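{- Let $\varepsilon>0$. For the maximum weight $b$-matching problem in the semi-streaming model, there is a $(2+\varepsilon)$-approximation algorithm using $O\left(\log_{1+\varepsilon}(W/\varepsilon)\cdot|M_{max}|\right)$ variables in memory, and another $(2+\varepsilon)$-approximation algorithm using $O\left(\log_{1+\varepsilon}(1/\varepsilon)\cdot|M_{max}|+\sum_{v\in V}b_v\right)$ variables in memory. Here $M_{max}$ denotes a maximum cardinality $b$-matching and $W$ denotes the maximum ratio between two non-zero weights.
   Context: $G=(V,E)$ is a multigraph without self-loops, and each vertex $v\in V$ has a capacity $b_v\in\mathbb{Z}_{+}$. A $b$-matching is a set $M\subseteq E$ such that each vertex $v$ has at most $b_v$ incident edges in $M$. Edges have weights $w:E\to\mathbb{R}_{+}$, and $w(M)=\sum_{e\in M}w(e)$. The maximum weight $b$-matching problem asks for a $b$-matching $M$ maximizing $w(M)$. An algorithm is an $\alpha$-approximation if it outputs a $b$-matching $M$ with $\alpha\, w(M)\ge w(M^{opt})$, where $M^{opt}$ is an optimal $b$-matching. In the semi-streaming model, the edges of $E$ arrive one by one over time and the algorithm has only limited memory (ideally proportional to the output size), so it cannot store all of $E$; memory is counted as the number of variables used.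
   Formalization: In the first memory bound the logarithm is read as max(1, ⌈log_{1+ε}(W/ε)⌉), since for ε ≥ W it is at most 0 and the literal bound would forbid storing anything; for ε ≤ 1/2 this agrees with the stated bound up to a constant factor. -}

module Defs where

open import Algebra.Bundles using (CommutativeRing; Semiring)
open import Algebra.Core using (Op₁; Op₂)
open import Algebra.Structures using (IsCommutativeRing)
import Algebra.Definitions.RawMonoid as RawMonoidDefs
import Algebra.Definitions.RawSemiring as RawSemiringDefs
open import Data.Bool using (Bool; _∨_; if_then_else_)
open import Data.Fin using (Fin; _≟_)
open import Data.Fin.Subset using (Subset; ⊥; ⁅_⁆; _∪_; _∩_; ∣_∣)
open import Data.List using (List; []; _∷_; length; foldl; map; filter; allFin; cartesianProduct)
open import Data.List.Membership.Propositional using (_∈_)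
open import Data.List.Relation.Unary.All as All using (All; []; _∷_)
import Data.List.Extrema as Extrema
open import Data.Nat as ℕ using (ℕ)
open import Data.Product using (_×_; _,_; proj₁; proj₂; ∃-syntax)
open import Data.Vec using (lookup; tabulate)
open import Level using (Level; suc; _⊔_)
open import Relation.Binary using (Rel; IsDecTotalOrder; TotalOrder)
import Relation.Binary.Construct.NonStrictToStrict as NonStrictToStrict
open import Relation.Binary.PropositionalEquality using (_≢_)
open import Relation.Nullary using (¬_; Dec; does)
open import Relation.Nullary.Decidable using (¬?; _×-dec_)

-- The interface through which real numbers are used.  ℝ, with its classical
-- order, is an Archimedean ordered field.  _⁻¹ is total; its value at 0# is
-- unspecified and never used.

record ArchimedeanOrderedField (c ℓ₁ ℓ₂ : Level) : Set (suc (c ⊔ ℓ₁ ⊔ ℓ₂)) where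
  infix  8 -_ _⁻¹
  infixl 7 _*_
  infixl 6 _+_
  infix  4 _≈_ _≤_
  field
    Carrier           : Set c
    _≈_               : Rel Carrier ℓ₁
    _≤_               : Rel Carrier ℓ₂
    _+_ _*_           : Op₂ Carrier
    -_ _⁻¹            : Op₁ Carrier
    0# 1#             : Carrier
    isCommutativeRing : IsCommutativeRing _≈_ _+_ _*_ -_ 0# 1#
    isDecTotalOrder   : IsDecTotalOrder _≈_ _≤_
    0≉1               : ¬ (0# ≈ 1#)
    ⁻¹-inverseʳ       : ∀ x → ¬ (x ≈ 0#) → x * x ⁻¹ ≈ 1#
    +-monoˡ-≤         : ∀ z {x y} → x ≤ y → x + z ≤ y + z
    *-nonNegative     : ∀ {x y} → 0# ≤ x → 0# ≤ y → 0# ≤ x * y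

  commutativeRing : CommutativeRing c ℓ₁
  commutativeRing = record { isCommutativeRing = isCommutativeRing }

  open CommutativeRing commutativeRing public using (_-_; +-rawMonoid; semiring)
  open IsDecTotalOrder isDecTotalOrder public using (_≤?_; isTotalOrder) renaming (_≟_ to _≈?_)

  totalOrder : TotalOrder c ℓ₁ ℓ₂
  totalOrder = record { isTotalOrder = isTotalOrder }

  open NonStrictToStrict _≈_ _≤_ public using (_<_)
  open RawMonoidDefs +-rawMonoid public using (sum) renaming (_×_ to _·_)
  open RawSemiringDefs (Semiring.rawSemiring semiring) public using (_^_)

  field
    archimedean : ∀ x → ∃[ k ] x ≤ k · 1#

  infixl 7 _÷_
  _÷_ : Op₂ Carrier
  x ÷ y = x * y ⁻¹

  -- k = ⌈log_β x⌉ when x ≥ 1, and k = 0 when x ≤ 1 (for β > 1).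
  IsCeilLog : Carrier → Carrier → ℕ → Set ℓ₂
  IsCeilLog β x k = x ≤ β ^ k × (∀ j → x ≤ β ^ j → k ℕ.≤ j)

module BMatching {c ℓ₁ ℓ₂} (R : ArchimedeanOrderedField c ℓ₁ ℓ₂) where
  open ArchimedeanOrderedField R

  -- A multigraph together with an arrival order: edge e arrives at time e.
  record Multigraph (n m : ℕ) : Set (c ⊔ ℓ₂) where
    field
      ends     : Fin m → Fin n × Fin n
      loopless : ∀ e → proj₁ (ends e) ≢ proj₂ (ends e)
      weight   : Fin m → Carrier
      weight≥0 : ∀ e → 0# ≤ weight e

    incident : Fin n → Subset m
    incident v = tabulate λ e → does (v ≟ proj₁ (ends e)) ∨ does (v ≟ proj₂ (ends e))

    totalWeight : Subset m → Carrier
    totalWeight M = sum λ e → if lookup M e then weight e else 0#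

    -- The 1# changes nothing when some weight is non-zero, as the ratio of
    -- that weight to itself is 1; otherwise it fixes the value to 1.
    maxRatio : Carrier
    maxRatio = Extrema.max totalOrder 1#
      (map (λ (e , f) → weight e ÷ weight f) (filter nonZero? (cartesianProduct (allFin m) (allFin m))))
      where
      nonZero? : (p : Fin m × Fin m) → Dec (¬ (weight (proj₁ p) ≈ 0#) × ¬ (weight (proj₂ p) ≈ 0#))
      nonZero? (e , f) = ¬? (weight e ≈? 0#) ×-dec ¬? (weight f ≈? 0#)

  open Multigraph

  module _ {n m : ℕ} (b : Fin n → ℕ) (G : Multigraph n m) where

    IsBMatching : Subset m → Set
    IsBMatching M = ∀ v → ∣ M ∩ incident G v ∣ ℕ.≤ b v

    IsMaximumCardinality : Subset m → Set
    IsMaximumCardinality M = IsBMatching M × (∀ N → IsBMatching N → ∣ N ∣ ℕ.≤ ∣ M ∣)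

    IsMaximumWeight : Subset m → Set ℓ₂
    IsMaximumWeight M = IsBMatching M × (∀ N → IsBMatching N → totalWeight G N ≤ totalWeight G M)

    IsApproximation : Carrier → Subset m → Set ℓ₂
    IsApproximation α M =
      IsBMatching M × (∀ Mᵒᵖᵗ → IsMaximumWeight Mᵒᵖᵗ → totalWeight G Mᵒᵖᵗ ≤ α * totalWeight G M)

  -- Memory is a list of variables, each holding one edge or one number.  To
  -- keep the count of variables meaningful, programs cannot pack data into a
  -- variable: edges are opaque tokens, of which only the ends and the weight
  -- can be read, and numbers are only added, subtracted, multiplied and
  -- compared, in computation trees of finite depth.

  data Ty : Set where
    edge num : Ty

  Ctx : Set
  Ctx = List Ty

  -- Γ lists the variables.  I lists the read-only input registers, which are
  -- not counted: the arriving edge during an arrival, none afterwards.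
  data Operand (I Γ : Ctx) (τ : Ty) : Set where
    var : τ ∈ Γ → Operand I Γ τ
    inp : τ ∈ I → Operand I Γ τ

  data Expr (I Γ : Ctx) : Ty → Set c where
    get         : ∀ {τ} → Operand I Γ τ → Expr I Γ τ
    const       : Carrier → Expr I Γ num
    weightOf    : Operand I Γ edge → Expr I Γ num
    add sub mul : Operand I Γ num → Operand I Γ num → Expr I Γ num

  -- assign replaces the whole memory by Δ, which covers allocating, freeing,
  -- moving and updating variables.  onEnds branches on the two end vertices.
  data Program (n : ℕ) (I Γ : Ctx) : Set c where
    halt   : Program n I Γ
    assign : ∀ {Δ} → All (Expr I Γ) Δ → Program n I Δ → Program n I Γ
    if≤    : (x y : Operand I Γ num) → (yes no : Program n I Γ) → Program n I Γ
    onEnds : Operand I Γ edge → (Fin n → Fin n → Program n I Γ) → Program n I Γ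

  -- The position inside a program is lost between two arrivals: only the
  -- variables, with their number and types, persist.  Neither the number of edges nor any bound on the
  -- weights is known in advance.
  record StreamingProgram (n : ℕ) : Set c where
    field
      onArrival : ∀ Γ → Program n (edge ∷ []) Γ
      finish    : ∀ Γ → Program n [] Γ

  StreamingAlgorithm : Set c
  StreamingAlgorithm = ∀ n (b : Fin n → ℕ) → StreamingProgram n

  data Value (m : ℕ) : Ty → Set c where
    edge : Fin m → Value m edge
    num  : Carrier → Value m num

  toEdge : ∀ {m} → Value m edge → Fin m
  toEdge (edge e) = e

  toNumber : ∀ {m} → Value m num → Carrier
  toNumber (num r) = r

  Memory : ℕ → Ctx → Set c
  Memory m = All (Value m)

  -- peak is the largest number of variables in use so far.
  record Config (m : ℕ) : Set c where
    constructor config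
    field
      peak      : ℕ
      {context} : Ctx
      memory    : Memory m context

  module Execution {n m : ℕ} (G : Multigraph n m) where

    module _ {I : Ctx} (ι : Memory m I) where

      value : ∀ {Γ τ} → Memory m Γ → Operand I Γ τ → Value m τ
      value μ (var x) = All.lookup μ x
      value μ (inp x) = All.lookup ι x

      number : ∀ {Γ} → Memory m Γ → Operand I Γ num → Carrier
      number μ x = toNumber (value μ x)

      edgeId : ∀ {Γ} → Memory m Γ → Operand I Γ edge → Fin m
      edgeId μ x = toEdge (value μ x)

      eval : ∀ {Γ τ} → Memory m Γ → Expr I Γ τ → Value m τ
      eval μ (get x)      = value μ x
      eval μ (const r)    = num r
      eval μ (weightOf x) = num (weight G (edgeId μ x))
      eval μ (add x y)    = num (number μ x + number μ y)
      eval μ (sub x y)    = num (number μ x - number μ y)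
      eval μ (mul x y)    = num (number μ x * number μ y)

      exec : ∀ {Γ} → Program n I Γ → ℕ → Memory m Γ → Config m
      exec {Γ} halt          p μ = config (p ℕ.⊔ length Γ) μ
      exec {Γ} (assign es P) p μ = exec P (p ℕ.⊔ length Γ) (All.map (eval μ) es)
      exec (if≤ x y P Q)     p μ = if does (number μ x ≤? number μ y) then exec P p μ else exec Q p μ
      exec (onEnds x P)      p μ = let e = edgeId μ x in exec (P (proj₁ (ends G e)) (proj₂ (ends G e))) p μ

    module _ (A : StreamingProgram n) where
      open StreamingProgram A

      arrive : Config m → Fin m → Config m
      arrive (config p {Γ} μ) e = exec (edge e ∷ []) (onArrival Γ) p μ

      run : Config m
      run = exec [] (finish (Config.context end)) (Config.peak end) (Config.memory end)
        where end = foldl arrive (config 0 []) (allFin m)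

    storedEdges : ∀ {Γ} → Memory m Γ → Subset m
    storedEdges []           = ⊥
    storedEdges (edge e ∷ μ) = ⁅ e ⁆ ∪ storedEdges μ
    storedEdges (num _ ∷ μ)  = storedEdges μ

  module _ {n m : ℕ} (A : StreamingAlgorithm) (b : Fin n → ℕ) (G : Multigraph n m) where
    open Execution G

    -- The edges in memory at the end are the output, so that storing the
    -- output is paid for.
    output : Subset m
    output = storedEdges (Config.memory (run (A n b)))

    memoryUsed : ℕ
    memoryUsed = Config.peak (run (A n b))

{-# OPTIONS --safe #-}

-- Local ratio on slots.  A vertex v owns b v slots, each with a potential,
-- initially 0.  An arriving edge is compared with the least potentials p and q
-- at its two ends.  If its weight w is at most (1 + δ)(p + q) it is discarded;
-- otherwise it is stored, and the two slots are raised to w - q and w - p,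
-- that is, both by the gain w - p - q.  At the end the stored edges are taken
-- greedily, newest first, at most one for each slot.
--
-- Let S be the sum of the final potentials.  They form a dual solution, so
-- every b-matching weighs at most (1 + δ) S.  A stored edge weighs at least
-- the gains of itself and of all older edges in its slots, so the output weighs
-- at least the sum of all gains, which is S / 2.  An edge whose raised value is
-- at most θ times the present potential of one of its slots can be dropped,
-- unless it is the newest edge of a slot: this loses at most θ S of the gains.
-- Values in a slot grow by factors 1 + δ, which bounds the number of edges in
-- each slot: by the weight ratio when nothing is dropped (θ = 0), and in terms
-- of θ and δ otherwise.  A greedy choice of one edge for each slot then bounds
-- the number of stored edges by the size of a b-matching.

module Submission where

open import Defs
open import Data.Fin using (Fin)
open import Data.Fin.Subset using (Subset; ∣_∣)
open import Data.Nat as ℕ using (ℕ)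
open import Data.Product using (_×_; Σ-syntax; ∃-syntax)
open import Data.Vec as Vec using (tabulate)

open import Algebra.Bundles using (CommutativeRing)
import Algebra.Properties.Semiring.Exp as ExpProperties
import Algebra.Solver.Ring.NaturalCoefficients.Default as SemiringSolver
open import Data.Bool using (Bool; true; false; _∧_; _∨_; not; if_then_else_)
open import Data.Bool.ListAction using (any)
open import Data.Bool.Properties using (∧-identityʳ; ∨-zeroʳ; if-float; not-injective)
open import Data.Empty using (⊥-elim)
open import Data.Fin as Fin using (zero; suc)
open import Data.Fin.Subset using (⁅_⁆; _∪_; _∩_) renaming (⊥ to ∅)
open import Data.Fin.Subset.Properties using (x∈⁅x⁆; x∈⁅y⁆⇒x≡y)
open import Data.List as List
  using (List; []; _∷_; _++_; length; map; foldl; filter; filterᵇ; concatMap; cartesianProduct; allFin; upTo)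
import Data.List.Extrema as Extrema
open import Data.List.Membership.Propositional using (_∈_; lose)
open import Data.List.Membership.Propositional.Properties
  using (∈-allFin; ∈-cartesianProduct⁺; ∈-concatMap⁺; ∈-filter⁺; ∈-map⁺; ∈-upTo⁺; ∈-upTo⁻)
open import Data.List.Properties using (length-upTo)
open import Data.List.Relation.Binary.Pointwise using (Pointwise; []; _∷_)
open import Data.List.Relation.Unary.All as All using (All; []; _∷_)
open import Data.List.Relation.Unary.AllPairs using (AllPairs; []; _∷_)
open import Data.List.Relation.Unary.Any using (here; there)
open import Data.List.Relation.Unary.Unique.Propositional using (Unique)
open import Data.List.Relation.Unary.Unique.Propositional.Properties using (allFin⁺; upTo⁺)
open import Data.Maybe using (Maybe; just; nothing; maybe′)
open import Data.Nat using (zero; suc)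
import Data.Nat.Properties as ℕ
open import Data.Nat.Solver using (module +-*-Solver)
open import Data.Product using (_,_; proj₁; proj₂)
open import Data.Product.Properties using (≡-dec)
open import Data.Sum using (_⊎_; inj₁; inj₂)
open import Data.Unit.Polymorphic using (⊤; tt)
open import Data.Vec using ([]; _∷_; lookup)
open import Data.Vec.Properties using (lookup-replicate; lookup-zipWith; lookup∘tabulate; lookup⇒[]=; []=⇒lookup)
open import Function using (_∘_)
open import Level using (_⊔_)
open import Relation.Binary using (DecidableEquality; IsDecTotalOrder)
open import Relation.Binary.PropositionalEquality as ≡ using (_≡_; _≢_; refl)
open import Relation.Nullary using (¬_; Dec; does; yes; no)

-- Weak duality is the delicate step. The linear program of the problem has, besides a constraint
-- for each vertex, the constraint that an edge is used at most once, so its dual has a variable for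
-- each vertex and one for each edge. The least potential at a vertex serves as the vertex variable,
-- and what a slot has above that minimum is credited to the newest edge of the slot. This is why an
-- arriving edge must go into slots of least potential: a slot is overwritten only when its old
-- potential is a lower bound for all slots of the vertex, and from then on the overwritten edge can
-- be paid by any of them. Two features of the memory bounds shape the program. The first bound has
-- no term for the capacities, so potentials cannot have variables of their own; they are read off
-- the newest stored entry of each slot, which is why these entries may not be dropped. Nor is there
-- an additive constant: if no edge has positive capacity at both ends, the first bound is zero, and
-- the program must do without a single variable.

module OrderedField {c ℓ₁ ℓ₂} (R : ArchimedeanOrderedField c ℓ₁ ℓ₂) where
  open ArchimedeanOrderedField R public
  open CommutativeRing commutativeRing public
    using (+-cong; *-cong; +-comm; *-comm; +-assoc; *-assoc; +-identityˡ; +-identityʳ; *-identityˡ; *-identityʳ;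
           distribˡ; distribʳ; zeroˡ; zeroʳ; -‿inverseʳ; -‿inverseˡ; commutativeSemiring)
    renaming (refl to ≈-refl; sym to ≈-sym; trans to ≈-trans; reflexive to ≈-reflexive)
  open IsDecTotalOrder isDecTotalOrder public
    using (total; antisym) renaming (refl to ≤-refl; trans to ≤-trans; reflexive to ≤-reflexive)
  module Solver = SemiringSolver commutativeSemiring
  open Solver using (solve; _:+_; _:*_; _:=_; con)

  -- Arithmetic in an ordered field.

  +-monoʳ-≤ : ∀ z {x y} → x ≤ y → z + x ≤ z + y
  +-monoʳ-≤ z {x} {y} x≤y =
    ≤-trans (≤-reflexive (+-comm z x)) (≤-trans (+-monoˡ-≤ z x≤y) (≤-reflexive (+-comm y z)))

  +-mono-≤ : ∀ {x y u v} → x ≤ y → u ≤ v → x + u ≤ y + v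
  +-mono-≤ {y = y} {u} x≤y u≤v = ≤-trans (+-monoˡ-≤ u x≤y) (+-monoʳ-≤ y u≤v)

  x+z-z≈x : ∀ x z → x + z - z ≈ x
  x+z-z≈x x z = ≈-trans (+-assoc x z (- z)) (≈-trans (+-cong ≈-refl (-‿inverseʳ z)) (+-identityʳ x))

  x-z+z≈x : ∀ x z → x - z + z ≈ x
  x-z+z≈x x z = ≈-trans (+-assoc x (- z) z) (≈-trans (+-cong ≈-refl (-‿inverseˡ z)) (+-identityʳ x))

  +-cancelʳ-≤ : ∀ z {x y} → x + z ≤ y + z → x ≤ y
  +-cancelʳ-≤ z {x} {y} h =
    ≤-trans (≤-reflexive (≈-sym (x+z-z≈x x z))) (≤-trans (+-monoˡ-≤ (- z) h) (≤-reflexive (x+z-z≈x y z)))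

  +-cancelʳ-≈ : ∀ z {x y} → x + z ≈ y + z → x ≈ y
  +-cancelʳ-≈ z {x} {y} h =
    ≈-trans (≈-sym (x+z-z≈x x z)) (≈-trans (+-cong h ≈-refl) (x+z-z≈x y z))

  -- b - a = y - x in a form without subtraction.
  ≤-by-difference : ∀ {x y a b} → x ≤ y → a + y ≈ b + x → a ≤ b
  ≤-by-difference {x} {y} {a} {b} x≤y eq =
    +-cancelʳ-≤ y (≤-trans (≤-reflexive eq) (+-monoʳ-≤ b x≤y))

  x≤x+y : ∀ {x y} → 0# ≤ y → x ≤ x + y
  x≤x+y {x} {y} 0≤y = ≤-trans (≤-reflexive (≈-sym (+-identityʳ x))) (+-monoʳ-≤ x 0≤y)

  x≤y+x : ∀ {x y} → 0# ≤ y → x ≤ y + x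
  x≤y+x {x} {y} 0≤y = ≤-trans (x≤x+y 0≤y) (≤-reflexive (+-comm x y))

  +-nonNegative : ∀ {x y} → 0# ≤ x → 0# ≤ y → 0# ≤ x + y
  +-nonNegative 0≤x 0≤y = ≤-trans 0≤x (x≤x+y 0≤y)

  y≤x⇒0≤x-y : ∀ {x y} → y ≤ x → 0# ≤ x - y
  y≤x⇒0≤x-y {x} {y} y≤x =
    +-cancelʳ-≤ y (≤-trans (≤-reflexive (+-identityˡ y)) (≤-trans y≤x (≤-reflexive (≈-sym (x-z+z≈x x y)))))

  *-monoˡ-≤ : ∀ {z} → 0# ≤ z → ∀ {x y} → x ≤ y → x * z ≤ y * z
  *-monoˡ-≤ {z} 0≤z {x} {y} x≤y =
    ≤-trans (x≤x+y (*-nonNegative (y≤x⇒0≤x-y x≤y) 0≤z))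
      (≤-reflexive (≈-trans (≈-sym (distribʳ z x (y - x)))
        (*-cong (≈-trans (+-comm x (y - x)) (x-z+z≈x y x)) ≈-refl)))

  *-monoʳ-≤ : ∀ {z} → 0# ≤ z → ∀ {x y} → x ≤ y → z * x ≤ z * y
  *-monoʳ-≤ {z} 0≤z {x} {y} x≤y =
    ≤-trans (≤-reflexive (*-comm z x)) (≤-trans (*-monoˡ-≤ 0≤z x≤y) (≤-reflexive (*-comm y z)))

  *-mono-≤ : ∀ {x y u v} → 0# ≤ u → 0# ≤ y → x ≤ y → u ≤ v → x * u ≤ y * v
  *-mono-≤ 0≤u 0≤y x≤y u≤v = ≤-trans (*-monoˡ-≤ 0≤u x≤y) (*-monoʳ-≤ 0≤y u≤v)

  ≰⇒≥ : ∀ {x y} → ¬ (x ≤ y) → y ≤ x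
  ≰⇒≥ {x} {y} x≰y with total x y
  ... | inj₁ x≤y = ⊥-elim (x≰y x≤y)
  ... | inj₂ y≤x = y≤x

  <⇒≱ : ∀ {x y} → x < y → ¬ (y ≤ x)
  <⇒≱ (x≤y , x≉y) y≤x = x≉y (antisym x≤y y≤x)

  ≰⇒> : ∀ {x y} → ¬ (x ≤ y) → y < x
  ≰⇒> x≰y = ≰⇒≥ x≰y , λ y≈x → x≰y (≤-reflexive (≈-sym y≈x))

  <-≤-trans : ∀ {x y z} → x < y → y ≤ z → x < z
  <-≤-trans (x≤y , x≉y) y≤z = ≤-trans x≤y y≤z , λ x≈z → x≉y (antisym x≤y (≤-trans y≤z (≤-reflexive (≈-sym x≈z))))

  ≤-<-trans : ∀ {x y z} → x ≤ y → y < z → x < z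
  ≤-<-trans x≤y (y≤z , y≉z) = ≤-trans x≤y y≤z , λ x≈z → y≉z (antisym y≤z (≤-trans (≤-reflexive (≈-sym x≈z)) x≤y))

  0≤1 : 0# ≤ 1#
  0≤1 with total 0# 1#
  ... | inj₁ h = h
  ... | inj₂ 1≤0 = ≤-trans (*-nonNegative 0≤-1 0≤-1) (≤-reflexive -1*-1≈1)
    where
    0≤-1 : 0# ≤ - 1#
    0≤-1 = +-cancelʳ-≤ 1#
      (≤-trans (≤-reflexive (+-identityˡ 1#)) (≤-trans 1≤0 (≤-reflexive (≈-sym (-‿inverseˡ 1#)))))
    -1*-1≈1 : - 1# * - 1# ≈ 1#
    -1*-1≈1 = +-cancelʳ-≈ (- 1#)
      (≈-trans (+-cong ≈-refl (≈-sym (*-identityʳ (- 1#))))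
      (≈-trans (≈-sym (distribˡ (- 1#) (- 1#) 1#))
      (≈-trans (*-cong ≈-refl (-‿inverseˡ 1#)) (≈-trans (zeroʳ (- 1#)) (≈-sym (-‿inverseʳ 1#))))))

  0<1 : 0# < 1#
  0<1 = 0≤1 , 0≉1

  0≤x⁻¹ : ∀ {x} → 0# < x → 0# ≤ x ⁻¹
  0≤x⁻¹ {x} (0≤x , 0≉x) with total 0# (x ⁻¹)
  ... | inj₁ h = h
  ... | inj₂ x⁻¹≤0 = ⊥-elim (<⇒≱ 0<1
          (≤-trans (≤-reflexive (≈-sym (⁻¹-inverseʳ x (λ x≈0 → 0≉x (≈-sym x≈0)))))
          (≤-trans (*-monoʳ-≤ 0≤x x⁻¹≤0) (≤-reflexive (zeroʳ x)))))

  x*y*y⁻¹≈x : ∀ x {y} → 0# < y → x * y * y ⁻¹ ≈ x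
  x*y*y⁻¹≈x x {y} (_ , 0≉y) =
    ≈-trans (*-assoc x y (y ⁻¹))
      (≈-trans (*-cong ≈-refl (⁻¹-inverseʳ y (λ y≈0 → 0≉y (≈-sym y≈0)))) (*-identityʳ x))

  x÷y*y≈x : ∀ x {y} → 0# < y → x ÷ y * y ≈ x
  x÷y*y≈x x {y} 0<y =
    ≈-trans (solve 3 (λ x y z → x :* z :* y := x :* y :* z) ≈-refl x y (y ⁻¹)) (x*y*y⁻¹≈x x 0<y)

  *-cancelʳ-≤ : ∀ {z} → 0# < z → ∀ {x y} → x * z ≤ y * z → x ≤ y
  *-cancelʳ-≤ {z} 0<z {x} {y} h =
    ≤-trans (≤-reflexive (≈-sym (x*y*y⁻¹≈x x 0<z)))
      (≤-trans (*-monoˡ-≤ (0≤x⁻¹ 0<z) h) (≤-reflexive (x*y*y⁻¹≈x y 0<z)))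

  x÷y≤z⇒x≤z*y : ∀ {x y z} → 0# < y → x ÷ y ≤ z → x ≤ z * y
  x÷y≤z⇒x≤z*y {x} 0<y h = ≤-trans (≤-reflexive (≈-sym (x÷y*y≈x x 0<y))) (*-monoˡ-≤ (proj₁ 0<y) h)

  0≤k·x : ∀ {x} → 0# ≤ x → ∀ k → 0# ≤ k · x
  0≤k·x 0≤x zero    = ≤-refl
  0≤k·x 0≤x (suc k) = +-nonNegative 0≤x (0≤k·x 0≤x k)

  ·1-mono-≤ : ∀ {j k} → j ℕ.≤ k → j · 1# ≤ k · 1#
  ·1-mono-≤ {k = k} ℕ.z≤n = 0≤k·x 0≤1 k
  ·1-mono-≤ (ℕ.s≤s j≤k) = +-monoʳ-≤ 1# (·1-mono-≤ j≤k)

  -- The way back to ℕ: cardinality bounds below are proved as inequalities between sums of `1#` in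
  -- the field, so that weights and counts share the same lemmas on sums.
  ·1-cancel-≤ : ∀ j k → j · 1# ≤ k · 1# → j ℕ.≤ k
  ·1-cancel-≤ zero    k       h = ℕ.z≤n
  ·1-cancel-≤ (suc j) zero    h = ⊥-elim (<⇒≱ 0<1 (≤-trans (x≤x+y (0≤k·x 0≤1 j)) h))
  ·1-cancel-≤ (suc j) (suc k) h = ℕ.s≤s (·1-cancel-≤ j k (+-cancelʳ-≤ 1#
    (≤-trans (≤-reflexive (+-comm _ _)) (≤-trans h (≤-reflexive (+-comm _ _))))))

  ·1-+ : ∀ j k → (j ℕ.+ k) · 1# ≈ j · 1# + k · 1#
  ·1-+ zero    k = ≈-sym (+-identityˡ _)
  ·1-+ (suc j) k = ≈-trans (+-cong ≈-refl (·1-+ j k)) (≈-sym (+-assoc 1# _ _))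

  ·1-* : ∀ j k → (j ℕ.* k) · 1# ≈ j · (k · 1#)
  ·1-* zero    k = ≈-refl
  ·1-* (suc j) k = ≈-trans (·1-+ k (j ℕ.* k)) (+-cong ≈-refl (·1-* j k))

  ·-congʳ : ∀ k {x y} → x ≈ y → k · x ≈ k · y
  ·-congʳ zero    x≈y = ≈-refl
  ·-congʳ (suc k) x≈y = +-cong x≈y (·-congʳ k x≈y)

  ·-monoˡ-≤ : ∀ {j k} → j ℕ.≤ k → ∀ {x} → 0# ≤ x → j · x ≤ k · x
  ·-monoˡ-≤ {k = k} ℕ.z≤n 0≤x = 0≤k·x 0≤x k
  ·-monoˡ-≤ (ℕ.s≤s j≤k) {x} 0≤x = +-monoʳ-≤ x (·-monoˡ-≤ j≤k 0≤x)

  open ExpProperties semiring public using (^-homo-*; ^-congˡ; ^-assocʳ)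

  1≤x^k : ∀ {x} → 1# ≤ x → ∀ k → 1# ≤ x ^ k
  1≤x^k 1≤x zero    = ≤-refl
  1≤x^k 1≤x (suc k) = ≤-trans (≤-reflexive (≈-sym (*-identityˡ 1#)))
    (*-mono-≤ 0≤1 (≤-trans 0≤1 1≤x) 1≤x (1≤x^k 1≤x k))

  0≤x^k : ∀ {x} → 0# ≤ x → ∀ k → 0# ≤ x ^ k
  0≤x^k 0≤x zero    = 0≤1
  0≤x^k 0≤x (suc k) = *-nonNegative 0≤x (0≤x^k 0≤x k)

  ^-monoˡ-≤ : ∀ k {x y} → 0# ≤ x → x ≤ y → x ^ k ≤ y ^ k
  ^-monoˡ-≤ zero    0≤x x≤y = ≤-refl
  ^-monoˡ-≤ (suc k) 0≤x x≤y = *-mono-≤ (0≤x^k 0≤x k) (≤-trans 0≤x x≤y) x≤y (^-monoˡ-≤ k 0≤x x≤y)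

  ^-monoʳ-≤ : ∀ {x} → 1# ≤ x → ∀ {j k} → j ℕ.≤ k → x ^ j ≤ x ^ k
  ^-monoʳ-≤ 1≤x {k = k} ℕ.z≤n = 1≤x^k 1≤x k
  ^-monoʳ-≤ 1≤x (ℕ.s≤s j≤k)   = *-monoʳ-≤ (≤-trans 0≤1 1≤x) (^-monoʳ-≤ 1≤x j≤k)

  -- Plays the part of the logarithm: the number of entries in a slot is bounded by comparing powers
  -- of `1# + δ`.
  ^-cancel-≤ : ∀ {x} → 1# < x → ∀ j k → x ^ j ≤ x ^ k → j ℕ.≤ k
  ^-cancel-≤ 1<x zero k h = ℕ.z≤n
  ^-cancel-≤ {x} 1<x (suc j) zero h = ⊥-elim (<⇒≱ 1<x
    (≤-trans (≤-reflexive (≈-sym (*-identityʳ x)))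
      (≤-trans (*-monoʳ-≤ (≤-trans 0≤1 (proj₁ 1<x)) (1≤x^k (proj₁ 1<x) j)) h)))
  ^-cancel-≤ {x} 1<x (suc j) (suc k) h = ℕ.s≤s (^-cancel-≤ 1<x j k (*-cancelʳ-≤ (<-≤-trans 0<1 (proj₁ 1<x))
    (≤-trans (≤-reflexive (*-comm _ x)) (≤-trans h (≤-reflexive (*-comm x _))))))

  bernoulli : ∀ {x} → 0# ≤ x → ∀ k → 1# + k · x ≤ (1# + x) ^ k
  bernoulli {x} 0≤x zero    = ≤-reflexive (+-identityʳ 1#)
  bernoulli {x} 0≤x (suc k) = ≤-trans
    (≤-by-difference (*-nonNegative 0≤x (0≤k·x 0≤x k))
      (solve 2 (λ x y → con 1 :+ (x :+ y) :+ x :* y := (con 1 :+ x) :* (con 1 :+ y) :+ con 0) ≈-refl x (k · x)))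
    (*-monoʳ-≤ (+-nonNegative 0≤1 0≤x) (bernoulli 0≤x k))

-- Finite sums over lists, with boolean indicators.

module ListSum {c ℓ₁ ℓ₂} (R : ArchimedeanOrderedField c ℓ₁ ℓ₂) where
  open OrderedField R
  open Solver using (solve; _:+_; _:=_)

  ∑ : ∀ {a} {A : Set a} → List A → (A → Carrier) → Carrier
  ∑ []       f = 0#
  ∑ (x ∷ xs) f = f x + ∑ xs f

  when : Bool → Carrier → Carrier
  when p x = if p then x else 0#

  when≥0 : ∀ p {x} → 0# ≤ x → 0# ≤ when p x
  when≥0 true  0≤x = 0≤x
  when≥0 false 0≤x = ≤-refl

  when≤ : ∀ p {x} → 0# ≤ x → when p x ≤ x
  when≤ true  0≤x = ≤-refl
  when≤ false 0≤x = 0≤x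

  when-mono-≤ : ∀ p {x y} → (p ≡ true → x ≤ y) → when p x ≤ when p y
  when-mono-≤ true  x≤y = x≤y refl
  when-mono-≤ false x≤y = ≤-refl

  when-implies : ∀ p q {x} → (p ≡ true → q ≡ true) → 0# ≤ x → when p x ≤ when q x
  when-implies true  q p⇒q 0≤x = ≤-reflexive (≈-reflexive (≡.cong (λ q → when q _) (≡.sym (p⇒q refl))))
  when-implies false q p⇒q 0≤x = when≥0 q 0≤x

  when-∨ : ∀ p q {x} → 0# ≤ x → when (p ∨ q) x ≤ when p x + when q x
  when-∨ true  q 0≤x = x≤x+y (when≥0 q 0≤x)
  when-∨ false q 0≤x = ≤-reflexive (≈-sym (+-identityˡ _))

  when-∧ : ∀ p q {x} → when (p ∧ q) x ≈ when p (when q x)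
  when-∧ true  q = ≈-refl
  when-∧ false q = ≈-refl

  when-+ : ∀ p {x y} → when p (x + y) ≈ when p x + when p y
  when-+ true  = ≈-refl
  when-+ false = ≈-sym (+-identityˡ 0#)

  module _ {a} {A : Set a} where

    ∑-mono-∈ : ∀ (xs : List A) {f g} → (∀ {x} → x ∈ xs → f x ≤ g x) → ∑ xs f ≤ ∑ xs g
    ∑-mono-∈ []       h = ≤-refl
    ∑-mono-∈ (x ∷ xs) h = +-mono-≤ (h (here refl)) (∑-mono-∈ xs (h ∘ there))

    ∑-mono : ∀ (xs : List A) {f g} → (∀ x → f x ≤ g x) → ∑ xs f ≤ ∑ xs g
    ∑-mono xs h = ∑-mono-∈ xs λ {x} _ → h x

    ∑-cong : ∀ (xs : List A) {f g} → (∀ x → f x ≈ g x) → ∑ xs f ≈ ∑ xs g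
    ∑-cong []       h = ≈-refl
    ∑-cong (x ∷ xs) h = +-cong (h x) (∑-cong xs h)

    ∑-zero : ∀ (xs : List A) → ∑ xs (λ _ → 0#) ≈ 0#
    ∑-zero []       = ≈-refl
    ∑-zero (x ∷ xs) = ≈-trans (+-identityˡ _) (∑-zero xs)

    ∑≥0-∈ : ∀ (xs : List A) {f} → (∀ {x} → x ∈ xs → 0# ≤ f x) → 0# ≤ ∑ xs f
    ∑≥0-∈ xs h = ≤-trans (≤-reflexive (≈-sym (∑-zero xs))) (∑-mono-∈ xs h)

    ∑≥0 : ∀ (xs : List A) {f} → (∀ x → 0# ≤ f x) → 0# ≤ ∑ xs f
    ∑≥0 xs h = ∑≥0-∈ xs λ {x} _ → h x

    ∑-+ : ∀ (xs : List A) f g → ∑ xs (λ x → f x + g x) ≈ ∑ xs f + ∑ xs g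
    ∑-+ []       f g = ≈-sym (+-identityˡ 0#)
    ∑-+ (x ∷ xs) f g = ≈-trans (+-cong ≈-refl (∑-+ xs f g))
      (solve 4 (λ a b c d → (a :+ b) :+ (c :+ d) := (a :+ c) :+ (b :+ d)) ≈-refl (f x) (g x) (∑ xs f) (∑ xs g))

    ∑-* : ∀ (xs : List A) y f → ∑ xs (λ x → y * f x) ≈ y * ∑ xs f
    ∑-* []       y f = ≈-sym (zeroʳ y)
    ∑-* (x ∷ xs) y f = ≈-trans (+-cong ≈-refl (∑-* xs y f)) (≈-sym (distribˡ y (f x) (∑ xs f)))

    ∑-const : ∀ (xs : List A) y → ∑ xs (λ _ → y) ≈ length xs · y
    ∑-const []       y = ≈-refl
    ∑-const (x ∷ xs) y = +-cong ≈-refl (∑-const xs y)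

    ∑-filter : ∀ (p : A → Bool) (xs : List A) f → ∑ (filterᵇ p xs) f ≈ ∑ xs (λ x → when (p x) (f x))
    ∑-filter p []       f = ≈-refl
    ∑-filter p (x ∷ xs) f with p x
    ... | true  = +-cong ≈-refl (∑-filter p xs f)
    ... | false = ≈-trans (∑-filter p xs f) (≈-sym (+-identityˡ _))

    ∑-member-∈ : ∀ {xs : List A} {x} f → (∀ {x} → x ∈ xs → 0# ≤ f x) → x ∈ xs → f x ≤ ∑ xs f
    ∑-member-∈ {_ ∷ xs} f f≥0 (here refl)  = x≤x+y (∑≥0-∈ xs (f≥0 ∘ there))
    ∑-member-∈ {y ∷ xs} f f≥0 (there x∈xs) = ≤-trans (∑-member-∈ f (f≥0 ∘ there) x∈xs) (x≤y+x (f≥0 (here refl)))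

    ∑-member : ∀ {xs : List A} {x} f → (∀ x → 0# ≤ f x) → x ∈ xs → f x ≤ ∑ xs f
    ∑-member f f≥0 = ∑-member-∈ f λ {x} _ → f≥0 x

    ∑-empty : ∀ (xs : List A) (p : A → Bool) {y} → (∀ {x} → x ∈ xs → p x ≡ false) → ∑ xs (λ x → when (p x) y) ≤ 0#
    ∑-empty xs p {y} none = ≤-trans (∑-mono-∈ xs λ x∈xs → ≤-reflexive (≈-reflexive (≡.cong (λ p → when p y) (none x∈xs))))
      (≤-reflexive (∑-zero xs))

    ∑-atMostOne : ∀ {xs : List A} → Unique xs → ∀ (p : A → Bool) {y} → 0# ≤ y →
                  (∀ {x x′} → p x ≡ true → p x′ ≡ true → x ≡ x′) → ∑ xs (λ x → when (p x) y) ≤ y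
    ∑-atMostOne []                   p 0≤y one = 0≤y
    ∑-atMostOne {x ∷ xs} (x∉xs ∷ !xs) p {y} 0≤y one with p x in px
    ... | false = ≤-trans (≤-reflexive (+-identityˡ _)) (∑-atMostOne !xs p 0≤y one)
    ... | true  = ≤-trans (+-monoʳ-≤ y (∑-empty xs p none)) (≤-reflexive (+-identityʳ y))
      where
      none : ∀ {x′} → x′ ∈ xs → p x′ ≡ false
      none {x′} x′∈xs with p x′ in px′
      ... | false = refl
      ... | true  = ⊥-elim (All.lookup x∉xs x′∈xs (one px px′))

  ∑-swap : ∀ {a b} {A : Set a} {B : Set b} (xs : List A) (ys : List B) (f : A → B → Carrier) →
           ∑ xs (λ x → ∑ ys (λ y → f x y)) ≈ ∑ ys (λ y → ∑ xs (λ x → f x y))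
  ∑-swap []       ys f = ≈-sym (∑-zero ys)
  ∑-swap (x ∷ xs) ys f = ≈-trans (+-cong ≈-refl (∑-swap xs ys f)) (≈-sym (∑-+ ys (f x) (λ y → ∑ xs (λ x → f x y))))

  ∑-++ : ∀ {a} {A : Set a} (xs ys : List A) f → ∑ (xs ++ ys) f ≈ ∑ xs f + ∑ ys f
  ∑-++ []       ys f = ≈-sym (+-identityˡ _)
  ∑-++ (x ∷ xs) ys f = ≈-trans (+-cong ≈-refl (∑-++ xs ys f)) (≈-sym (+-assoc _ _ _))

  ∑-map : ∀ {a b} {A : Set a} {B : Set b} (g : A → B) (xs : List A) f → ∑ (map g xs) f ≡ ∑ xs (f ∘ g)
  ∑-map g []       f = refl
  ∑-map g (x ∷ xs) f = ≡.cong (f (g x) +_) (∑-map g xs f)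

  ∑-concatMap : ∀ {a b} {A : Set a} {B : Set b} (g : A → List B) (xs : List A) f →
                ∑ (concatMap g xs) f ≈ ∑ xs (λ x → ∑ (g x) f)
  ∑-concatMap g []       f = ≈-refl
  ∑-concatMap g (x ∷ xs) f = ≈-trans (∑-++ (g x) (concatMap g xs) f) (+-cong ≈-refl (∑-concatMap g xs f))

  ∑-tabulate : ∀ {a} {A : Set a} {m} (g : Fin m → A) f → ∑ (List.tabulate g) f ≡ sum (f ∘ g)
  ∑-tabulate {m = zero}  g f = refl
  ∑-tabulate {m = suc m} g f = ≡.cong (f (g zero) +_) (∑-tabulate (g ∘ suc) f)

  ∑-subset : ∀ {m} (p : Subset m) y → ∑ (allFin m) (λ e → when (lookup p e) y) ≈ ∣ p ∣ · y
  ∑-subset p y = ≈-trans (≈-reflexive (∑-tabulate (λ e → e) (λ e → when (lookup p e) y))) (sum-subset p)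
    where
    sum-subset : ∀ {m} (p : Subset m) → sum (λ e → when (lookup p e) y) ≈ ∣ p ∣ · y
    sum-subset []          = ≈-refl
    sum-subset (true ∷ p)  = +-cong ≈-refl (sum-subset p)
    sum-subset (false ∷ p) = ≈-trans (+-identityˡ _) (sum-subset p)

  ∑-vec : ∀ {n} (b : Fin n → ℕ) → ∑ (allFin n) (λ v → b v · 1#) ≈ Vec.sum (Vec.tabulate b) · 1#
  ∑-vec b = ≈-trans (≈-reflexive (∑-tabulate (λ v → v) (λ v → b v · 1#))) (sum-vec b)
    where
    sum-vec : ∀ {n} (b : Fin n → ℕ) → sum (λ v → b v · 1#) ≈ Vec.sum (Vec.tabulate b) · 1#
    sum-vec {zero}  b = ≈-refl
    sum-vec {suc n} b = ≈-trans (+-cong ≈-refl (sum-vec (b ∘ suc))) (≈-sym (·1-+ (b zero) _))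

-- Slots, entries and the greedy selection.

Slot : ℕ → Set
Slot n = Fin n × ℕ

_≟ˢ_ : ∀ {n} → DecidableEquality (Slot n)
_≟ˢ_ = ≡-dec Fin._≟_ ℕ._≟_

-- The algorithm runs on entries whose edges and numbers are actual ones; a
-- program handles entries whose edges and numbers are operands.
record Entry {a b} (n : ℕ) (E : Set a) (N : Set b) : Set (a ⊔ b) where
  constructor entry
  field
    arc           : E
    src dst       : Slot n
    srcPot dstPot : N

open Entry

module _ {a b} {n : ℕ} {E : Set a} {N : Set b} where

  touches : Slot n → Entry n E N → Bool
  touches s f = does (src f ≟ˢ s) ∨ does (dst f ≟ˢ s)

  -- Meaningful only at a slot that the entry touches: every slot other than the source falls to the
  -- destination potential.
  value : Slot n → Entry n E N → N
  value s f = if does (src f ≟ˢ s) then srcPot f else dstPot f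

  newest : Slot n → List (Entry n E N) → Maybe (Entry n E N)
  newest s []       = nothing
  newest s (f ∷ fs) = if touches s f then just f else newest s fs

  greedy : List (Slot n) → List (Entry n E N) → List (Entry n E N)
  greedy used []       = []
  greedy used (f ∷ fs) =
    if any (λ s → touches s f) used then greedy used fs else f ∷ greedy (src f ∷ dst f ∷ used) fs

  touches-src : ∀ f → touches (src f) f ≡ true
  touches-src f with src f ≟ˢ src f
  ... | yes _ = refl
  ... | no ¬p = ⊥-elim (¬p refl)

  touches-dst : ∀ f → touches (dst f) f ≡ true
  touches-dst f with src f ≟ˢ dst f | dst f ≟ˢ dst f
  ... | yes _ | _     = refl
  ... | no _  | yes _ = refl
  ... | no _  | no ¬p = ⊥-elim (¬p refl)

  value-src : ∀ f → value (src f) f ≡ srcPot f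
  value-src f with src f ≟ˢ src f
  ... | yes _ = refl
  ... | no ¬p = ⊥-elim (¬p refl)

  value-dst : ∀ f → src f ≢ dst f → value (dst f) f ≡ dstPot f
  value-dst f src≢dst with src f ≟ˢ dst f
  ... | yes p = ⊥-elim (src≢dst p)
  ... | no _  = refl

  touches⁻ : ∀ s f → touches s f ≡ true → src f ≡ s ⊎ dst f ≡ s
  touches⁻ s f h with src f ≟ˢ s | dst f ≟ˢ s
  ... | yes p | _     = inj₁ p
  ... | no _  | yes p = inj₂ p
  ... | no _  | no _  with () ← h

-- Potentials, gains and growth along a history of stored entries, newest first.

module History {c ℓ₁ ℓ₂} (R : ArchimedeanOrderedField c ℓ₁ ℓ₂)
               {n m : ℕ} (b : Fin n → ℕ) (G : BMatching.Multigraph R n m)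
               (δ : ArchimedeanOrderedField.Carrier R)
               (0≤δ : ArchimedeanOrderedField._≤_ R (ArchimedeanOrderedField.0# R) δ) where
  open OrderedField R
  open ListSum R
  open BMatching R
  open Multigraph
  open Solver using (solve; _:+_; _:*_; _:=_; con)

  Ent : Set c
  Ent = Entry n (Fin m) Carrier

  pot : List Ent → Slot n → Carrier
  pot H s = maybe′ (value s) 0# (newest s H)

  weightᵉ : Ent → Carrier
  weightᵉ f = weight G (arc f)

  -- With old potentials p and q the entry holds w - q and w - p, so this is w - p - q, recovered
  -- from the entry without its history.
  gain : Ent → Carrier
  gain f = srcPot f + dstPot f - weightᵉ f

  record Link (H : List Ent) (f : Ent) : Set (c ⊔ ℓ₁ ⊔ ℓ₂) where
    field
      srcEnd   : proj₁ (src f) ≡ proj₁ (ends G (arc f))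
      dstEnd   : proj₁ (dst f) ≡ proj₂ (ends G (arc f))
      srcIndex : proj₂ (src f) ℕ.< b (proj₁ (src f))
      dstIndex : proj₂ (dst f) ℕ.< b (proj₁ (dst f))
      -- Written as sums instead of differences, to suit calculations in a commutative semiring.
      srcPot+  : srcPot f + pot H (dst f) ≈ weightᵉ f
      dstPot+  : dstPot f + pot H (src f) ≈ weightᵉ f
      srcMin   : ∀ i → i ℕ.< b (proj₁ (src f)) → pot H (src f) ≤ pot H (proj₁ (src f) , i)
      dstMin   : ∀ i → i ℕ.< b (proj₁ (dst f)) → pot H (dst f) ≤ pot H (proj₁ (dst f) , i)
      heavy    : (1# + δ) * (pot H (src f) + pot H (dst f)) < weightᵉ f

  open Link

  data Chain : List Ent → Set (c ⊔ ℓ₁ ⊔ ℓ₂) where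
    []  : Chain []
    _∷_ : ∀ {H f} → Link H f → Chain H → Chain (f ∷ H)

  src≢dst : ∀ {H f} → Link H f → src f ≢ dst f
  src≢dst {f = f} l eq = loopless G (arc f)
    (≡.trans (≡.sym (srcEnd l)) (≡.trans (≡.cong proj₁ eq) (dstEnd l)))

  -- One end of a link; the two ends play symmetric roles.
  record Side (H : List Ent) (f : Ent) (s : Slot n) : Set (c ⊔ ℓ₁ ⊔ ℓ₂) where
    field
      other       : Carrier
      other≥0     : 0# ≤ other
      value+other : value s f + other ≈ weightᵉ f
      gain+pot    : gain f + pot H s ≈ value s f
      pot≥0       : 0# ≤ pot H s
      heavyˢ      : (1# + δ) * (pot H s + other) < weightᵉ f

    pot+other≥0 : 0# ≤ pot H s + other
    pot+other≥0 = +-nonNegative pot≥0 other≥0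

    pot+other< : pot H s + other < weightᵉ f
    pot+other< = ≤-<-trans
      (≤-by-difference (*-nonNegative 0≤δ pot+other≥0)
        (solve 2 (λ d x → x :+ d :* x := (con 1 :+ d) :* x :+ con 0) ≈-refl δ (pot H s + other)))
      heavyˢ

    pot<value : ¬ (value s f ≤ pot H s)
    pot<value h = <⇒≱ pot+other< (≤-trans (≤-reflexive (≈-sym value+other)) (+-monoˡ-≤ other h))

    0<value : 0# < value s f
    0<value = ≤-<-trans pot≥0 (≰⇒> pot<value)

    gain≥0 : 0# ≤ gain f
    gain≥0 = ≤-by-difference (≰⇒≥ pot<value)
      (≈-trans (+-identityˡ _) (≈-sym gain+pot))

    -- Let p be the old potential, o the one at the other end and v the new value. The weight v + o
    -- exceeds (1 + δ)(p + o), and taking away o leaves v above (1 + δ)p + δo.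
    growth : (1# + δ) * pot H s ≤ value s f
    growth = ≤-trans (x≤x+y (*-nonNegative 0≤δ other≥0))
      (≤-by-difference (≤-trans (proj₁ heavyˢ) (≤-reflexive (≈-sym value+other)))
        (solve 4 (λ d p o v → (con 1 :+ d) :* p :+ d :* o :+ (v :+ o) := v :+ (con 1 :+ d) :* (p :+ o))
          ≈-refl δ (pot H s) other (value s f)))

    -- The potential at the other end takes at most the share 1/(1 + δ) of the weight, so the share
    -- δ/(1 + δ) is left for the value. This bounds values from below by weights.
    δ*weight≤ : δ * weightᵉ f ≤ (1# + δ) * value s f
    δ*weight≤ = ≤-trans (≤-reflexive (*-cong ≈-refl (≈-sym value+other)))
      (≤-by-difference other≤
        (solve 3 (λ d o v → d :* (v :+ o) :+ (v :+ o) := (con 1 :+ d) :* v :+ (con 1 :+ d) :* o)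
          ≈-refl δ other (value s f)))
      where
      other≤ : (1# + δ) * other ≤ value s f + other
      other≤ = ≤-trans (*-monoʳ-≤ (+-nonNegative 0≤1 0≤δ) (x≤y+x pot≥0))
        (≤-trans (proj₁ heavyˢ) (≤-reflexive (≈-sym value+other)))

    value≤weight : value s f ≤ weightᵉ f
    value≤weight = ≤-trans (x≤x+y other≥0) (≤-reflexive value+other)

    0<weight : 0# < weightᵉ f
    0<weight = ≤-<-trans pot+other≥0 pot+other<

  open Side

  -- Nonnegativity of the old potentials is a hypothesis because `pot≥0ᶜ` is itself proved by
  -- applying this lemma along the chain.
  side-of : ∀ {H f} → Link H f → (∀ s → 0# ≤ pot H s) → ∀ s → touches s f ≡ true → Side H f s
  side-of {H} {f} l p≥0 s t with touches⁻ s f t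
  ... | inj₁ refl = record
    { other       = pot H (dst f)
    ; other≥0     = p≥0 _
    ; value+other = ≈-trans (+-cong (≈-reflexive (value-src f)) ≈-refl) (srcPot+ l)
    ; gain+pot    = ≈-trans (+-cancelʳ-≈ (dstPot f) (≈-trans
        (solve 3 (λ g p Q → g :+ p :+ Q := g :+ (Q :+ p)) ≈-refl (gain f) (pot H (src f)) (dstPot f))
        (≈-trans (+-cong ≈-refl (dstPot+ l)) (x-z+z≈x _ _)))) (≈-reflexive (≡.sym (value-src f)))
    ; pot≥0       = p≥0 _
    ; heavyˢ      = heavy l
    }
  ... | inj₂ refl = record
    { other       = pot H (src f)
    ; other≥0     = p≥0 _
    ; value+other = ≈-trans (+-cong (≈-reflexive (value-dst f (src≢dst l))) ≈-refl) (dstPot+ l)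
    ; gain+pot    = ≈-trans (+-cancelʳ-≈ (srcPot f) (≈-trans
        (solve 3 (λ g q P → g :+ q :+ P := g :+ (P :+ q)) ≈-refl (gain f) (pot H (dst f)) (srcPot f))
        (≈-trans (+-cong ≈-refl (srcPot+ l)) (≈-trans (x-z+z≈x _ _) (+-comm _ _)))))
        (≈-reflexive (≡.sym (value-dst f (src≢dst l))))
    ; pot≥0       = p≥0 _
    ; heavyˢ      = ≤-<-trans (≤-reflexive (*-cong ≈-refl (+-comm _ _))) (heavy l)
    }

  pot≥0ᶜ : ∀ {H} → Chain H → ∀ s → 0# ≤ pot H s
  pot≥0ᶜ []               s = ≤-refl
  pot≥0ᶜ (_∷_ {H} {f} l ch) s with touches s f in t
  ... | true  = proj₁ (0<value (side-of l (pot≥0ᶜ ch) s t))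
  ... | false = pot≥0ᶜ ch s

  side : ∀ {H f} → Chain (f ∷ H) → ∀ s → touches s f ≡ true → Side H f s
  side (l ∷ ch) = side-of l (pot≥0ᶜ ch)

  link-gain≥0 : ∀ {H f} → Chain (f ∷ H) → 0# ≤ gain f
  link-gain≥0 {f = f} ch = gain≥0 (side ch (src f) (touches-src f))

  pot-mono : ∀ {H f} → Chain (f ∷ H) → ∀ s → pot H s ≤ pot (f ∷ H) s
  pot-mono {f = f} ch s with touches s f in t
  ... | true  = ≰⇒≥ (pot<value (side ch s t))
  ... | false = ≤-refl

  gain≥0ᶜ : ∀ {H} → Chain H → ∀ {f} → f ∈ H → 0# ≤ gain f
  gain≥0ᶜ ch@(_ ∷ _) (here refl) = link-gain≥0 ch
  gain≥0ᶜ (_ ∷ ch)   (there f∈H) = gain≥0ᶜ ch f∈H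

  0<weightᶜ : ∀ {H} → Chain H → ∀ {f} → f ∈ H → 0# < weightᵉ f
  0<weightᶜ ch@(_ ∷ _) {f} (here refl) = 0<weight (side ch (src f) (touches-src f))
  0<weightᶜ (_ ∷ ch)       (there f∈H) = 0<weightᶜ ch f∈H

  0<valueᶜ : ∀ {H} → Chain H → ∀ {f} → f ∈ H → ∀ s → touches s f ≡ true → 0# < value s f
  0<valueᶜ ch@(_ ∷ _) (here refl) s t = 0<value (side ch s t)
  0<valueᶜ (_ ∷ ch)   (there f∈H) s t = 0<valueᶜ ch f∈H s t

  δ*weight≤ᶜ : ∀ {H} → Chain H → ∀ {f} → f ∈ H → ∀ s → touches s f ≡ true → δ * weightᵉ f ≤ (1# + δ) * value s f
  δ*weight≤ᶜ ch@(_ ∷ _) (here refl) s t = δ*weight≤ (side ch s t)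
  δ*weight≤ᶜ (_ ∷ ch)   (there f∈H) s t = δ*weight≤ᶜ ch f∈H s t

  src≢dstᶜ : ∀ {H} → Chain H → ∀ {f} → f ∈ H → src f ≢ dst f
  src≢dstᶜ (l ∷ _)  (here refl) = src≢dst l
  src≢dstᶜ (_ ∷ ch) (there f∈H) = src≢dstᶜ ch f∈H

  value≤pot : ∀ {H} → Chain H → ∀ {f} → f ∈ H → ∀ s → touches s f ≡ true → value s f ≤ pot H s
  value≤pot (_∷_ {H} {f} l ch) (here refl) s t with touches s f
  value≤pot (_∷_ {H} {f} l ch) (here refl) s refl | true = ≤-refl
  value≤pot ch@(_ ∷ ch′)       (there f∈H) s t = ≤-trans (value≤pot ch′ f∈H s t) (pot-mono ch s)

  pot≤ : ∀ {H} → Chain H → ∀ {x} → 0# ≤ x → (∀ {f} → f ∈ H → weightᵉ f ≤ x) → ∀ s → pot H s ≤ x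
  pot≤ [] 0≤x h s = 0≤x
  pot≤ ch@(_∷_ {H} {f} _ ch′) 0≤x h s with touches s f in t
  ... | true  = ≤-trans (value≤weight (side ch s t)) (h (here refl))
  ... | false = pot≤ ch′ 0≤x (h ∘ there) s

  -- A telescoping sum: an entry raises both of its slots by its gain.
  pot≈∑gain : ∀ {H} → Chain H → ∀ s → pot H s ≈ ∑ H (λ f → when (touches s f) (gain f))
  pot≈∑gain [] s = ≈-refl
  pot≈∑gain ch@(_∷_ {H} {f} _ ch′) s with touches s f in t
  ... | true  = ≈-trans (≈-sym (gain+pot (side ch s t))) (+-cong ≈-refl (pot≈∑gain ch′ s))
  ... | false = ≈-trans (pot≈∑gain ch′ s) (≈-sym (+-identityˡ _))

  -- The value of an entry is the sum of the gains in the slot up to and including its own, and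
  -- values grow with time. Hence the newest entry of value at most x already accounts for the whole
  -- sum.
  ∑gain-below : ∀ {H} → Chain H → ∀ s {x} → 0# ≤ x →
                ∑ H (λ f → when (touches s f ∧ does (value s f ≤? x)) (gain f)) ≤ x
  ∑gain-below [] s 0≤x = 0≤x
  ∑gain-below ch@(_∷_ {H} {f} _ ch′) s {x} 0≤x with touches s f in t
  ... | false = ≤-trans (≤-reflexive (+-identityˡ _)) (∑gain-below ch′ s 0≤x)
  ... | true with value s f ≤? x
  ...   | no  _ = ≤-trans (≤-reflexive (+-identityˡ _)) (∑gain-below ch′ s 0≤x)
  ...   | yes v≤x = ≤-trans (+-monoʳ-≤ (gain f) (≤-trans
            (∑-mono-∈ H λ {f} f∈H → when-implies (touches s f ∧ does (value s f ≤? x)) (touches s f)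
              (∧-true₁ _) (gain≥0ᶜ ch′ f∈H))
            (≤-reflexive (≈-sym (pot≈∑gain ch′ s)))))
          (≤-trans (≤-reflexive (gain+pot (side ch s t))) v≤x)
    where
    ∧-true₁ : ∀ p {q} → p ∧ q ≡ true → p ≡ true
    ∧-true₁ true _ = refl

  ∑above-none : ∀ {H} → Chain H → ∀ s {y} → ¬ (y ≤ pot H s) →
                ∑ H (λ f → when (touches s f ∧ does (y ≤? value s f)) 1#) ≤ 0#
  ∑above-none {H} ch s {y} y>pot = ∑-empty H _ none
    where
    none : ∀ {f} → f ∈ H → touches s f ∧ does (y ≤? value s f) ≡ false
    none {f} f∈H with touches s f in t | y ≤? value s f
    ... | false | _ = refl
    ... | true  | no _ = refl
    ... | true  | yes y≤v = ⊥-elim (y>pot (≤-trans y≤v (value≤pot ch f∈H s t)))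

  -- Values in a slot increase strictly, so only its newest entry can reach the potential.
  ∑tops≤1 : ∀ {H} → Chain H → ∀ s →
            ∑ H (λ f → when (touches s f ∧ does (pot H s ≤? value s f)) 1#) ≤ 1#
  ∑tops≤1 [] s = 0≤1
  ∑tops≤1 ch@(_∷_ {H} {f} _ ch′) s with touches s f in t
  ... | false = ≤-trans (≤-reflexive (+-identityˡ _)) (∑tops≤1 ch′ s)
  ... | true  = ≤-trans (+-mono-≤ (when≤ (does (value s f ≤? value s f)) 0≤1) (∑above-none ch′ s (pot<value (side ch s t))))
                  (≤-reflexive (+-identityʳ 1#))

  -- To be read as a lower bound (1 + δ)^r x/y for the potential. The oldest of the r + 1 selected
  -- entries has value at least x/y, each later one contributes a factor 1 + δ, and entries that are
  -- not selected never lower the potential.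
  geometric : ∀ {H} → Chain H → ∀ s (K : Ent → Bool) {x y} → 0# ≤ y →
              (∀ {f} → f ∈ H → K f ≡ true → touches s f ≡ true → x ≤ y * value s f) →
              ∀ {r} → length (filterᵇ (λ f → K f ∧ touches s f) H) ≡ suc r →
              (1# + δ) ^ r * x ≤ y * pot H s
  geometric ch@(_∷_ {H} {f} _ ch′) s K {x} {y} 0≤y low {r} len
    with K f in k | touches s f in t
  ... | false | true  = ≤-trans (geometric ch′ s K 0≤y (low ∘ there) len) (*-monoʳ-≤ 0≤y (≰⇒≥ (pot<value (side ch s t))))
  ... | false | false = geometric ch′ s K 0≤y (low ∘ there) len
  ... | true  | false = geometric ch′ s K 0≤y (low ∘ there) len
  ... | true  | true with r | len
  ...   | zero  | _    = ≤-trans (≤-reflexive (*-identityˡ x)) (low (here refl) k t)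
  ...   | suc r | len′ = ≤-trans (≤-reflexive (*-assoc _ _ _))
            (≤-trans (*-monoʳ-≤ (+-nonNegative 0≤1 0≤δ) (geometric ch′ s K 0≤y (low ∘ there) (ℕ.suc-injective len′)))
            (≤-trans (≤-reflexive (solve 3 (λ d y p → d :* (y :* p) := y :* (d :* p)) ≈-refl (1# + δ) y (pot H s)))
              (*-monoʳ-≤ 0≤y (growth (side ch s t)))))

∨-true⁻ : ∀ p {q} → p ∨ q ≡ true → p ≡ true ⊎ q ≡ true
∨-true⁻ true  h = inj₁ refl
∨-true⁻ false h = inj₂ h

∨-false⁻ : ∀ p {q} → p ∨ q ≡ false → p ≡ false × q ≡ false
∨-false⁻ false h = refl , h

filterᵇ-cong : ∀ {a} {A : Set a} {p q : A → Bool} xs → (∀ {x} → x ∈ xs → p x ≡ q x) → filterᵇ p xs ≡ filterᵇ q xs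
filterᵇ-cong [] h = refl
filterᵇ-cong {p = p} {q} (x ∷ xs) h with p x | q x | h (here refl)
... | true  | .true  | refl = ≡.cong (x ∷_) (filterᵇ-cong xs (h ∘ there))
... | false | .false | refl = filterᵇ-cong xs (h ∘ there)

filterᵇ-filterᵇ : ∀ {a} {A : Set a} {p q : A → Bool} xs → (∀ {x} → x ∈ xs → q x ≡ true → p x ≡ true) →
                  filterᵇ q (filterᵇ p xs) ≡ filterᵇ q xs
filterᵇ-filterᵇ [] h = refl
filterᵇ-filterᵇ {p = p} {q} (x ∷ xs) h with p x in px | q x in qx
... | true  | true  rewrite qx = ≡.cong (x ∷_) (filterᵇ-filterᵇ xs (h ∘ there))
... | true  | false rewrite qx = filterᵇ-filterᵇ xs (h ∘ there)
... | false | false = filterᵇ-filterᵇ xs (h ∘ there)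
... | false | true  with () ← ≡.trans (≡.sym px) (h (here refl) qx)

-- Dropping entries, and charging arguments on slots.

module Analysis {c ℓ₁ ℓ₂} (R : ArchimedeanOrderedField c ℓ₁ ℓ₂)
                {n m : ℕ} (b : Fin n → ℕ) (G : BMatching.Multigraph R n m)
                (δ : ArchimedeanOrderedField.Carrier R)
                (0≤δ : ArchimedeanOrderedField._≤_ R (ArchimedeanOrderedField.0# R) δ)
                (θ : ArchimedeanOrderedField.Carrier R)
                (0≤θ : ArchimedeanOrderedField._≤_ R (ArchimedeanOrderedField.0# R) θ) where
  open OrderedField R
  open ListSum R
  open BMatching R
  open Multigraph
  open Solver using (solve; _:+_; _:=_)
  open History R b G δ 0≤δ public
  open Link
  open Side

  fresh : (Slot n → Carrier) → Ent → Bool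
  fresh p f = not (does (srcPot f ≤? θ * p (src f)) ∨ does (dstPot f ≤? θ * p (dst f)))

  -- The first two tests recognise the newest entry of a slot by numbers alone: no older entry
  -- reaches the present potential.
  stays : (Slot n → Carrier) → Ent → Bool
  stays p f = does (p (src f) ≤? srcPot f) ∨ (does (p (dst f) ≤? dstPot f) ∨ fresh p f)

  -- The memory as a function of the full history, so that the analysis can speak of all entries
  -- ever stored and need not follow the single prunings.
  live : List Ent → List Ent
  live H = filterᵇ (stays (pot H)) H

  does-true : ∀ {x y} → x ≤ y → does (x ≤? y) ≡ true
  does-true {x} {y} h with x ≤? y
  ... | yes _ = refl
  ... | no ¬h = ⊥-elim (¬h h)

  does-true⁻ : ∀ {x y} → does (x ≤? y) ≡ true → x ≤ y
  does-true⁻ {x} {y} h with yes p ← x ≤? y = p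

  stays-newest : ∀ H {f s} → newest s H ≡ just f → touches s f ≡ true → stays (pot H) f ≡ true
  stays-newest H {f} {s} h t with src f ≟ˢ s
  ... | yes refl rewrite h with src f ≟ˢ src f
  ...   | no ¬p = ⊥-elim (¬p refl)
  ...   | yes _ rewrite does-true (≤-refl {srcPot f}) = refl
  stays-newest H {f} {s} h t | no ¬p with dst f ≟ˢ s
  ... | yes refl rewrite h with src f ≟ˢ dst f
  ...   | yes p = ⊥-elim (¬p p)
  ...   | no _  rewrite does-true (≤-refl {dstPot f}) = ∨-zeroʳ _

  -- The newest entry of a slot always passes `stays`; therefore the pruned memory still determines
  -- every potential.
  newest-live : ∀ H s → newest s (live H) ≡ newest s H
  newest-live H s = go H refl
    where
    go : ∀ xs → newest s xs ≡ newest s H → newest s (filterᵇ (stays (pot H)) xs) ≡ newest s xs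
    go [] h = refl
    go (f ∷ xs) h with touches s f in t
    ... | false with stays (pot H) f
    ...   | false = go xs h
    ...   | true rewrite t = go xs h
    go (f ∷ xs) h | true rewrite stays-newest H (≡.sym h) t | t = refl

  pot-live : ∀ H s → pot (live H) s ≡ pot H s
  pot-live H s = ≡.cong (maybe′ (value s) 0#) (newest-live H s)

  fresh-antitone : ∀ {p p′ : Slot n → Carrier} → (∀ s → p s ≤ p′ s) → ∀ f → fresh p′ f ≡ true → fresh p f ≡ true
  fresh-antitone {p} {p′} p≤p′ f h with srcPot f ≤? θ * p (src f) | dstPot f ≤? θ * p (dst f)
  ... | no _ | no _ = refl
  ... | yes q | _ rewrite does-true (≤-trans q (*-monoʳ-≤ 0≤θ (p≤p′ (src f)))) with () ← h
  ... | no _ | yes q rewrite does-true (≤-trans q (*-monoʳ-≤ 0≤θ (p≤p′ (dst f))))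
                           | ∨-zeroʳ (does (srcPot f ≤? θ * p′ (src f))) with () ← h

  -- Potentials only rise and the tests become stricter, so a dropped entry would fail every later
  -- test as well. This is what lets successive prunings compose.
  stays-antitone : ∀ {p p′ : Slot n → Carrier} → (∀ s → p s ≤ p′ s) → ∀ f → stays p′ f ≡ true → stays p f ≡ true
  stays-antitone {p} {p′} p≤p′ f h with ∨-true⁻ (does (p′ (src f) ≤? srcPot f)) h
  ... | inj₁ q rewrite does-true (≤-trans (p≤p′ (src f)) (does-true⁻ q)) = refl
  ... | inj₂ h′ with ∨-true⁻ (does (p′ (dst f) ≤? dstPot f)) h′
  ...   | inj₁ q rewrite does-true (≤-trans (p≤p′ (dst f)) (does-true⁻ q)) = ∨-zeroʳ _
  ...   | inj₂ q rewrite fresh-antitone p≤p′ f q | ∨-zeroʳ (does (p (dst f) ≤? dstPot f)) = ∨-zeroʳ _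

  stays-cong : ∀ {p p′ : Slot n → Carrier} → (∀ s → p s ≡ p′ s) → ∀ f → stays p f ≡ stays p′ f
  stays-cong h f rewrite h (src f) | h (dst f) = refl

  -- Dropping entries step by step leaves the same memory as dropping them
  -- from the whole history at once.
  live-step : ∀ {H f} → Chain (f ∷ H) →
              filterᵇ (stays (pot (f ∷ live H))) (f ∷ live H) ≡ live (f ∷ H)
  live-step {H} {f} ch = ≡.trans (filterᵇ-cong (f ∷ live H) λ {x} _ → stays-cong pot-eq x)
    (drop-twice (stays-newest (f ∷ H) (newest-head f) (touches-src f)))
    where
    newest-head : ∀ f → newest (src f) (f ∷ H) ≡ just f
    newest-head f rewrite touches-src f = refl
    pot-eq : ∀ s → pot (f ∷ live H) s ≡ pot (f ∷ H) s
    pot-eq s with touches s f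
    ... | true  = refl
    ... | false = pot-live H s
    drop-twice : stays (pot (f ∷ H)) f ≡ true → filterᵇ (stays (pot (f ∷ H))) (f ∷ live H) ≡ live (f ∷ H)
    drop-twice h rewrite h = ≡.cong (f ∷_) (filterᵇ-filterᵇ H λ {x} _ → stays-antitone (pot-mono ch) x)

  slots : List (Slot n)
  slots = concatMap (λ v → map (v ,_) (upTo (b v))) (allFin n)

  ∑-slots : ∀ φ → ∑ slots φ ≈ ∑ (allFin n) (λ v → ∑ (upTo (b v)) (λ i → φ (v , i)))
  ∑-slots φ = ≈-trans (∑-concatMap _ (allFin n) φ)
    (∑-cong (allFin n) λ v → ≈-reflexive (∑-map (v ,_) (upTo (b v)) φ))

  ∈-slots : ∀ {s} → proj₂ s ℕ.< b (proj₁ s) → s ∈ slots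
  ∈-slots {v , i} i<b = ∈-concatMap⁺ (λ v → map (v ,_) (upTo (b v))) (lose (∈-allFin v) (∈-map⁺ (v ,_) (∈-upTo⁺ i<b)))

  ∑-slot≤ : ∀ s₀ {x} → 0# ≤ x → ∑ slots (λ s → when (does (s₀ ≟ˢ s)) x) ≤ x
  ∑-slot≤ (v₀ , i₀) {x} 0≤x = ≤-trans (≤-reflexive (∑-slots _))
    (≤-trans (∑-mono (allFin n) inner)
      (∑-atMostOne (allFin⁺ n) (λ v → does (v₀ Fin.≟ v)) 0≤x
        λ {v} {v′} p q → ≡.trans (≡.sym (sound v p)) (sound v′ q)))
    where
    sound : ∀ v → does (v₀ Fin.≟ v) ≡ true → v₀ ≡ v
    sound v h with yes p ← v₀ Fin.≟ v = p
    soundˢ : ∀ s → does ((v₀ , i₀) ≟ˢ s) ≡ true → (v₀ , i₀) ≡ s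
    soundˢ s h with yes p ← (v₀ , i₀) ≟ˢ s = p
    inner : ∀ v → ∑ (upTo (b v)) (λ i → when (does ((v₀ , i₀) ≟ˢ (v , i))) x) ≤ when (does (v₀ Fin.≟ v)) x
    inner v = byVertex (v₀ Fin.≟ v)
      where
      byVertex : (d : Dec (v₀ ≡ v)) → ∑ (upTo (b v)) (λ i → when (does ((v₀ , i₀) ≟ˢ (v , i))) x) ≤ when (does d) x
      byVertex (yes _) = ∑-atMostOne (upTo⁺ (b v)) (λ i → does ((v₀ , i₀) ≟ˢ (v , i))) 0≤x
        λ {i} {i′} p q → ≡.trans (≡.sym (≡.cong proj₂ (soundˢ (v , i) p))) (≡.cong proj₂ (soundˢ (v , i′) q))
      byVertex (no v₀≢v) = ∑-empty (upTo (b v)) (λ i → does ((v₀ , i₀) ≟ˢ (v , i))) λ {i} _ → none i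
        where
        none : ∀ i → does ((v₀ , i₀) ≟ˢ (v , i)) ≡ false
        none i with (v₀ , i₀) ≟ˢ (v , i)
        ... | yes p = ⊥-elim (v₀≢v (≡.cong proj₁ p))
        ... | no _  = refl

  ∑-touches≤ : ∀ (f : Ent) {x} → 0# ≤ x → ∑ slots (λ s → when (touches s f) x) ≤ x + x
  ∑-touches≤ f {x} 0≤x = ≤-trans
    (∑-mono slots λ s → when-∨ (does (src f ≟ˢ s)) (does (dst f ≟ˢ s)) 0≤x)
    (≤-trans (≤-reflexive (∑-+ slots _ _)) (+-mono-≤ (∑-slot≤ (src f) 0≤x) (∑-slot≤ (dst f) 0≤x)))

  srcIndexᶜ : ∀ {H} → Chain H → ∀ {f} → f ∈ H → proj₂ (src f) ℕ.< b (proj₁ (src f))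
  srcIndexᶜ (l ∷ _)  (here refl) = srcIndex l
  srcIndexᶜ (_ ∷ ch) (there f∈H) = srcIndexᶜ ch f∈H

  dstIndexᶜ : ∀ {H} → Chain H → ∀ {f} → f ∈ H → proj₂ (dst f) ℕ.< b (proj₁ (dst f))
  dstIndexᶜ (l ∷ _)  (here refl) = dstIndex l
  dstIndexᶜ (_ ∷ ch) (there f∈H) = dstIndexᶜ ch f∈H

  ∑pot≤2∑gain : ∀ {H} → Chain H → ∑ slots (pot H) ≤ ∑ H gain + ∑ H gain
  ∑pot≤2∑gain {H} ch =
    ≤-trans (≤-reflexive (∑-cong slots (pot≈∑gain ch)))
    (≤-trans (≤-reflexive (∑-swap slots H _))
    (≤-trans (∑-mono-∈ H λ {f} f∈H → ∑-touches≤ f (gain≥0ᶜ ch f∈H)) (≤-reflexive (∑-+ H gain gain))))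

  -- A dropped entry is stale in at least one of its slots, and by `∑gain-below` the stale entries
  -- of a slot have total gain at most θ times its potential.
  ∑gain≤live : ∀ {H} → Chain H → ∑ H gain ≤ ∑ (live H) gain + θ * ∑ slots (pot H)
  ∑gain≤live {H} ch = ≤-trans (∑-mono-∈ H split)
    (≤-trans (≤-reflexive (∑-+ H _ _))
    (+-mono-≤ (≤-reflexive (≈-sym (∑-filter (stays (pot H)) H gain)))
      (≤-trans (≤-reflexive (∑-swap H slots _))
      (≤-trans (∑-mono slots λ s → ∑gain-below ch s (*-nonNegative 0≤θ (pot≥0ᶜ ch s)))
        (≤-reflexive (∑-* slots θ (pot H)))))))
    where
    stale : Slot n → Ent → Bool
    stale s f = touches s f ∧ does (value s f ≤? θ * pot H s)
    staleAt : ∀ f → f ∈ H → ∀ {s} → s ∈ slots → touches s f ≡ true → value s f ≤ θ * pot H s →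
              gain f ≤ ∑ slots (λ s → when (stale s f) (gain f))
    staleAt f f∈H {s} s∈slots t h = ≤-trans
      (≤-reflexive (≈-reflexive (≡.cong (λ p → when p (gain f)) (≡.sym (≡.cong₂ _∧_ t (does-true h))))))
      (∑-member (λ s → when (stale s f) (gain f)) (λ s → when≥0 (stale s f) (gain≥0ᶜ ch f∈H)) s∈slots)
    split : ∀ {f} → f ∈ H → gain f ≤ when (stays (pot H) f) (gain f) + ∑ slots (λ s → when (stale s f) (gain f))
    split {f} f∈H with stays (pot H) f in st
    ... | true  = x≤x+y (∑≥0 slots λ s → when≥0 (stale s f) (gain≥0ᶜ ch f∈H))
    ... | false with ∨-true⁻ (does (srcPot f ≤? θ * pot H (src f)))
                     (not-injective (proj₂ (∨-false⁻ (does (pot H (dst f) ≤? dstPot f))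
                       (proj₂ (∨-false⁻ (does (pot H (src f) ≤? srcPot f)) st)))))
    ...   | inj₁ q = ≤-trans (staleAt f f∈H (∈-slots (srcIndexᶜ ch f∈H)) (touches-src f)
                       (≤-trans (≤-reflexive (≈-reflexive (value-src f))) (does-true⁻ q))) (x≤y+x ≤-refl)
    ...   | inj₂ q = ≤-trans (staleAt f f∈H (∈-slots (dstIndexᶜ ch f∈H)) (touches-dst f)
                       (≤-trans (≤-reflexive (≈-reflexive (value-dst f (src≢dstᶜ ch f∈H)))) (does-true⁻ q))) (x≤y+x ≤-refl)

  load : (Ent → Carrier) → Slot n → List Ent → Carrier
  load φ s xs = ∑ xs (λ f → when (touches s f) (φ f))

  -- The budget ψ of an entry must cover φ of itself and of all older entries in its two slots. It
  -- is used twice: with gains against weights for the approximation, and with ones against twice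
  -- the load of a slot for counting.
  Charged : (φ ψ : Ent → Carrier) → List Ent → Set ℓ₂
  Charged φ ψ []       = ⊤
  Charged φ ψ (f ∷ fs) = φ f + load φ (src f) fs + load φ (dst f) fs ≤ ψ f × Charged φ ψ fs

  -- An entry that greedy skips is charged to a taken one sharing a slot with it.
  greedy-charge : ∀ φ ψ xs → (∀ {f} → f ∈ xs → 0# ≤ φ f) → Charged φ ψ xs → ∀ used →
                  ∑ xs φ ≤ ∑ used (λ s → load φ s xs) + ∑ (greedy used xs) ψ
  greedy-charge φ ψ [] φ≥0 ch used = +-nonNegative (∑≥0 used λ _ → ≤-refl) ≤-refl
  greedy-charge φ ψ (f ∷ fs) φ≥0 (charge , ch) used with any (λ s → touches s f) used in blocked
  ... | true  = ≤-trans (+-monoʳ-≤ (φ f) (greedy-charge φ ψ fs (φ≥0 ∘ there) ch used))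
      (≤-trans (≤-reflexive (≈-sym (+-assoc _ _ _)))
      (+-monoˡ-≤ _ (≤-trans (+-monoˡ-≤ _ (blocked≤ used blocked)) (≤-reflexive (≈-sym (∑-+ used _ _))))))
    where
    blocked≤ : ∀ used → any (λ s → touches s f) used ≡ true → φ f ≤ ∑ used (λ s → when (touches s f) (φ f))
    blocked≤ (s ∷ used) h with touches s f
    ... | true  = x≤x+y (∑≥0 used λ s → when≥0 (touches s f) (φ≥0 (here refl)))
    ... | false = ≤-trans (blocked≤ used h) (≤-reflexive (≈-sym (+-identityˡ _)))
  ... | false = ≤-trans (+-monoʳ-≤ (φ f) (greedy-charge φ ψ fs (φ≥0 ∘ there) ch (src f ∷ dst f ∷ used)))
      (≤-trans (≤-reflexive (solve 5 (λ x a b u g → x :+ ((a :+ (b :+ u)) :+ g) := u :+ ((x :+ a :+ b) :+ g)) ≈-refl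
        (φ f) (load φ (src f) fs) (load φ (dst f) fs) (∑ used (λ s → load φ s fs)) _))
      (+-mono-≤ (∑-mono used λ s → x≤y+x (when≥0 (touches s f) (φ≥0 (here refl))))
                (+-monoˡ-≤ _ charge)))

  load-filter≤ : ∀ (K : Ent → Bool) φ s xs → (∀ {f} → f ∈ xs → 0# ≤ φ f) → load φ s (filterᵇ K xs) ≤ load φ s xs
  load-filter≤ K φ s xs φ≥0 = ≤-trans (≤-reflexive (∑-filter K xs _))
    (∑-mono-∈ xs λ {f} f∈xs → when≤ (K f) (when≥0 (touches s f) (φ≥0 f∈xs)))

  charged-filter : ∀ K φ ψ xs → (∀ {f} → f ∈ xs → 0# ≤ φ f) → Charged φ ψ xs → Charged φ ψ (filterᵇ K xs)
  charged-filter K φ ψ [] φ≥0 ch = tt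
  charged-filter K φ ψ (f ∷ fs) φ≥0 (charge , ch) with K f
  ... | false = charged-filter K φ ψ fs (φ≥0 ∘ there) ch
  ... | true  = ≤-trans (+-mono-≤ (+-monoʳ-≤ (φ f) (load-filter≤ K φ (src f) fs (φ≥0 ∘ there)))
                                  (load-filter≤ K φ (dst f) fs (φ≥0 ∘ there))) charge ,
                charged-filter K φ ψ fs (φ≥0 ∘ there) ch

  -- Holds with equality: the older gains in the two slots add up to the old potentials p and q, and
  -- the gain is w - p - q.
  charged-gain : ∀ {H} → Chain H → Charged gain weightᵉ H
  charged-gain []               = tt
  charged-gain ch@(_∷_ {H} {f} l ch′) = ≤-reflexive
    (≈-trans (+-cong (≈-trans (+-cong ≈-refl (≈-sym (pot≈∑gain ch′ (src f))))
      (≈-trans (gain+pot (side ch (src f) (touches-src f))) (≈-reflexive (value-src f))))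
      (≈-sym (pot≈∑gain ch′ (dst f)))) (srcPot+ l)) , charged-gain ch′

  ∑-greedy : ∀ φ ψ xs → (∀ {f} → f ∈ xs → 0# ≤ φ f) → Charged φ ψ xs → ∑ xs φ ≤ ∑ (greedy [] xs) ψ
  ∑-greedy φ ψ xs φ≥0 ch = ≤-trans (greedy-charge φ ψ xs φ≥0 ch []) (≤-reflexive (+-identityˡ _))

  ∈-filterᵇ⁻ : ∀ (K : Ent → Bool) {f} xs → f ∈ filterᵇ K xs → f ∈ xs
  ∈-filterᵇ⁻ K (x ∷ xs) h with K x
  ∈-filterᵇ⁻ K (x ∷ xs) (here eq) | true  = here eq
  ∈-filterᵇ⁻ K (x ∷ xs) (there h) | true  = there (∈-filterᵇ⁻ K xs h)
  ∈-filterᵇ⁻ K (x ∷ xs) h         | false = there (∈-filterᵇ⁻ K xs h)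

  -- Each of the two copies of the gains is split into the live part, which the greedy weight pays
  -- for, and the dropped part, at most θ times the sum of potentials.
  primal : ∀ {H} → Chain H →
           let Σpot = ∑ slots (pot H) ; w = ∑ (greedy [] (live H)) weightᵉ in
           Σpot ≤ (w + θ * Σpot) + (w + θ * Σpot)
  primal {H} ch = ≤-trans (∑pot≤2∑gain ch) (+-mono-≤ half half)
    where
    half = ≤-trans (∑gain≤live ch) (+-monoˡ-≤ _ (∑-greedy gain weightᵉ (live H)
      (gain≥0ᶜ ch ∘ ∈-filterᵇ⁻ (stays (pot H)) H)
      (charged-filter (stays (pot H)) gain weightᵉ H (gain≥0ᶜ ch) (charged-gain ch))))

  charged-1 : ∀ {x} xs → (∀ s → load (λ _ → 1#) s xs ≤ x) → Charged (λ _ → 1#) (λ _ → x + x) xs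
  charged-1 [] h = tt
  charged-1 {x} (f ∷ fs) h =
    -- The `1#` of the entry itself is part of the load of its source slot, so the total stays
    -- within x + x and no further 1 arises.
    +-mono-≤ (≤-trans (≤-reflexive (≈-reflexive (≡.cong (λ p → when p 1# + load (λ _ → 1#) (src f) fs) (≡.sym (touches-src f)))))
                      (h (src f)))
             (≤-trans (x≤y+x (when≥0 (touches (dst f) f) 0≤1)) (h (dst f))) ,
    charged-1 fs (λ s → ≤-trans (x≤y+x (when≥0 (touches s f) 0≤1)) (h s))

  -- A taken entry blocks at most the L entries of each of its two slots, itself included.
  length-greedy : ∀ (K : Ent → Bool) H L → (∀ s → length (filterᵇ (λ f → K f ∧ touches s f) H) ℕ.≤ L) →
                  length (filterᵇ K H) ℕ.≤ length (greedy [] (filterᵇ K H)) ℕ.* (L ℕ.+ L)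
  length-greedy K H L h = ·1-cancel-≤ _ _
    (≤-trans (≤-reflexive (≈-sym (∑-const (filterᵇ K H) 1#)))
    (≤-trans (∑-greedy (λ _ → 1#) (λ _ → L · 1# + L · 1#) (filterᵇ K H) (λ _ → 0≤1) (charged-1 (filterᵇ K H) load≤))
    (≤-reflexive (≈-trans (∑-cong (greedy [] (filterᵇ K H)) λ _ → ≈-sym (·1-+ L L))
      (≈-trans (∑-const (greedy [] (filterᵇ K H)) _) (≈-sym (·1-* (length (greedy [] (filterᵇ K H))) (L ℕ.+ L))))))))
    where
    load≤ : ∀ s → load (λ _ → 1#) s (filterᵇ K H) ≤ L · 1#
    load≤ s = ≤-trans (≤-reflexive (≈-trans (∑-filter K H _)
      (≈-trans (∑-cong H λ f → ≈-sym (when-∧ (K f) (touches s f)))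
      (≈-trans (≈-sym (∑-filter (λ f → K f ∧ touches s f) H _)) (∑-const (filterᵇ (λ f → K f ∧ touches s f) H) 1#)))))
      (·1-mono-≤ (h s))

  -- An entry that stays without being fresh is the newest of one of its slots, and the capacities
  -- count the slots.
  length-live : ∀ {H} → Chain H → length (live H) ℕ.≤ length (filterᵇ (fresh (pot H)) H) ℕ.+ Vec.sum (Vec.tabulate b)
  length-live {H} ch = ·1-cancel-≤ _ _
    (≤-trans (≤-reflexive (≈-trans (≈-sym (∑-const (live H) 1#)) (∑-filter (stays (pot H)) H _)))
    (≤-trans (∑-mono-∈ H split)
    (≤-trans (≤-reflexive (∑-+ H _ _))
    (≤-trans (+-mono-≤ (≤-reflexive (≈-trans (≈-sym (∑-filter (fresh (pot H)) H _)) (∑-const (filterᵇ (fresh (pot H)) H) 1#))) tops)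
    (≤-reflexive (≈-sym (·1-+ (length (filterᵇ (fresh (pot H)) H)) _)))))))
    where
    top : Slot n → Ent → Bool
    top s f = touches s f ∧ does (pot H s ≤? value s f)
    tops : ∑ H (λ f → ∑ slots (λ s → when (top s f) 1#)) ≤ Vec.sum (Vec.tabulate b) · 1#
    tops = ≤-trans (≤-reflexive (∑-swap H slots _))
      (≤-trans (∑-mono slots (∑tops≤1 ch))
      (≤-reflexive (≈-trans (∑-slots _) (≈-trans
        (∑-cong (allFin n) λ v → ≈-trans (∑-const (upTo (b v)) 1#) (≈-reflexive (≡.cong (_· 1#) (length-upTo (b v)))))
        (∑-vec b)))))
    topAt : ∀ f {s} → s ∈ slots → touches s f ≡ true → pot H s ≤ value s f → 1# ≤ ∑ slots (λ s → when (top s f) 1#)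
    topAt f s∈slots t h = ≤-trans
      (≤-reflexive (≈-reflexive (≡.cong (λ p → when p 1#) (≡.sym (≡.cong₂ _∧_ t (does-true h))))))
      (∑-member (λ s → when (top s f) 1#) (λ s → when≥0 (top s f) 0≤1) s∈slots)
    split : ∀ {f} → f ∈ H → when (stays (pot H) f) 1# ≤ when (fresh (pot H) f) 1# + ∑ slots (λ s → when (top s f) 1#)
    split {f} f∈H with stays (pot H) f in st
    ... | false = +-nonNegative (when≥0 (fresh (pot H) f) 0≤1) (∑≥0 slots λ s → when≥0 (top s f) 0≤1)
    ... | true with ∨-true⁻ (does (pot H (src f) ≤? srcPot f)) st
    ...   | inj₁ q = ≤-trans (topAt f (∈-slots (srcIndexᶜ ch f∈H)) (touches-src f)
                       (≤-trans (does-true⁻ q) (≤-reflexive (≈-reflexive (≡.sym (value-src f)))))) (x≤y+x (when≥0 (fresh (pot H) f) 0≤1))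
    ...   | inj₂ st′ with ∨-true⁻ (does (pot H (dst f) ≤? dstPot f)) st′
    ...     | inj₁ q = ≤-trans (topAt f (∈-slots (dstIndexᶜ ch f∈H)) (touches-dst f)
                       (≤-trans (does-true⁻ q) (≤-reflexive (≈-reflexive (≡.sym (value-dst f (src≢dstᶜ ch f∈H))))))) (x≤y+x (when≥0 (fresh (pot H) f) 0≤1))
    ...     | inj₂ q rewrite q = x≤x+y (∑≥0 slots λ s → when≥0 (top s f) 0≤1)

-- From lists of entries to sets of edges, and the runs of the algorithm.

module Matching {c ℓ₁ ℓ₂} (R : ArchimedeanOrderedField c ℓ₁ ℓ₂)
                {n m : ℕ} (b : Fin n → ℕ) (G : BMatching.Multigraph R n m)
                (δ : ArchimedeanOrderedField.Carrier R)
                (0≤δ : ArchimedeanOrderedField._≤_ R (ArchimedeanOrderedField.0# R) δ)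
                (θ : ArchimedeanOrderedField.Carrier R)
                (0≤θ : ArchimedeanOrderedField._≤_ R (ArchimedeanOrderedField.0# R) θ) where
  open OrderedField R
  open ListSum R
  open BMatching R
  open Multigraph
  open Analysis R b G δ 0≤δ θ 0≤θ public
  open Link

  support : List Ent → Subset m
  support []       = ∅
  support (f ∷ fs) = ⁅ arc f ⁆ ∪ support fs

  Distinct : List Ent → Set c
  Distinct = AllPairs (λ f g → arc f ≢ arc g)

  lookup-singleton⁻ : ∀ (a e : Fin m) → lookup ⁅ a ⁆ e ≡ true → e ≡ a
  lookup-singleton⁻ a e h = x∈⁅y⁆⇒x≡y a (lookup⇒[]= e ⁅ a ⁆ h)

  lookup-singleton : ∀ (a : Fin m) → lookup ⁅ a ⁆ a ≡ true
  lookup-singleton a = []=⇒lookup (x∈⁅x⁆ a)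

  lookup-support⁻ : ∀ fs e → lookup (support fs) e ≡ true → ∃[ f ] f ∈ fs × arc f ≡ e
  lookup-support⁻ [] e h with () ← ≡.trans (≡.sym h) (lookup-replicate e false)
  lookup-support⁻ (f ∷ fs) e h
    with ∨-true⁻ (lookup ⁅ arc f ⁆ e) (≡.trans (≡.sym (lookup-zipWith _∨_ e ⁅ arc f ⁆ (support fs))) h)
  ... | inj₁ q = f , here refl , ≡.sym (lookup-singleton⁻ (arc f) e q)
  ... | inj₂ q with g , g∈fs , eq ← lookup-support⁻ fs e q = g , there g∈fs , eq

  ∑-support≤ : ∀ fs (φ : Fin m → Carrier) → (∀ e → 0# ≤ φ e) →
               ∑ (allFin m) (λ e → when (lookup (support fs) e) (φ e)) ≤ ∑ fs (φ ∘ arc)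
  ∑-support≤ [] φ φ≥0 = ≤-trans
    (∑-mono (allFin m) λ e → ≤-reflexive (≈-reflexive (≡.cong (λ p → when p (φ e)) (lookup-replicate e false))))
    (≤-reflexive (∑-zero (allFin m)))
  ∑-support≤ (f ∷ fs) φ φ≥0 = ≤-trans (∑-mono (allFin m) split)
    (≤-trans (≤-reflexive (∑-+ (allFin m) _ _))
    (+-mono-≤ (∑-atMostOne (allFin⁺ m) (lookup ⁅ arc f ⁆) (φ≥0 (arc f))
                λ {e} {e′} p q → ≡.trans (lookup-singleton⁻ (arc f) e p) (≡.sym (lookup-singleton⁻ (arc f) e′ q)))
              (∑-support≤ fs φ φ≥0)))
    where
    split : ∀ e → when (lookup (support (f ∷ fs)) e) (φ e) ≤
                  when (lookup ⁅ arc f ⁆ e) (φ (arc f)) + when (lookup (support fs) e) (φ e)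
    split e = ≤-trans (≤-reflexive (≈-reflexive (≡.cong (λ p → when p (φ e)) (lookup-zipWith _∨_ e ⁅ arc f ⁆ (support fs)))))
      (≤-trans (when-∨ (lookup ⁅ arc f ⁆ e) (lookup (support fs) e) (φ≥0 e))
        (+-monoˡ-≤ _ (when-mono-≤ (lookup ⁅ arc f ⁆ e) λ h →
          ≤-reflexive (≈-reflexive (≡.cong φ (lookup-singleton⁻ (arc f) e h))))))

  ∑-support≥ : ∀ {fs} → Distinct fs → ∀ (φ : Fin m → Carrier) → (∀ e → 0# ≤ φ e) →
               ∑ fs (φ ∘ arc) ≤ ∑ (allFin m) (λ e → when (lookup (support fs) e) (φ e))
  ∑-support≥ [] φ φ≥0 = ∑≥0 (allFin m) λ e → when≥0 (lookup ∅ e) (φ≥0 e)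
  ∑-support≥ {f ∷ fs} (f∉fs ∷ !fs) φ φ≥0 = ≤-trans
    (+-mono-≤
      (≤-trans (≤-reflexive (≈-reflexive (≡.cong (λ p → when p (φ (arc f))) (≡.sym (lookup-singleton (arc f))))))
        (∑-member (λ e → when (lookup ⁅ arc f ⁆ e) (φ e)) (λ e → when≥0 (lookup ⁅ arc f ⁆ e) (φ≥0 e)) (∈-allFin (arc f))))
      (∑-support≥ !fs φ φ≥0))
    (≤-trans (≤-reflexive (≈-sym (∑-+ (allFin m) _ _))) (∑-mono (allFin m) merge))
    where
    merge : ∀ e → when (lookup ⁅ arc f ⁆ e) (φ e) + when (lookup (support fs) e) (φ e) ≤
                  when (lookup (support (f ∷ fs)) e) (φ e)
    merge e rewrite lookup-zipWith _∨_ e ⁅ arc f ⁆ (support fs)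
      with lookup ⁅ arc f ⁆ e in p | lookup (support fs) e in q
    ... | false | r = ≤-reflexive (+-identityˡ _)
    ... | true  | false = ≤-reflexive (+-identityʳ _)
    ... | true  | true with g , g∈fs , refl ← lookup-support⁻ fs e q =
            ⊥-elim (All.lookup f∉fs g∈fs (≡.sym (lookup-singleton⁻ (arc f) (arc g) p)))

  totalWeight≈ : ∀ (M : Subset m) → totalWeight G M ≈ ∑ (allFin m) (λ e → when (lookup M e) (weight G e))
  totalWeight≈ M = ≈-sym (≈-reflexive (∑-tabulate (λ e → e) (λ e → when (lookup M e) (weight G e))))

  totalWeight-support : ∀ {fs} → Distinct fs → ∑ fs weightᵉ ≤ totalWeight G (support fs)
  totalWeight-support {fs} !fs = ≤-trans (∑-support≥ !fs (weight G) (weight≥0 G)) (≤-reflexive (≈-sym (totalWeight≈ (support fs))))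

  length-support : ∀ {fs} → Distinct fs → length fs ℕ.≤ ∣ support fs ∣
  length-support {fs} !fs = ·1-cancel-≤ _ _ (≤-trans (≤-reflexive (≈-sym (∑-const fs 1#)))
    (≤-trans (∑-support≥ !fs (λ _ → 1#) (λ _ → 0≤1)) (≤-reflexive (∑-subset (support fs) 1#))))

  greedy-All : ∀ {p} {P : Ent → Set p} {xs} → All P xs → ∀ used → All P (greedy used xs)
  greedy-All [] used = []
  greedy-All {xs = f ∷ fs} (p ∷ ps) used with any (λ s → touches s f) used
  ... | true  = greedy-All ps used
  ... | false = p ∷ greedy-All ps _

  greedy-distinct : ∀ {xs} → Distinct xs → ∀ used → Distinct (greedy used xs)
  greedy-distinct [] used = []
  greedy-distinct {f ∷ fs} (p ∷ ps) used with any (λ s → touches s f) used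
  ... | true  = greedy-distinct ps used
  ... | false = greedy-All p _ ∷ greedy-distinct ps _

  filterᵇ-All : ∀ {p} {P : Ent → Set p} K {xs} → All P xs → All P (filterᵇ K xs)
  filterᵇ-All K [] = []
  filterᵇ-All K {f ∷ fs} (p ∷ ps) with K f
  ... | true  = p ∷ filterᵇ-All K ps
  ... | false = filterᵇ-All K ps

  filterᵇ-distinct : ∀ K {xs} → Distinct xs → Distinct (filterᵇ K xs)
  filterᵇ-distinct K [] = []
  filterᵇ-distinct K {f ∷ fs} (p ∷ ps) with K f
  ... | true  = filterᵇ-All K p ∷ filterᵇ-distinct K ps
  ... | false = filterᵇ-distinct K ps

  unblocked : ∀ (f : Ent) used → any (λ s → touches s f) used ≡ false → ∀ {s} → s ∈ used → touches s f ≡ false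
  unblocked f (s ∷ used) h (here refl) = proj₁ (∨-false⁻ (touches s f) h)
  unblocked f (s ∷ used) h (there s∈)  = unblocked f used (proj₂ (∨-false⁻ (touches s f) h)) s∈

  greedy-used : ∀ xs {s used} → s ∈ used → load (λ _ → 1#) s (greedy used xs) ≤ 0#
  greedy-used [] s∈used = ≤-refl
  greedy-used (f ∷ fs) {s} {used} s∈used with any (λ s → touches s f) used in free
  ... | true  = greedy-used fs s∈used
  ... | false = ≤-trans
    (+-mono-≤ (≤-reflexive (≈-reflexive (≡.cong (λ p → when p 1#) (unblocked f used free s∈used))))
              (greedy-used fs (there (there s∈used))))
    (≤-reflexive (+-identityˡ 0#))

  greedy-disjoint : ∀ xs used s → load (λ _ → 1#) s (greedy used xs) ≤ 1#
  greedy-disjoint [] used s = 0≤1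
  greedy-disjoint (f ∷ fs) used s with any (λ s → touches s f) used
  ... | true  = greedy-disjoint fs used s
  ... | false with touches s f in t
  ...   | false = ≤-trans (≤-reflexive (+-identityˡ _)) (greedy-disjoint fs _ s)
  ...   | true  = ≤-trans (+-monoʳ-≤ 1# (greedy-used fs (mem (touches⁻ s f t)))) (≤-reflexive (+-identityʳ 1#))
    where
    mem : src f ≡ s ⊎ dst f ≡ s → s ∈ (src f ∷ dst f ∷ used)
    mem (inj₁ refl) = here refl
    mem (inj₂ refl) = there (here refl)

  record Placed (f : Ent) : Set where
    field
      srcEndᵖ   : proj₁ (src f) ≡ proj₁ (ends G (arc f))
      dstEndᵖ   : proj₁ (dst f) ≡ proj₂ (ends G (arc f))
      srcIndexᵖ : proj₂ (src f) ℕ.< b (proj₁ (src f))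
      dstIndexᵖ : proj₂ (dst f) ℕ.< b (proj₁ (dst f))

  open Placed

  placed : ∀ {H} → Chain H → All Placed H
  placed []       = []
  placed (l ∷ ch) = record { srcEndᵖ = srcEnd l ; dstEndᵖ = dstEnd l ; srcIndexᵖ = srcIndex l ; dstIndexᵖ = dstIndex l } ∷ placed ch

  lookup-incident⁻ : ∀ v e → lookup (incident G v) e ≡ true → v ≡ proj₁ (ends G e) ⊎ v ≡ proj₂ (ends G e)
  lookup-incident⁻ v e h rewrite lookup∘tabulate (λ e → does (v Fin.≟ proj₁ (ends G e)) ∨ does (v Fin.≟ proj₂ (ends G e))) e
    with v Fin.≟ proj₁ (ends G e) | v Fin.≟ proj₂ (ends G e)
  ... | yes p | _     = inj₁ p
  ... | no _  | yes p = inj₂ p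
  ... | no _  | no _  with () ← h

  lookup-incident₁ : ∀ e → lookup (incident G (proj₁ (ends G e))) e ≡ true
  lookup-incident₁ e rewrite lookup∘tabulate (λ e′ → does (proj₁ (ends G e) Fin.≟ proj₁ (ends G e′)) ∨ does (proj₁ (ends G e) Fin.≟ proj₂ (ends G e′))) e
    with proj₁ (ends G e) Fin.≟ proj₁ (ends G e)
  ... | yes _ = refl
  ... | no ¬p = ⊥-elim (¬p refl)

  lookup-incident₂ : ∀ e → lookup (incident G (proj₂ (ends G e))) e ≡ true
  lookup-incident₂ e rewrite lookup∘tabulate (λ e′ → does (proj₂ (ends G e) Fin.≟ proj₁ (ends G e′)) ∨ does (proj₂ (ends G e) Fin.≟ proj₂ (ends G e′))) e
    with proj₂ (ends G e) Fin.≟ proj₂ (ends G e)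
  ... | yes _ = ∨-zeroʳ _
  ... | no ¬p = ⊥-elim (¬p refl)

  -- Every entry incident to v occupies one of the `b v` slots of v, and no slot is occupied twice.
  disjoint⇒bmatching : ∀ {fs} → All Placed fs → (∀ s → load (λ _ → 1#) s fs ≤ 1#) → IsBMatching b G (support fs)
  disjoint⇒bmatching {fs} pl disjoint v = ·1-cancel-≤ _ _
    (≤-trans (≤-reflexive (≈-sym (∑-subset (support fs ∩ incident G v) 1#)))
    (≤-trans (∑-mono (allFin m) λ e → ≤-reflexive (≈-trans
      (≈-reflexive (≡.cong (λ p → when p 1#) (lookup-zipWith _∧_ e (support fs) (incident G v))))
      (when-∧ (lookup (support fs) e) (lookup (incident G v) e))))
    (≤-trans (∑-support≤ fs (λ e → when (lookup (incident G v) e) 1#) (λ e → when≥0 (lookup (incident G v) e) 0≤1))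
    (≤-trans (∑-mono-∈ fs λ {f} f∈fs → atSlot f (All.lookup pl f∈fs))
    (≤-trans (≤-reflexive (∑-swap fs (upTo (b v)) _))
    (≤-trans (∑-mono (upTo (b v)) λ i → disjoint (v , i))
    (≤-reflexive (≈-trans (∑-const (upTo (b v)) 1#) (≈-reflexive (≡.cong (_· 1#) (length-upTo (b v))))))))))))
    where
    member : ∀ f i → i ℕ.< b v → touches (v , i) f ≡ true → 1# ≤ ∑ (upTo (b v)) (λ i → when (touches (v , i) f) 1#)
    member f i i<b t = ≤-trans (≤-reflexive (≈-reflexive (≡.cong (λ p → when p 1#) (≡.sym t))))
      (∑-member (λ i → when (touches (v , i) f) 1#) (λ i → when≥0 (touches (v , i) f) 0≤1) (∈-upTo⁺ i<b))
    atSlot : ∀ f → Placed f → when (lookup (incident G v) (arc f)) 1# ≤ ∑ (upTo (b v)) (λ i → when (touches (v , i) f) 1#)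
    atSlot f p with lookup (incident G v) (arc f) in inc
    ... | false = ∑≥0 (upTo (b v)) λ i → when≥0 (touches (v , i) f) 0≤1
    ... | true with lookup-incident⁻ v (arc f) inc
    ...   | inj₁ eq with refl ← ≡.trans eq (≡.sym (srcEndᵖ p)) = member f (proj₂ (src f)) (srcIndexᵖ p) (touches-src f)
    ...   | inj₂ eq with refl ← ≡.trans eq (≡.sym (dstEndᵖ p)) = member f (proj₂ (dst f)) (dstIndexᵖ p) (touches-dst f)

  greedy-bmatching : ∀ {fs} → All Placed fs → IsBMatching b G (support (greedy [] fs))
  greedy-bmatching {fs} pl = disjoint⇒bmatching (greedy-All pl []) (greedy-disjoint fs [])

  -- The argmin over 0, ..., k with k included, so for a vertex of capacity `suc a` it is called
  -- with `a`.
  best : (ℕ → Carrier) → ℕ → ℕ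
  best φ zero    = zero
  best φ (suc k) = if does (φ (best φ k) ≤? φ (suc k)) then best φ k else suc k

  best≤ : ∀ (φ : ℕ → Carrier) k → best φ k ℕ.≤ k
  best≤ φ zero = ℕ.z≤n
  best≤ φ (suc k) with does (φ (best φ k) ≤? φ (suc k))
  ... | true  = ℕ.m≤n⇒m≤1+n (best≤ φ k)
  ... | false = ℕ.≤-refl

  best-min : ∀ (φ : ℕ → Carrier) k {i} → i ℕ.≤ k → φ (best φ k) ≤ φ i
  best-min φ zero ℕ.z≤n = ≤-refl
  best-min φ (suc k) {i} i≤ with φ (best φ k) ≤? φ (suc k) | ℕ.m≤n⇒m<n∨m≡n i≤
  ... | yes h | inj₁ (ℕ.s≤s i≤k) = best-min φ k i≤k
  ... | yes h | inj₂ refl        = h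
  ... | no ¬h | inj₁ (ℕ.s≤s i≤k) = ≤-trans (≰⇒≥ ¬h) (best-min φ k i≤k)
  ... | no ¬h | inj₂ refl        = ≤-refl

  best-cong : ∀ {φ ψ : ℕ → Carrier} → (∀ i → φ i ≡ ψ i) → ∀ k → best φ k ≡ best ψ k
  best-cong h zero = refl
  best-cong {φ} {ψ} h (suc k) rewrite best-cong h k | h (best ψ k) | h (suc k) = refl

  cheapest : List Ent → Fin n → ℕ → Slot n
  cheapest H v k = v , best (λ i → pot H (v , i)) k

  newEntry : List Ent → Fin m → ℕ → ℕ → Ent
  newEntry H e a d = entry e s t (weight G e - pot H t) (weight G e - pot H s)
    where
    s = cheapest H (proj₁ (ends G e)) a
    t = cheapest H (proj₂ (ends G e)) d

  Light : List Ent → Fin m → ℕ → ℕ → Set ℓ₂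
  Light H e a d = weight G e ≤
    (1# + δ) * (pot H (cheapest H (proj₁ (ends G e)) a) + pot H (cheapest H (proj₂ (ends G e)) d))

  -- Edges and entries are both listed newest first. `skip` treats an end of capacity 0, where there
  -- is no slot to choose.
  data Run : List (Fin m) → List Ent → Set (c ⊔ ℓ₂) where
    start  : Run [] []
    skip   : ∀ {es H e} → b (proj₁ (ends G e)) ≡ 0 ⊎ b (proj₂ (ends G e)) ≡ 0 → Run es H → Run (e ∷ es) H
    reject : ∀ {es H e a d} → b (proj₁ (ends G e)) ≡ suc a → b (proj₂ (ends G e)) ≡ suc d →
             Light H e a d → Run es H → Run (e ∷ es) H
    accept : ∀ {es H e a d} → b (proj₁ (ends G e)) ≡ suc a → b (proj₂ (ends G e)) ≡ suc d →
             ¬ Light H e a d → Run es H → Run (e ∷ es) (newEntry H e a d ∷ H)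

  cheapest-min : ∀ H v {a} → b v ≡ suc a → ∀ i → i ℕ.< b v → pot H (cheapest H v a) ≤ pot H (v , i)
  cheapest-min H v {a} eq i i<b = best-min (λ i → pot H (v , i)) a (ℕ.≤-pred (ℕ.≤-trans i<b (ℕ.≤-reflexive eq)))

  cheapest< : ∀ H v {a} → b v ≡ suc a → proj₂ (cheapest H v a) ℕ.< b v
  cheapest< H v {a} eq = ℕ.≤-trans (ℕ.s≤s (best≤ _ a)) (ℕ.≤-reflexive (≡.sym eq))

  chain : ∀ {es H} → Run es H → Chain H
  chain start = []
  chain (skip _ r)       = chain r
  chain (reject _ _ _ r) = chain r
  chain (accept {H = H} {e} p q heavy r) = record
    { srcEnd   = refl
    ; dstEnd   = refl
    ; srcIndex = cheapest< H _ p
    ; dstIndex = cheapest< H _ q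
    ; srcPot+  = x-z+z≈x _ _
    ; dstPot+  = x-z+z≈x _ _
    ; srcMin   = cheapest-min H _ p
    ; dstMin   = cheapest-min H _ q
    ; heavy    = ≰⇒> heavy
    } ∷ chain r

  arcs-seen : ∀ {es H} → Run es H → All (λ f → arc f ∈ es) H
  arcs-seen start            = []
  arcs-seen (skip _ r)       = All.map there (arcs-seen r)
  arcs-seen (reject _ _ _ r) = All.map there (arcs-seen r)
  arcs-seen (accept _ _ _ r) = here refl ∷ All.map there (arcs-seen r)

  distinct : ∀ {es H} → Unique es → Run es H → Distinct H
  distinct _ start = []
  distinct (_ ∷ !es) (skip _ r)       = distinct !es r
  distinct (_ ∷ !es) (reject _ _ _ r) = distinct !es r
  distinct (e∉es ∷ !es) (accept _ _ _ r) = All.map (λ h → All.lookup e∉es h) (arcs-seen r) ∷ distinct !es r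

-- Weak duality: prices made from potentials.

module Duality {c ℓ₁ ℓ₂} (R : ArchimedeanOrderedField c ℓ₁ ℓ₂)
                {n m : ℕ} (b : Fin n → ℕ) (G : BMatching.Multigraph R n m)
                (δ : ArchimedeanOrderedField.Carrier R)
                (0≤δ : ArchimedeanOrderedField._≤_ R (ArchimedeanOrderedField.0# R) δ)
                (θ : ArchimedeanOrderedField.Carrier R)
                (0≤θ : ArchimedeanOrderedField._≤_ R (ArchimedeanOrderedField.0# R) θ) where
  open OrderedField R
  open ListSum R
  open BMatching R
  open Multigraph
  open Solver using (solve; _:+_; _:*_; _:=_; con)
  open Matching R b G δ 0≤δ θ 0≤θ public
  open Link

  newestArc : List Ent → Slot n → Fin m → Bool
  newestArc H s e = maybe′ (λ f → does (arc f Fin.≟ e)) false (newest s H)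

  -- A seen edge is paid for at each end either by all slots there or by the
  -- one slot where it is the newest entry.
  Bounded : List Ent → Fin n → Fin m → Carrier → Set ℓ₂
  Bounded H v e x =
    (∀ i → i ℕ.< b v → x ≤ pot H (v , i)) ⊎
    (∃[ i ] i ℕ.< b v × newestArc H (v , i) e ≡ true × x ≤ pot H (v , i))

  Covered : List Ent → Fin m → Set (c ⊔ ℓ₂)
  Covered H e = ∃[ x ] ∃[ y ] weight G e ≤ (1# + δ) * (x + y) ×
                Bounded H (proj₁ (ends G e)) e x × Bounded H (proj₂ (ends G e)) e y

  newestArc-other : ∀ H f s e → touches s f ≡ false → newestArc (f ∷ H) s e ≡ newestArc H s e
  newestArc-other H f s e t = ≡.cong (λ p → maybe′ (λ f → does (arc f Fin.≟ e)) false (if p then just f else newest s H)) t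

  pot-other : ∀ H f s → touches s f ≡ false → pot (f ∷ H) s ≡ pot H s
  pot-other H f s t = ≡.cong (λ p → maybe′ (value s) 0# (if p then just f else newest s H)) t

  newestArc-self : ∀ H f s → touches s f ≡ true → newestArc (f ∷ H) s (arc f) ≡ true
  newestArc-self H f s t = ≡.trans
    (≡.cong (λ p → maybe′ (λ g → does (arc g Fin.≟ arc f)) false (if p then just f else newest s H)) t) self
    where
    self : does (arc f Fin.≟ arc f) ≡ true
    self with arc f Fin.≟ arc f
    ... | yes _ = refl
    ... | no ¬p = ⊥-elim (¬p refl)

  touched-min : ∀ {H f} → Link H f → ∀ v i → touches (v , i) f ≡ true → ∀ j → j ℕ.< b v → pot H (v , i) ≤ pot H (v , j)
  touched-min {H} {f} l v i t with touches⁻ (v , i) f t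
  ... | inj₁ refl = srcMin l
  ... | inj₂ refl = dstMin l

  -- The interesting case is an overwritten slot. It was a minimum at its vertex, so its old
  -- potential is a lower bound for all slots there, and the second alternative passes into the
  -- first.
  bounded-step : ∀ {H f} → Chain (f ∷ H) → ∀ {v e x} → Bounded H v e x → Bounded (f ∷ H) v e x
  bounded-step ch (inj₁ h) = inj₁ λ i i<b → ≤-trans (h i i<b) (pot-mono ch _)
  bounded-step {H} {f} ch@(l ∷ _) {v} {e} (inj₂ (i , i<b , top , h)) with touches (v , i) f in t
  ... | false = inj₂ (i , i<b , ≡.trans (newestArc-other H f (v , i) e t) top ,
                      ≤-trans h (≤-reflexive (≈-reflexive (≡.sym (pot-other H f (v , i) t)))))
  ... | true  = inj₁ λ j j<b → ≤-trans h (≤-trans (touched-min l v i t j j<b) (pot-mono ch _))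

  covered-step : ∀ {H f} → Chain (f ∷ H) → ∀ {e} → Covered H e → Covered (f ∷ H) e
  covered-step ch (x , y , w≤ , u , v) = x , y , w≤ , bounded-step ch u , bounded-step ch v

  -- The weight is `srcPot f` plus the old potential of the destination slot, and that potential is
  -- at most its raised value.
  covered-new : ∀ {H f} → Chain (f ∷ H) → Covered (f ∷ H) (arc f)
  covered-new {H} {f} ch@(l ∷ ch′) =
    value (src f) f , value (dst f) f , w≤ ,
    ≡.subst (λ v → Bounded (f ∷ H) v (arc f) _) (srcEnd l) (new (src f) (srcIndex l) (touches-src f)) ,
    ≡.subst (λ v → Bounded (f ∷ H) v (arc f) _) (dstEnd l) (new (dst f) (dstIndex l) (touches-dst f))
    where
    new : ∀ s → proj₂ s ℕ.< b (proj₁ s) → touches s f ≡ true → Bounded (f ∷ H) (proj₁ s) (arc f) (value s f)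
    new s i<b t = inj₂ (proj₂ s , i<b , newestArc-self H f s t , value≤pot ch (here refl) s t)
    sides = +-nonNegative (proj₁ (0<valueᶜ ch (here refl) (src f) (touches-src f)))
                          (proj₁ (0<valueᶜ ch (here refl) (dst f) (touches-dst f)))
    w≤ : weightᵉ f ≤ (1# + δ) * (value (src f) f + value (dst f) f)
    w≤ = ≤-trans (≤-reflexive (≈-sym (srcPot+ l)))
      (≤-trans (+-mono-≤ (≤-reflexive (≈-reflexive (≡.sym (value-src f))))
                         (≤-trans (pot-mono ch (dst f)) (≤-reflexive (≈-reflexive (newest-value (dst f) (touches-dst f))))))
      (≤-trans (x≤x+y (*-nonNegative 0≤δ sides))
        (≤-reflexive (solve 2 (λ d x → x :+ d :* x := (con 1 :+ d) :* x) ≈-refl δ (value (src f) f + value (dst f) f)))))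
      where
      newest-value : ∀ s → touches s f ≡ true → pot (f ∷ H) s ≡ value s f
      newest-value s t = ≡.cong (λ p → maybe′ (value s) 0# (if p then just f else newest s H)) t

  covered : ∀ {es H} → Run es H → ∀ {e} → e ∈ es → ∀ {a d} →
            b (proj₁ (ends G e)) ≡ suc a → b (proj₂ (ends G e)) ≡ suc d → Covered H e
  covered (skip (inj₁ u0) r) (here refl) p q with () ← ≡.trans (≡.sym u0) p
  covered (skip (inj₂ v0) r) (here refl) p q with () ← ≡.trans (≡.sym v0) q
  covered (skip _ r)         (there e∈)  p q = covered r e∈ p q
  covered (reject {H = H} p′ q′ light r) (here refl) p q =
    _ , _ , light , inj₁ (cheapest-min H _ p′) , inj₁ (cheapest-min H _ q′)
  covered (reject _ _ _ r)     (there e∈)  p q = covered r e∈ p q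
  covered r@(accept _ _ _ _)   (here refl) p q = covered-new (chain r)
  covered r@(accept _ _ _ r′)  (there e∈)  p q = covered-step (chain r) (covered r′ e∈ p q)

  -- At capacity 0 the predecessor falls back to index 0, which is no slot of the vertex; this is
  -- harmless, as no edge can be matched there.
  floor : List Ent → Fin n → Carrier
  floor H v = pot H (cheapest H v (ℕ.pred (b v)))

  floor≤ : ∀ H v {i} → i ℕ.< b v → floor H v ≤ pot H (v , i)
  floor≤ H v {i} i<b = best-min (λ i → pot H (v , i)) (ℕ.pred (b v)) (ℕ.pred-mono-≤ i<b)

  -- In terms of the dual linear program, the floor is the vertex variable and the sum is the part
  -- of the edge variable that is contributed at v.
  price : List Ent → Fin n → Fin m → Carrier
  price H v e = floor H v + ∑ (upTo (b v)) (λ i → when (newestArc H (v , i) e) (pot H (v , i) - floor H v))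

  surplus≥0 : ∀ H v {i} p → i ∈ upTo (b v) → 0# ≤ when p (pot H (v , i) - floor H v)
  surplus≥0 H v p i∈ = when≥0 p (y≤x⇒0≤x-y (floor≤ H v (∈-upTo⁻ i∈)))

  price≥0 : ∀ {H} → Chain H → ∀ v e → 0# ≤ price H v e
  price≥0 {H} ch v e = +-nonNegative (pot≥0ᶜ ch _) (∑≥0-∈ (upTo (b v)) λ {i} → surplus≥0 H v (newestArc H (v , i) e))

  bounded≤price : ∀ H v e {x a} → b v ≡ suc a → Bounded H v e x → x ≤ price H v e
  bounded≤price H v e {a = a} eq (inj₁ h) =
    ≤-trans (h _ (cheapest< H v (≡.trans eq (≡.cong suc (≡.sym (≡.cong ℕ.pred eq))))))
      (x≤x+y (∑≥0-∈ (upTo (b v)) λ {i} → surplus≥0 H v (newestArc H (v , i) e)))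
  bounded≤price H v e eq (inj₂ (i , i<b , top , h)) =
    ≤-trans h (≤-trans (≤-reflexive (≈-sym (≈-trans (+-comm _ _) (x-z+z≈x _ (floor H v)))))
      (+-monoʳ-≤ (floor H v) (≤-trans
        (≤-reflexive (≈-reflexive (≡.cong (λ p → when p (pot H (v , i) - floor H v)) (≡.sym top))))
        (∑-member-∈ (λ i → when (newestArc H (v , i) e) (pot H (v , i) - floor H v))
          (λ {i} → surplus≥0 H v (newestArc H (v , i) e)) (∈-upTo⁺ i<b)))))

  ∑-newestArc≤ : ∀ H s {x} → 0# ≤ x → ∑ (allFin m) (λ e → when (newestArc H s e) x) ≤ x
  ∑-newestArc≤ H s 0≤x = ∑-atMostOne (allFin⁺ m) (newestArc H s) 0≤x one
    where
    one : ∀ {e e′} → newestArc H s e ≡ true → newestArc H s e′ ≡ true → e ≡ e′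
    one {e} {e′} p q with newest s H
    ... | just f with yes x ← arc f Fin.≟ e | yes y ← arc f Fin.≟ e′ = ≡.trans (≡.sym x) y

  -- At most `b v` matched edges pay the floor, and each slot gives its surplus to a single edge,
  -- its newest. Floor and surplus of a slot add up to its potential.
  ∑-price≤ : ∀ {H} → Chain H → ∀ N → IsBMatching b G N → ∀ v →
             ∑ (allFin m) (λ e → when (lookup (N ∩ incident G v) e) (price H v e)) ≤ ∑ (upTo (b v)) (λ i → pot H (v , i))
  ∑-price≤ {H} ch N bm v =
    ≤-trans (≤-reflexive (∑-cong (allFin m) λ e → when-+ (lookup (N ∩ incident G v) e)))
    (≤-trans (≤-reflexive (∑-+ (allFin m) _ _))
    (≤-trans (+-mono-≤
      (≤-trans (≤-reflexive (∑-subset (N ∩ incident G v) (floor H v))) (·-monoˡ-≤ (bm v) (pot≥0ᶜ ch _)))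
      (≤-trans (∑-mono (allFin m) λ e → when≤ (lookup (N ∩ incident G v) e)
                 (∑≥0-∈ (upTo (b v)) λ {i} → surplus≥0 H v (newestArc H (v , i) e)))
      (≤-trans (≤-reflexive (∑-swap (allFin m) (upTo (b v)) _))
               (∑-mono-∈ (upTo (b v)) λ {i} i∈ → ∑-newestArc≤ H (v , i) (y≤x⇒0≤x-y (floor≤ H v (∈-upTo⁻ i∈)))))))
    (≤-reflexive (≈-trans (+-cong (≈-sym (≈-trans (∑-const (upTo (b v)) (floor H v))
        (≈-reflexive (≡.cong (_· floor H v) (length-upTo (b v)))))) ≈-refl)
      (≈-trans (≈-sym (∑-+ (upTo (b v)) _ _))
        (∑-cong (upTo (b v)) λ i → ≈-trans (+-comm _ _) (x-z+z≈x _ (floor H v))))))))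

  matched⇒suc : ∀ N → IsBMatching b G N → ∀ v e → lookup (N ∩ incident G v) e ≡ true → ∃[ a ] b v ≡ suc a
  matched⇒suc N bm v e h with b v in eq
  ... | suc a = a , refl
  ... | zero  with () ← ℕ.≤-trans (·1-cancel-≤ 1 ∣ N ∩ incident G v ∣
          (≤-trans (≤-reflexive (+-identityʳ 1#)) (≤-trans
            (≤-reflexive (≈-reflexive (≡.cong (λ p → when p 1#) (≡.sym h))))
            (≤-trans (∑-member (λ e → when (lookup (N ∩ incident G v) e) 1#)
                       (λ e → when≥0 (lookup (N ∩ incident G v) e) 0≤1) (∈-allFin e))
              (≤-reflexive (∑-subset (N ∩ incident G v) 1#))))))
          (≡.subst (∣ N ∩ incident G v ∣ ℕ.≤_) eq (bm v))

  -- Weak duality: the prices of the two ends of a matched edge pay for it.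
  dual : ∀ {es H} → Run es H → (∀ e → e ∈ es) → ∀ N → IsBMatching b G N →
         totalWeight G N ≤ (1# + δ) * ∑ slots (pot H)
  dual {es} {H} r all N bm =
    ≤-trans (≤-reflexive (totalWeight≈ N))
    (≤-trans (∑-mono (allFin m) pay)
    (≤-trans (≤-reflexive (∑-* (allFin m) (1# + δ) _))
    (*-monoʳ-≤ (+-nonNegative 0≤1 0≤δ)
      (≤-trans (≤-reflexive (∑-swap (allFin m) (allFin n) _))
      (≤-trans (∑-mono (allFin n) (∑-price≤ ch N bm)) (≤-reflexive (≈-sym (∑-slots (pot H)))))))))
    where
    ch = chain r
    share : Fin m → Fin n → Carrier
    share e v = when (lookup (N ∩ incident G v) e) (price H v e)
    share≥0 : ∀ e v → 0# ≤ share e v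
    share≥0 e v = when≥0 (lookup (N ∩ incident G v) e) (price≥0 ch v e)
    -- As there are no self-loops, the two ends contribute two different terms to the sum over all
    -- vertices.
    both : ∀ {e u v} → u ≢ v → share e u + share e v ≤ ∑ (allFin n) (share e)
    both {e} {u} {v} u≢v = ≤-trans (+-mono-≤ (pick u) (pick v))
      (≤-trans (≤-reflexive (≈-sym (∑-+ (allFin n) _ _))) (∑-mono (allFin n) merge))
      where
      pick : ∀ u → share e u ≤ ∑ (allFin n) (λ v → when (does (u Fin.≟ v)) (share e v))
      pick u = ≤-trans (≤-reflexive (≈-reflexive (≡.sym self)))
        (∑-member (λ v → when (does (u Fin.≟ v)) (share e v)) (λ v → when≥0 (does (u Fin.≟ v)) (share≥0 e v)) (∈-allFin u))
        where
        self : when (does (u Fin.≟ u)) (share e u) ≡ share e u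
        self with u Fin.≟ u
        ... | yes _ = refl
        ... | no ¬p = ⊥-elim (¬p refl)
      merge : ∀ x → when (does (u Fin.≟ x)) (share e x) + when (does (v Fin.≟ x)) (share e x) ≤ share e x
      merge x with u Fin.≟ x | v Fin.≟ x
      ... | yes p | yes q = ⊥-elim (u≢v (≡.trans p (≡.sym q)))
      ... | yes _ | no _  = ≤-reflexive (+-identityʳ _)
      ... | no _  | yes _ = ≤-reflexive (+-identityˡ _)
      ... | no _  | no _  = ≤-trans (≤-reflexive (+-identityˡ _)) (share≥0 e x)
    pay : ∀ e → when (lookup N e) (weight G e) ≤ (1# + δ) * ∑ (allFin n) (share e)
    pay e with lookup N e in e∈N
    ... | false = *-nonNegative (+-nonNegative 0≤1 0≤δ) (∑≥0 (allFin n) (share≥0 e))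
    ... | true  = paid (matched⇒suc N bm u e u∋e) (matched⇒suc N bm v e v∋e)
      where
      u = proj₁ (ends G e)
      v = proj₂ (ends G e)
      u∋e : lookup (N ∩ incident G u) e ≡ true
      u∋e = ≡.trans (lookup-zipWith _∧_ e N (incident G u)) (≡.cong₂ _∧_ e∈N (lookup-incident₁ e))
      v∋e : lookup (N ∩ incident G v) e ≡ true
      v∋e = ≡.trans (lookup-zipWith _∧_ e N (incident G v)) (≡.cong₂ _∧_ e∈N (lookup-incident₂ e))
      paid : ∃[ a ] b u ≡ suc a → ∃[ d ] b v ≡ suc d → weight G e ≤ (1# + δ) * ∑ (allFin n) (share e)
      paid (_ , p) (_ , q) with x , y , w≤ , bu , bv ← covered r (all e) p q =
        ≤-trans w≤ (*-monoʳ-≤ (+-nonNegative 0≤1 0≤δ) (≤-trans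
          (+-mono-≤ (≤-trans (bounded≤price H u e p bu) (≤-reflexive (≈-reflexive (≡.cong (λ t → when t (price H u e)) (≡.sym u∋e)))))
                    (≤-trans (bounded≤price H v e q bv) (≤-reflexive (≈-reflexive (≡.cong (λ t → when t (price H v e)) (≡.sym v∋e))))))
          (both (loopless G e))))

-- The streaming program.

module Programs {c ℓ₁ ℓ₂} (R : ArchimedeanOrderedField c ℓ₁ ℓ₂)
                {n : ℕ} (b : Fin n → ℕ)
                (δ θ : ArchimedeanOrderedField.Carrier R) where
  open OrderedField R
  open BMatching R

  infixl 6 _⊕_ _⊖_
  infixl 7 _⊗_

  -- Nested arithmetic, which `push` compiles to single operations that use the front of the memory
  -- as a stack.
  data Term (I Γ : Ctx) : Set c where
    atom        : Expr I Γ num → Term I Γ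
    _⊕_ _⊖_ _⊗_ : Term I Γ → Term I Γ → Term I Γ

  -- Five variables for an entry: the edge, the two slot indices and the two potentials. The
  -- vertices of the slots are read off the edge.
  ctx : ∀ {a} {A : Set a} → List A → Ctx
  ctx []       = []
  ctx (_ ∷ xs) = edge ∷ num ∷ num ∷ num ∷ num ∷ ctx xs

  module _ {I : Ctx} where

    wkOperand : ∀ {Γ τ} → Operand I Γ τ → Operand I (num ∷ Γ) τ
    wkOperand (var x) = var (there x)
    wkOperand (inp x) = inp x

    mapExpr : ∀ {Γ Δ τ} → (∀ {τ} → Operand I Γ τ → Operand I Δ τ) → Expr I Γ τ → Expr I Δ τ
    mapExpr ρ (get x)      = get (ρ x)
    mapExpr ρ (const r)    = const r
    mapExpr ρ (weightOf x) = weightOf (ρ x)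
    mapExpr ρ (add x y)    = add (ρ x) (ρ y)
    mapExpr ρ (sub x y)    = sub (ρ x) (ρ y)
    mapExpr ρ (mul x y)    = mul (ρ x) (ρ y)

    v₀ : ∀ {Γ τ} → Operand I (τ ∷ Γ) τ
    v₀ = var (here refl)

    v₁ : ∀ {Γ σ τ} → Operand I (σ ∷ τ ∷ Γ) τ
    v₁ = var (there (here refl))

    keep : ∀ {Γ} → All (Expr I Γ) Γ
    keep = All.tabulate λ x → get (var x)

    drop₂ : ∀ {Γ σ τ} → All (Expr I (σ ∷ τ ∷ Γ)) Γ
    drop₂ = All.tabulate λ x → get (var (there (there x)))

    push : ∀ {Γ Δ} → (∀ {τ} → Operand I Γ τ → Operand I Δ τ) → Term I Γ → Program n I (num ∷ Δ) → Program n I Δ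
    push ρ (atom x) P = assign (mapExpr ρ x ∷ keep) P
    push ρ (s ⊕ t)  P = push ρ s (push (λ x → wkOperand (ρ x)) t (assign (add v₁ v₀ ∷ drop₂) P))
    push ρ (s ⊖ t)  P = push ρ s (push (λ x → wkOperand (ρ x)) t (assign (sub v₁ v₀ ∷ drop₂) P))
    push ρ (s ⊗ t)  P = push ρ s (push (λ x → wkOperand (ρ x)) t (assign (mul v₁ v₀ ∷ drop₂) P))

    -- The variables needed on top of the present ones. The result itself is not counted: a context
    -- is charged when it is left, so the continuation pays for it.
    height : ∀ {Γ} → Term I Γ → ℕ
    height (atom x) = 0
    height (s ⊕ t)  = height s ℕ.⊔ (suc (height t) ℕ.⊔ 2)
    height (s ⊖ t)  = height s ℕ.⊔ (suc (height t) ℕ.⊔ 2)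
    height (s ⊗ t)  = height s ℕ.⊔ (suc (height t) ℕ.⊔ 2)

    -- Both numbers are discarded before `κ` takes over. The outcome lives on only as the position
    -- in the program, which costs no variable.
    branch : ∀ {Γ} → Term I Γ → Term I Γ → (Bool → Program n I Γ) → Program n I Γ
    branch s t κ = push (λ x → x) s (push wkOperand t (if≤ v₁ v₀ (assign drop₂ (κ true)) (assign drop₂ (κ false))))

    record Block (Γ : Ctx) : Set where
      constructor block
      field
        arcᵒ      : Operand I Γ edge
        iᵒ jᵒ     : Operand I Γ num
        srcᵒ dstᵒ : Operand I Γ num

    open Block public

    -- The types of the variables survive between arrivals and reveal how many entries are stored.
    -- The last clause serves the end of the context, and shapes that no run produces.
    parseAt : ∀ {Γ₀} Γ → (∀ {τ} → τ ∈ Γ → τ ∈ Γ₀) → List (Block Γ₀)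
    parseAt (edge ∷ num ∷ num ∷ num ∷ num ∷ Γ) ρ =
      block (var (ρ (here refl))) (var (ρ (there (here refl)))) (var (ρ (there (there (here refl)))))
            (var (ρ (there (there (there (here refl)))))) (var (ρ (there (there (there (there (here refl))))))) ∷
      parseAt Γ (λ x → ρ (there (there (there (there (there x))))))
    parseAt _ ρ = []

    -- An index i is stored as the number i · 1#; it is read back by searching
    -- for the first i which is not exceeded.
    search : ∀ {Γ} → ℕ → ℕ → Operand I Γ num → (ℕ → Program n I Γ) → Program n I Γ
    search zero    i x κ = κ i
    search (suc k) i x κ = branch (atom (get x)) (atom (const (i · 1#))) λ p → if p then κ i else search k (suc i) x κ

    Symbolic : Ctx → Set
    Symbolic Γ = Entry n (Operand I Γ edge) (Operand I Γ num)

    -- Turns slots into data known to the program text: vertices by branching on the edge, indices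
    -- by search. Only edges and potentials remain operands.
    decode : ∀ {Γ} → List (Block Γ) → (List (Symbolic Γ) → Program n I Γ) → Program n I Γ
    decode []       κ = κ []
    decode (B ∷ Bs) κ = onEnds (arcᵒ B) λ u v →
      search (b u) 0 (iᵒ B) λ i → search (b v) 0 (jᵒ B) λ j →
      decode Bs λ S → κ (entry (arcᵒ B) (u , i) (v , j) (srcᵒ B) (dstᵒ B) ∷ S)

    potTerm : ∀ {Γ} → List (Symbolic Γ) → Slot n → Term I Γ
    potTerm S s = atom (maybe′ (get ∘ value s) (const 0#) (newest s S))

    -- Together with `decideStays` and `sift`, the continuation-passing form of `best`, `stays` and
    -- the filter: each comparison of numbers becomes a `branch`.
    choose : ∀ {Γ} → List (Symbolic Γ) → Fin n → ℕ → (ℕ → Program n I Γ) → Program n I Γ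
    choose S v zero    κ = κ zero
    choose S v (suc k) κ = choose S v k λ i →
      branch (potTerm S (v , i)) (potTerm S (v , suc k)) λ p → κ (if p then i else suc k)

    decideStays : ∀ {Γ} → List (Symbolic Γ) → Symbolic Γ → (Bool → Program n I Γ) → Program n I Γ
    decideStays S f κ =
      branch (potTerm S (src f)) (atom (get (srcPot f))) λ p → if p then κ true else
      branch (potTerm S (dst f)) (atom (get (dstPot f))) λ p → if p then κ true else
      branch (atom (get (srcPot f))) (atom (const θ) ⊗ potTerm S (src f)) λ p → if p then κ false else
      branch (atom (get (dstPot f))) (atom (const θ) ⊗ potTerm S (dst f)) λ p → if p then κ false else κ true

    sift : ∀ {Γ} → List (Symbolic Γ) → List (Symbolic Γ) → (List (Symbolic Γ) → Program n I Γ) → Program n I Γ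
    sift S []       κ = κ []
    sift S (f ∷ fs) κ = decideStays S f λ p → sift S fs λ S′ → κ (if p then f ∷ S′ else S′)

    exprs : ∀ {Γ} (S : List (Symbolic Γ)) → All (Expr I Γ) (ctx S)
    exprs []      = []
    exprs (f ∷ S) = get (arc f) ∷ const (proj₂ (src f) · 1#) ∷ const (proj₂ (dst f) · 1#) ∷
                    get (srcPot f) ∷ get (dstPot f) ∷ exprs S

    store : ∀ {Γ} → List (Symbolic Γ) → Program n I Γ
    store S = assign (exprs S) halt

    -- Operands belong to a fixed context. Storing the new block changes the context, so all entries
    -- are decoded afresh.
    prune : ∀ Γ → Program n I Γ
    prune Γ = decode (parseAt Γ λ x → x) λ S → sift S S store

    newBlock : ∀ {Γ} → Operand I (num ∷ num ∷ Γ) edge → ℕ → ℕ → All (Expr I (num ∷ num ∷ Γ)) (edge ∷ num ∷ num ∷ num ∷ num ∷ Γ)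
    -- The number pushed first is now `v₁`: it is the weight less the destination potential, hence
    -- the new source potential.
    newBlock e i j = get e ∷ const (i · 1#) ∷ const (j · 1#) ∷ get v₁ ∷ get v₀ ∷ drop₂

  arriving : ∀ {Γ} → Operand (edge ∷ []) Γ edge
  arriving = inp (here refl)

  threshold : ∀ {I Γ} → Term I Γ → Term I Γ → Term I Γ
  threshold p q = atom (const (1# + δ)) ⊗ (p ⊕ q)

  admit : ∀ Γ → Fin n → Fin n → ℕ → ℕ → Program n (edge ∷ []) Γ
  -- An end of capacity 0 stops the program before anything is computed, so that unusable edges
  -- alone never cause memory to be used.
  admit Γ u v zero    _       = halt
  admit Γ u v (suc a) zero    = halt
  admit Γ u v (suc a) (suc d) =
    decode (parseAt Γ λ x → x) λ S → choose S u a λ i → choose S v d λ j →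
    branch (atom (weightOf arriving)) (threshold (potTerm S (u , i)) (potTerm S (v , j))) λ light →
    if light then halt else
    push (λ x → x) (atom (weightOf arriving) ⊖ potTerm S (v , j)) (
    push wkOperand (atom (weightOf arriving) ⊖ potTerm S (u , i)) (
    assign (newBlock arriving i j) (prune _)))

  program : StreamingProgram n
  program = record
    { onArrival = λ Γ → onEnds arriving λ u v → admit Γ u v (b u) (b v)
    ; finish    = λ Γ → decode (parseAt Γ λ x → x) λ S → store (greedy [] S)
    }

filterᵇ-∷ : ∀ {a} {A : Set a} (p : A → Bool) x xs →
            filterᵇ p (x ∷ xs) ≡ (if p x then x ∷ filterᵇ p xs else filterᵇ p xs)
filterᵇ-∷ p x xs with p x
... | true  = refl
... | false = refl

length-filterᵇ : ∀ {a} {A : Set a} (p : A → Bool) xs → length (filterᵇ p xs) ℕ.≤ length xs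
length-filterᵇ p []       = ℕ.z≤n
length-filterᵇ p (x ∷ xs) with p x
... | true  = ℕ.s≤s (length-filterᵇ p xs)
... | false = ℕ.m≤n⇒m≤1+n (length-filterᵇ p xs)

-- The program computes the run, within a known number of variables.

module Simulation {c ℓ₁ ℓ₂} (R : ArchimedeanOrderedField c ℓ₁ ℓ₂)
                {n m : ℕ} (b : Fin n → ℕ) (G : BMatching.Multigraph R n m)
                (δ : ArchimedeanOrderedField.Carrier R)
                (0≤δ : ArchimedeanOrderedField._≤_ R (ArchimedeanOrderedField.0# R) δ)
                (θ : ArchimedeanOrderedField.Carrier R)
                (0≤θ : ArchimedeanOrderedField._≤_ R (ArchimedeanOrderedField.0# R) θ) where
  open OrderedField R
  open BMatching R
  open Multigraph
  open Execution G renaming (value to valueOf)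
  open Duality R b G δ 0≤δ θ 0≤θ public
  open Programs R b δ θ public
  open Placed

  enc : (xs : List Ent) → Memory m (ctx xs)
  enc []       = []
  enc (x ∷ xs) = edge (arc x) ∷ num (proj₂ (src x) · 1#) ∷ num (proj₂ (dst x) · 1#) ∷
                 num (srcPot x) ∷ num (dstPot x) ∷ enc xs

  storedEdges-enc : ∀ xs → storedEdges (enc xs) ≡ support xs
  storedEdges-enc []       = refl
  storedEdges-enc (x ∷ xs) = ≡.cong (⁅ arc x ⁆ ∪_) (storedEdges-enc xs)

  module _ {I : Ctx} (ι : Memory m I) where

    -- Here w bounds the variables used by `P` on its own account, whatever the peak p before it.
    -- The same w can thus be passed unchanged through a chain of continuations.
    record Yields {Γ Δ : Ctx} (P : Program n I Γ) (μ : Memory m Γ) (w : ℕ) (ν : Memory m Δ) : Set c where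
      constructor yields
      field
        outcome : ∀ p → ∃[ q ] exec ι P p μ ≡ config q ν × q ℕ.≤ p ℕ.⊔ w

    open Yields

    eval-tabulate : ∀ {Γ Γ′} {μ : Memory m Γ} (f : ∀ {τ} → τ ∈ Γ′ → Expr I Γ τ) (μ′ : Memory m Γ′) →
                    (∀ {τ} (x : τ ∈ Γ′) → eval ι μ (f x) ≡ All.lookup μ′ x) →
                    All.map (eval ι μ) (All.tabulate f) ≡ μ′
    eval-tabulate f []       h = refl
    eval-tabulate f (r ∷ μ′) h = ≡.cong₂ _∷_ (h (here refl)) (eval-tabulate (f ∘ there) μ′ (h ∘ there))

    eval-keep : ∀ {Γ} (μ : Memory m Γ) → All.map (eval ι μ) keep ≡ μ
    eval-keep μ = eval-tabulate _ μ λ _ → refl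

    eval-drop₂ : ∀ {Γ σ τ} {x : Value m σ} {y : Value m τ} (μ : Memory m Γ) →
                 All.map (eval ι (x ∷ y ∷ μ)) drop₂ ≡ μ
    eval-drop₂ μ = eval-tabulate _ μ λ _ → refl

    eval-mapExpr : ∀ {Γ Γ′ τ} {ρ : ∀ {τ} → Operand I Γ τ → Operand I Γ′ τ} {μ : Memory m Γ} {μ′ : Memory m Γ′} →
                   (∀ {τ} (x : Operand I Γ τ) → valueOf ι μ′ (ρ x) ≡ valueOf ι μ x) →
                   (x : Expr I Γ τ) → eval ι μ′ (mapExpr ρ x) ≡ eval ι μ x
    eval-mapExpr h (get x)      = h x
    eval-mapExpr h (const r)    = refl
    eval-mapExpr h (weightOf x) = ≡.cong (λ v → num (weight G (toEdge v))) (h x)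
    eval-mapExpr h (add x y)    = ≡.cong₂ (λ v v′ → num (toNumber v + toNumber v′)) (h x) (h y)
    eval-mapExpr h (sub x y)    = ≡.cong₂ (λ v v′ → num (toNumber v - toNumber v′)) (h x) (h y)
    eval-mapExpr h (mul x y)    = ≡.cong₂ (λ v v′ → num (toNumber v * toNumber v′)) (h x) (h y)

    ⟦_⟧ : ∀ {Γ} → Term I Γ → Memory m Γ → Carrier
    ⟦ atom x ⟧ μ = toNumber (eval ι μ x)
    ⟦ s ⊕ t ⟧  μ = ⟦ s ⟧ μ + ⟦ t ⟧ μ
    ⟦ s ⊖ t ⟧  μ = ⟦ s ⟧ μ - ⟦ t ⟧ μ
    ⟦ s ⊗ t ⟧  μ = ⟦ s ⟧ μ * ⟦ t ⟧ μ

    num-η : (v : Value m num) → num (toNumber v) ≡ v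
    num-η (num r) = refl

    read : ∀ {Γ} → Memory m Γ → Symbolic Γ → Ent
    read μ f = entry (edgeId ι μ (arc f)) (src f) (dst f) (number ι μ (srcPot f)) (number ι μ (dstPot f))

    value-read : ∀ {Γ} (μ : Memory m Γ) s f → value s (read μ f) ≡ number ι μ (value s f)
    value-read μ s f = ≡.sym (if-float (number ι μ) (does (src f ≟ˢ s)))

    potTerm-read : ∀ {Γ} (μ : Memory m Γ) S s → ⟦ potTerm S s ⟧ μ ≡ pot (map (read μ) S) s
    potTerm-read μ []      s = refl
    potTerm-read μ (f ∷ S) s with touches s f
    ... | true  = ≡.sym (value-read μ s f)
    ... | false = potTerm-read μ S s

    greedy-read : ∀ {Γ} (μ : Memory m Γ) used S → map (read μ) (greedy used S) ≡ greedy used (map (read μ) S)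
    greedy-read μ used [] = refl
    greedy-read μ used (f ∷ S) with any (λ s → touches s f) used
    ... | true  = greedy-read μ used S
    ... | false = ≡.cong (read μ f ∷_) (greedy-read μ (src f ∷ dst f ∷ used) S)

    record Loads {Γ} (μ : Memory m Γ) (B : Block {I} Γ) (x : Ent) : Set c where
      constructor loads
      field
        arcˡ : valueOf ι μ (arcᵒ B) ≡ edge (arc x)
        iˡ   : valueOf ι μ (iᵒ B) ≡ num (proj₂ (src x) · 1#)
        jˡ   : valueOf ι μ (jᵒ B) ≡ num (proj₂ (dst x) · 1#)
        srcˡ : valueOf ι μ (srcᵒ B) ≡ num (srcPot x)
        dstˡ : valueOf ι μ (dstᵒ B) ≡ num (dstPot x)

    parse-loads : ∀ {Γ} {μ : Memory m Γ} xs (ρ : ∀ {τ} → τ ∈ ctx xs → τ ∈ Γ) →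
                  (∀ {τ} (x : τ ∈ ctx xs) → All.lookup μ (ρ x) ≡ All.lookup (enc xs) x) →
                  Pointwise (Loads μ) (parseAt (ctx xs) ρ) xs
    parse-loads []       ρ h = []
    parse-loads (x ∷ xs) ρ h =
      loads (h (here refl)) (h (there (here refl))) (h (there (there (here refl))))
            (h (there (there (there (here refl))))) (h (there (there (there (there (here refl)))))) ∷
      parse-loads xs (λ x → ρ (there (there (there (there (there x)))))) λ x → h (there (there (there (there (there x)))))

    module _ {Δ : Ctx} {w : ℕ} {ν : Memory m Δ} where

      halt-yields : length Δ ℕ.≤ w → Yields halt ν w ν
      halt-yields fits = yields λ p → _ , refl , ℕ.⊔-monoʳ-≤ p fits

      assign-yields : ∀ {Γ Γ′} {es : All (Expr I Γ) Γ′} {P μ μ′} → length Γ ℕ.≤ w →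
                      All.map (eval ι μ) es ≡ μ′ → Yields P μ′ w ν → Yields (assign es P) μ w ν
      assign-yields {Γ} fits refl y = yields λ p →
        let q , eq , q≤ = outcome y (p ℕ.⊔ length Γ) in
        q , eq , ℕ.≤-trans q≤ (ℕ.≤-reflexive (≡.trans (ℕ.⊔-assoc p (length Γ) w) (≡.cong (p ℕ.⊔_) (ℕ.m≤n⇒m⊔n≡n fits))))

      push-yields : ∀ {Γ Γ′} {ρ : ∀ {τ} → Operand I Γ τ → Operand I Γ′ τ} {μ : Memory m Γ} {μ′ : Memory m Γ′} →
                    (∀ {τ} (x : Operand I Γ τ) → valueOf ι μ′ (ρ x) ≡ valueOf ι μ x) →
                    ∀ t {P} → length Γ′ ℕ.+ height t ℕ.≤ w →
                    Yields P (num (⟦ t ⟧ μ) ∷ μ′) w ν → Yields (push ρ t P) μ′ w ν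

      -- Common to the three binary operations and to `branch`. The room for two extra variables is
      -- handed on because the closing step still finds both numbers on the stack.
      push₂-yields : ∀ {Γ Γ′} {ρ : ∀ {τ} → Operand I Γ τ → Operand I Γ′ τ} {μ : Memory m Γ} {μ′ : Memory m Γ′} →
                     (∀ {τ} (x : Operand I Γ τ) → valueOf ι μ′ (ρ x) ≡ valueOf ι μ x) →
                     ∀ s t {P} → length Γ′ ℕ.+ (height s ℕ.⊔ (suc (height t) ℕ.⊔ 2)) ℕ.≤ w →
                     (2 ℕ.+ length Γ′ ℕ.≤ w → Yields P (num (⟦ t ⟧ μ) ∷ num (⟦ s ⟧ μ) ∷ μ′) w ν) →
                     Yields (push ρ s (push (wkOperand ∘ ρ) t P)) μ′ w ν
      push₂-yields {Γ′ = Γ′} {ρ} {μ} {μ′} h s t fits y =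
        push-yields h s (below (ℕ.m≤m⊔n (height s) _))
          (push-yields h′ t
            (ℕ.≤-trans (ℕ.≤-reflexive (≡.sym (ℕ.+-suc (length Γ′) (height t))))
              (below (ℕ.≤-trans (ℕ.m≤m⊔n (suc (height t)) 2) (ℕ.m≤n⊔m (height s) _))))
            (y (ℕ.≤-trans (ℕ.≤-reflexive (ℕ.+-comm 2 (length Γ′)))
              (below (ℕ.≤-trans (ℕ.m≤n⊔m (suc (height t)) 2) (ℕ.m≤n⊔m (height s) _))))))
        where
        below : ∀ {k} → k ℕ.≤ height s ℕ.⊔ (suc (height t) ℕ.⊔ 2) → length Γ′ ℕ.+ k ℕ.≤ w
        below k≤ = ℕ.≤-trans (ℕ.+-monoʳ-≤ (length Γ′) k≤) fits
        h′ : ∀ {τ} (x : Operand I _ τ) → valueOf ι (num (⟦ s ⟧ μ) ∷ μ′) (wkOperand (ρ x)) ≡ valueOf ι μ x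
        h′ x with ρ x | h x
        ... | var y | eq = eq
        ... | inp y | eq = eq

      push-yields {μ = μ} {μ′} h (atom x) fits y =
        assign-yields (ℕ.≤-trans (ℕ.m≤m+n _ 0) fits)
          (≡.cong₂ _∷_ (≡.trans (eval-mapExpr h x) (≡.sym (num-η _))) (eval-keep μ′)) y
      push-yields h (s ⊕ t) fits y = push₂-yields h s t fits λ room → assign-yields room (≡.cong (_ ∷_) (eval-drop₂ _)) y
      push-yields h (s ⊖ t) fits y = push₂-yields h s t fits λ room → assign-yields room (≡.cong (_ ∷_) (eval-drop₂ _)) y
      push-yields h (s ⊗ t) fits y = push₂-yields h s t fits λ room → assign-yields room (≡.cong (_ ∷_) (eval-drop₂ _)) y

      branch-yields : ∀ {Γ} {μ : Memory m Γ} s t κ → length Γ ℕ.+ (height s ℕ.⊔ (suc (height t) ℕ.⊔ 2)) ℕ.≤ w →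
                      Yields (κ (does (⟦ s ⟧ μ ≤? ⟦ t ⟧ μ))) μ w ν → Yields (branch s t κ) μ w ν
      branch-yields {Γ} {μ} s t κ fits y = push₂-yields (λ _ → refl) s t fits λ room →
        yields λ p → select (does (⟦ s ⟧ μ ≤? ⟦ t ⟧ μ)) room y p
        where
        M = num (⟦ t ⟧ μ) ∷ num (⟦ s ⟧ μ) ∷ μ
        select : ∀ d → 2 ℕ.+ length Γ ℕ.≤ w → Yields (κ d) μ w ν → ∀ p → ∃[ q ]
                 (if d then exec ι (assign drop₂ (κ true)) p M else exec ι (assign drop₂ (κ false)) p M) ≡ config q ν ×
                 q ℕ.≤ p ℕ.⊔ w
        select true  room y = outcome (assign-yields room (eval-drop₂ μ) y)
        select false room y = outcome (assign-yields room (eval-drop₂ μ) y)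

      onEnds-yields : ∀ {Γ} {μ : Memory m Γ} x κ →
                      Yields (κ (proj₁ (ends G (edgeId ι μ x))) (proj₂ (ends G (edgeId ι μ x)))) μ w ν →
                      Yields (onEnds x κ) μ w ν
      onEnds-yields x κ y = yields (outcome y)

      -- The stored index r lies in the window from i to i + k. Each failed comparison moves i up by
      -- one, and an exhausted window leaves only i = r.
      search-yields : ∀ {Γ} {μ : Memory m Γ} k i x {r} κ → valueOf ι μ x ≡ num (r · 1#) → length Γ ℕ.+ 5 ℕ.≤ w →
                      i ℕ.≤ r → r ℕ.≤ i ℕ.+ k → Yields (κ r) μ w ν → Yields (search k i x κ) μ w ν
      search-yields zero i x κ eq room i≤r r≤ y
        rewrite ℕ.≤-antisym i≤r (ℕ.≤-trans r≤ (ℕ.≤-reflexive (ℕ.+-identityʳ i))) = y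
      search-yields {Γ} {μ} (suc k) i x {r} κ eq room i≤r r≤ y =
        branch-yields (atom (get x)) (atom (const (i · 1#))) next (ℕ.≤-trans (ℕ.+-monoʳ-≤ (length Γ) (ℕ.m≤m+n 2 3)) room) found
        where
        next : Bool → Program n I Γ
        next p = if p then κ i else search k (suc i) x κ
        found : Yields (next (does (number ι μ x ≤? i · 1#))) μ w ν
        found with number ι μ x ≤? i · 1#
        ... | yes h rewrite ℕ.≤-antisym i≤r (·1-cancel-≤ r i (≤-trans (≤-reflexive (≈-reflexive (≡.sym (≡.cong toNumber eq)))) h)) = y
        ... | no ¬h = search-yields k (suc i) x κ eq room
                (ℕ.≰⇒> λ r≤i → ¬h (≤-trans (≤-reflexive (≈-reflexive (≡.cong toNumber eq))) (·1-mono-≤ r≤i)))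
                (ℕ.≤-trans r≤ (ℕ.≤-reflexive (ℕ.+-suc i k))) y

      -- Room for temporaries is asked for only if there is an entry: an empty memory is decoded
      -- without using any variable.
      decode-yields : ∀ {Γ} {μ : Memory m Γ} {Bs xs} κ → Pointwise (Loads μ) Bs xs → All Placed xs →
                      (∀ {x} → x ∈ xs → length Γ ℕ.+ 5 ℕ.≤ w) →
                      (∀ S → map (read μ) S ≡ xs → Yields (κ S) μ w ν) → Yields (decode Bs κ) μ w ν
      decode-yields κ [] [] room y = y [] refl
      decode-yields {Γ} {μ} {B ∷ Bs} {x ∷ xs} κ (L ∷ Ls) (p ∷ ps) room y =
        onEnds-yields (arcᵒ B) indices
          (≡.subst (λ e → Yields (indices (proj₁ (ends G e)) (proj₂ (ends G e))) μ w ν) (≡.sym (≡.cong toEdge (Loads.arcˡ L)))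
            (≡.subst₂ (λ u v → Yields (indices u v) μ w ν) (srcEndᵖ p) (dstEndᵖ p)
              (search-yields (b u) 0 (iᵒ B) (dstIndices u v) (Loads.iˡ L) (room (here refl)) ℕ.z≤n (ℕ.<⇒≤ (srcIndexᵖ p))
              (search-yields (b v) 0 (jᵒ B) (rest u v i) (Loads.jˡ L) (room (here refl)) ℕ.z≤n (ℕ.<⇒≤ (dstIndexᵖ p))
              (decode-yields (λ S → κ (entryᵒ u v i j ∷ S)) Ls ps (room ∘ there)
                λ S eq → y (entryᵒ u v i j ∷ S) (≡.cong₂ _∷_ read≡ eq))))))
        where
        u = proj₁ (src x)
        i = proj₂ (src x)
        v = proj₁ (dst x)
        j = proj₂ (dst x)
        entryᵒ : Fin n → Fin n → ℕ → ℕ → Symbolic Γ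
        entryᵒ u v i j = entry (arcᵒ B) (u , i) (v , j) (srcᵒ B) (dstᵒ B)
        rest : Fin n → Fin n → ℕ → ℕ → Program n I Γ
        rest u v i j = decode Bs λ S → κ (entryᵒ u v i j ∷ S)
        dstIndices : Fin n → Fin n → ℕ → Program n I Γ
        dstIndices u v i = search (b v) 0 (jᵒ B) (rest u v i)
        indices : Fin n → Fin n → Program n I Γ
        indices u v = search (b u) 0 (iᵒ B) (dstIndices u v)
        read≡ : read μ (entryᵒ u v i j) ≡ x
        read≡ rewrite Loads.arcˡ L | Loads.srcˡ L | Loads.dstˡ L = refl

      choose-yields : ∀ {Γ} {μ : Memory m Γ} S v k κ → length Γ ℕ.+ 5 ℕ.≤ w →
                      Yields (κ (best (λ i → pot (map (read μ) S) (v , i)) k)) μ w ν → Yields (choose S v k κ) μ w ν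
      choose-yields S v zero κ room y = y
      choose-yields {Γ} {μ} S v (suc k) κ room y = choose-yields S v k
        (λ i → branch (potTerm S (v , i)) (potTerm S (v , suc k)) λ p → κ (if p then i else suc k)) room
        (branch-yields (potTerm S (v , i)) (potTerm S (v , suc k)) (λ p → κ (if p then i else suc k))
          (ℕ.≤-trans (ℕ.+-monoʳ-≤ (length Γ) (ℕ.m≤m+n 2 3)) room)
          (≡.subst₂ (λ r r′ → Yields (κ (if does (r ≤? r′) then i else suc k)) μ w ν)
            (≡.sym (potTerm-read μ S (v , i))) (≡.sym (potTerm-read μ S (v , suc k))) y))
        where i = best (λ i → pot (map (read μ) S) (v , i)) k

      decideStays-yields : ∀ {Γ} {μ : Memory m Γ} S f κ → length Γ ℕ.+ 5 ℕ.≤ w →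
                           Yields (κ (stays (pot (map (read μ) S)) (read μ f))) μ w ν → Yields (decideStays S f κ) μ w ν
      decideStays-yields {Γ} {μ} S f κ room y =
        branch-yields pᵗ Pᵗ κ₁ (low (ℕ.m≤m+n 2 3)) (srcTop (does (⟦ pᵗ ⟧ μ ≤? P)) (≡.subst (λ d → Yields (κ d) μ w ν) (≡.sym decision) y))
        where
        pᵗ = potTerm S (src f)
        qᵗ = potTerm S (dst f)
        Pᵗ = atom (get (srcPot f))
        Qᵗ = atom (get (dstPot f))
        p = ⟦ pᵗ ⟧ μ
        q = ⟦ qᵗ ⟧ μ
        P = number ι μ (srcPot f)
        Q = number ι μ (dstPot f)
        κ₁ κ₂ κ₃ κ₄ : Bool → Program n I Γ
        κ₄ d = if d then κ false else κ true
        κ₃ d = if d then κ false else branch Qᵗ (atom (const θ) ⊗ qᵗ) κ₄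
        κ₂ d = if d then κ true else branch Pᵗ (atom (const θ) ⊗ pᵗ) κ₃
        κ₁ d = if d then κ true else branch qᵗ Qᵗ κ₂
        decision : does (p ≤? P) ∨ (does (q ≤? Q) ∨ not (does (P ≤? θ * p) ∨ does (Q ≤? θ * q))) ≡
                   stays (pot (map (read μ) S)) (read μ f)
        decision = ≡.cong₂ (λ p q → does (p ≤? P) ∨ (does (q ≤? Q) ∨ not (does (P ≤? θ * p) ∨ does (Q ≤? θ * q))))
          (potTerm-read μ S (src f)) (potTerm-read μ S (dst f))
        low : ∀ {k} → k ℕ.≤ 5 → length Γ ℕ.+ k ℕ.≤ w
        low k≤5 = ℕ.≤-trans (ℕ.+-monoʳ-≤ (length Γ) k≤5) room
        dstStale : ∀ d → Yields (κ (not d)) μ w ν → Yields (κ₄ d) μ w ν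
        dstStale true  y = y
        dstStale false y = y
        srcStale : ∀ d → Yields (κ (not (d ∨ does (Q ≤? θ * q)))) μ w ν → Yields (κ₃ d) μ w ν
        srcStale true  y = y
        srcStale false y = branch-yields Qᵗ (atom (const θ) ⊗ qᵗ) κ₄ (low (ℕ.m≤m+n 3 2)) (dstStale (does (Q ≤? θ * q)) y)
        dstTop : ∀ d → Yields (κ (d ∨ not (does (P ≤? θ * p) ∨ does (Q ≤? θ * q)))) μ w ν → Yields (κ₂ d) μ w ν
        dstTop true  y = y
        dstTop false y = branch-yields Pᵗ (atom (const θ) ⊗ pᵗ) κ₃ (low (ℕ.m≤m+n 3 2)) (srcStale (does (P ≤? θ * p)) y)
        srcTop : ∀ d → Yields (κ (d ∨ (does (q ≤? Q) ∨ not (does (P ≤? θ * p) ∨ does (Q ≤? θ * q))))) μ w ν → Yields (κ₁ d) μ w ν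
        srcTop true  y = y
        srcTop false y = branch-yields qᵗ Qᵗ κ₂ (low (ℕ.m≤m+n 2 3)) (dstTop (does (q ≤? Q)) y)

      sift-yields : ∀ {Γ} {μ : Memory m Γ} S fs κ → length Γ ℕ.+ 5 ℕ.≤ w →
                    (∀ S′ → map (read μ) S′ ≡ filterᵇ (stays (pot (map (read μ) S))) (map (read μ) fs) → Yields (κ S′) μ w ν) →
                    Yields (sift S fs κ) μ w ν
      sift-yields S [] κ room y = y [] refl
      sift-yields {Γ} {μ} S (f ∷ fs) κ room y = decideStays-yields S f (λ p → sift S fs (addIf p)) room
        (sift-yields S fs (addIf (K (read μ f))) room (next (stays (pot (map (read μ) S)) (read μ f)) refl))
        where
        K = stays (pot (map (read μ) S))
        addIf : Bool → List (Symbolic Γ) → Program n I Γ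
        addIf p S′ = κ (if p then f ∷ S′ else S′)
        next : ∀ d → K (read μ f) ≡ d → ∀ S′ → map (read μ) S′ ≡ filterᵇ K (map (read μ) fs) →
               Yields (κ (if d then f ∷ S′ else S′)) μ w ν
        next d eq S′ h = y (if d then f ∷ S′ else S′)
          (≡.trans (kept d) (≡.trans (≡.cong (λ d → if d then read μ f ∷ rest else rest) (≡.sym eq))
            (≡.sym (filterᵇ-∷ K (read μ f) (map (read μ) fs)))))
          where
          rest = filterᵇ K (map (read μ) fs)
          kept : ∀ d → map (read μ) (if d then f ∷ S′ else S′) ≡ (if d then read μ f ∷ rest else rest)
          kept true  = ≡.cong (read μ f ∷_) h
          kept false = h

    length-ctx : (xs : List Ent) → length (ctx xs) ≡ 5 ℕ.* length xs
    length-ctx []       = refl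
    length-ctx (x ∷ xs) = ≡.trans (≡.cong (5 ℕ.+_) (length-ctx xs)) (≡.sym (ℕ.*-suc 5 (length xs)))

    ctx-mono : (xs ys : List Ent) → length xs ℕ.≤ length ys → length (ctx xs) ℕ.≤ length (ctx ys)
    ctx-mono xs ys h = ℕ.≤-trans (ℕ.≤-reflexive (length-ctx xs))
      (ℕ.≤-trans (ℕ.*-monoʳ-≤ 5 h) (ℕ.≤-reflexive (≡.sym (length-ctx ys))))

    -- The two memories have contexts `ctx S` and `ctx (map (read μ) S)`, which agree only
    -- propositionally; `config` hides the context and makes the equation well typed.
    store-config : ∀ {Γ} (μ : Memory m Γ) q S →
                   config q (All.map (eval ι μ) (exprs S)) ≡ config q (enc (map (read μ) S))
    store-config μ q []      = refl
    store-config μ q (f ∷ S) = ≡.trans (prepend (store-config μ q S)) (heads (edge-η _) (num-η _) (num-η _))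
      where
      edge-η : (v : Value m edge) → v ≡ edge (toEdge v)
      edge-η (edge e) = refl
      prepend : ∀ {Δ Δ′} {ν : Memory m Δ} {ν′ : Memory m Δ′} {e : Value m edge} {i j p q′ : Value m num} →
                config q ν ≡ config q ν′ →
                config q (e ∷ i ∷ j ∷ p ∷ q′ ∷ ν) ≡ config q (e ∷ i ∷ j ∷ p ∷ q′ ∷ ν′)
      prepend refl = refl
      heads : ∀ {Δ} {ν : Memory m Δ} {e e′ : Value m edge} {i j p p′ q₁ q₂ : Value m num} → e ≡ e′ → p′ ≡ p → q₂ ≡ q₁ →
              config q (e ∷ i ∷ j ∷ p ∷ q₁ ∷ ν) ≡ config q (e′ ∷ i ∷ j ∷ p′ ∷ q₂ ∷ ν)
      heads refl refl refl = refl

    store-yields : ∀ {Γ} {μ : Memory m Γ} {w} S {xs} → map (read μ) S ≡ xs → length Γ ℕ.≤ w → length (ctx xs) ℕ.≤ w →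
                   Yields (store S) μ w (enc xs)
    store-yields {Γ} {μ} {w} S refl fits fits′ = yields λ p →
      _ , store-config μ _ S , ℕ.≤-trans (ℕ.≤-reflexive (ℕ.⊔-assoc p (length Γ) (length (ctx S))))
        (ℕ.⊔-monoʳ-≤ p (ℕ.⊔-lub fits (ℕ.≤-trans (ℕ.≤-reflexive (same S)) fits′)))
      where
      same : ∀ S → length (ctx S) ≡ length (ctx (map (read μ) S))
      same []      = refl
      same (_ ∷ S) = ≡.cong (5 ℕ.+_) (same S)

    loads-enc : ∀ xs → Pointwise (Loads (enc xs)) (parseAt (ctx xs) λ x → x) xs
    loads-enc xs = parse-loads xs (λ x → x) λ _ → refl

    prune-yields : ∀ {w} xs → All Placed xs → length (ctx xs) ℕ.+ 5 ℕ.≤ w →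
                   Yields (prune (ctx xs)) (enc xs) w (enc (filterᵇ (stays (pot xs)) xs))
    prune-yields {w} xs pl room = decode-yields (λ S → sift S S store) (loads-enc xs) pl (λ _ → room) λ S eq →
      sift-yields S S store room λ S′ eq′ → store-yields S′ (≡.trans eq′ (≡.cong (λ zs → filterᵇ (stays (pot zs)) zs) eq)) (below ℕ.≤-refl)
        (below (ctx-mono (filterᵇ (stays (pot xs)) xs) xs (length-filterᵇ (stays (pot xs)) xs)))
      where
      below : ∀ {k} → k ℕ.≤ length (ctx xs) → k ℕ.≤ w
      below k≤ = ℕ.≤-trans k≤ (ℕ.≤-trans (ℕ.m≤m+n _ 5) room)

    finish-yields : ∀ {w} xs → All Placed xs → (∀ {x} → x ∈ xs → length (ctx xs) ℕ.+ 5 ℕ.≤ w) →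
                    Yields (decode (parseAt (ctx xs) λ x → x) λ S → store (greedy [] S)) (enc xs) w (enc (greedy [] xs))
    finish-yields {w} xs pl room = decode-yields (λ S → store (greedy [] S)) (loads-enc xs) pl room λ S eq →
      store-yields (greedy [] S) (≡.trans (greedy-read (enc xs) [] S) (≡.cong (greedy []) eq)) (fits xs room)
        (ℕ.≤-trans (ctx-mono (greedy [] xs) xs (length-greedy≤ [] xs)) (fits xs room))
      where
      fits : ∀ xs → (∀ {x} → x ∈ xs → length (ctx xs) ℕ.+ 5 ℕ.≤ w) → length (ctx xs) ℕ.≤ w
      fits []       room = ℕ.z≤n
      fits (x ∷ xs) room = ℕ.≤-trans (ℕ.m≤m+n _ 5) (room (here refl))
      length-greedy≤ : ∀ used (xs : List Ent) → length (greedy used xs) ℕ.≤ length xs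
      length-greedy≤ used [] = ℕ.z≤n
      length-greedy≤ used (f ∷ fs) with any (λ s → touches s f) used
      ... | true  = ℕ.m≤n⇒m≤1+n (length-greedy≤ used fs)
      ... | false = ℕ.s≤s (length-greedy≤ _ fs)

  best-pot-cong : ∀ {xs ys} → (∀ s → pot xs s ≡ pot ys s) → ∀ v k → cheapest xs v k ≡ cheapest ys v k
  best-pot-cong h v k = ≡.cong (v ,_) (best-cong (λ i → h (v , i)) k)

  open Yields

  arrived : ∀ e → Memory m (edge ∷ [])
  arrived e = edge e ∷ []

  -- Ten extra variables suffice: five for the new entry and five for temporaries while pruning.
  -- Before anything is stored, the test against the threshold takes four.
  admit-yields : ∀ {Δ w} {ν : Memory m Δ} e a d xs → All Placed xs → length (ctx xs) ℕ.+ 10 ℕ.≤ w →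
                 (Light xs e a d → Yields (arrived e) halt (enc xs) w ν) →
                 (¬ Light xs e a d → Yields (arrived e) (prune (ctx (newEntry xs e a d ∷ xs))) (enc (newEntry xs e a d ∷ xs)) w ν) →
                 Yields (arrived e) (admit (ctx xs) (proj₁ (ends G e)) (proj₂ (ends G e)) (suc a) (suc d)) (enc xs) w ν
  admit-yields {w = w} {ν} e a d xs pl room light heavy =
    decode-yields ι afterDecode (loads-enc ι xs) pl (λ _ → room₅) λ S eq →
      choose-yields ι S u a (afterSrc S) room₅
        (≡.subst (λ zs → Yields ι (afterSrc S (best (λ i → pot zs (u , i)) a)) (enc xs) w ν) (≡.sym eq)
      (choose-yields ι S v d (afterDst S i) room₅
        (≡.subst (λ zs → Yields ι (afterDst S i (best (λ i → pot zs (v , i)) d)) (enc xs) w ν) (≡.sym eq)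
          (branch-yields ι weightTerm (threshold (potTerm S (u , i)) (potTerm S (v , j))) (afterTest S i j) (low (ℕ.m≤m+n 4 6))
            (≡.subst₂ (λ p q → Yields ι (afterTest S i j (does (weight G e ≤? (1# + δ) * (p + q)))) (enc xs) w ν)
              (≡.sym (potTerm-xs S eq (u , i))) (≡.sym (potTerm-xs S eq (v , j))) (tested S eq))))))
    where
    ι = arrived e
    u = proj₁ (ends G e)
    v = proj₂ (ends G e)
    i = best (λ i → pot xs (u , i)) a
    j = best (λ i → pot xs (v , i)) d
    low : ∀ {k} → k ℕ.≤ 10 → length (ctx xs) ℕ.+ k ℕ.≤ w
    low k≤ = ℕ.≤-trans (ℕ.+-monoʳ-≤ (length (ctx xs)) k≤) room
    room₅ : length (ctx xs) ℕ.+ 5 ℕ.≤ w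
    room₅ = low (ℕ.m≤m+n 5 5)
    weightTerm : Term (edge ∷ []) (ctx xs)
    weightTerm = atom (weightOf arriving)
    afterTest : List (Symbolic (ctx xs)) → ℕ → ℕ → Bool → Program n (edge ∷ []) (ctx xs)
    afterTest S i j light =
      if light then halt else
      push (λ x → x) (weightTerm ⊖ potTerm S (v , j)) (
      push wkOperand (weightTerm ⊖ potTerm S (u , i)) (
      assign (newBlock arriving i j) (prune _)))
    afterDst : List (Symbolic (ctx xs)) → ℕ → ℕ → Program n (edge ∷ []) (ctx xs)
    afterDst S i j = branch weightTerm (threshold (potTerm S (u , i)) (potTerm S (v , j))) (afterTest S i j)
    afterSrc : List (Symbolic (ctx xs)) → ℕ → Program n (edge ∷ []) (ctx xs)
    afterSrc S i = choose S v d (afterDst S i)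
    afterDecode : List (Symbolic (ctx xs)) → Program n (edge ∷ []) (ctx xs)
    afterDecode S = choose S u a (afterSrc S)
    potTerm-xs : ∀ S → map (read ι (enc xs)) S ≡ xs → ∀ s → ⟦_⟧ ι (potTerm S s) (enc xs) ≡ pot xs s
    potTerm-xs S eq s = ≡.trans (potTerm-read ι (enc xs) S s) (≡.cong (λ zs → pot zs s) eq)
    wk-value : ∀ {Γ} {μ : Memory m Γ} {r τ} (x : Operand (edge ∷ []) Γ τ) → valueOf ι (num r ∷ μ) (wkOperand x) ≡ valueOf ι μ x
    wk-value (var x) = refl
    wk-value (inp x) = refl
    tested : ∀ S → map (read ι (enc xs)) S ≡ xs →
             Yields ι (afterTest S i j (does (weight G e ≤? (1# + δ) * (pot xs (u , i) + pot xs (v , j))))) (enc xs) w ν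
    tested S eq with weight G e ≤? (1# + δ) * (pot xs (u , i) + pot xs (v , j))
    ... | yes h = light h
    ... | no ¬h =
      push-yields ι (λ _ → refl) (weightTerm ⊖ potTerm S (v , j)) (low (ℕ.m≤m+n 2 8))
      (push-yields ι wk-value (weightTerm ⊖ potTerm S (u , i))
        (ℕ.≤-trans (ℕ.≤-reflexive (≡.sym (ℕ.+-suc (length (ctx xs)) 2))) (low (ℕ.m≤m+n 3 7)))
      (assign-yields ι (ℕ.≤-trans (ℕ.≤-reflexive (ℕ.+-comm 2 (length (ctx xs)))) (low (ℕ.m≤m+n 2 8)))
        (≡.trans (≡.cong (withBlock (⟦_⟧ ι (potTerm S (u , i)) (enc xs)) (⟦_⟧ ι (potTerm S (v , j)) (enc xs))) (eval-drop₂ ι (enc xs)))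
          (≡.cong₂ (λ p q → withBlock p q (enc xs)) (potTerm-xs S eq (u , i)) (potTerm-xs S eq (v , j))))
        (heavy ¬h)))
      where
      withBlock : Carrier → Carrier → ∀ {Γ} → Memory m Γ → Memory m (edge ∷ num ∷ num ∷ num ∷ num ∷ Γ)
      withBlock p q ζ = edge e ∷ num (i · 1#) ∷ num (j · 1#) ∷ num (weight G e - q) ∷ num (weight G e - p) ∷ ζ

-- The whole stream: invariant, final step and peak memory.

module Streaming {c ℓ₁ ℓ₂} (R : ArchimedeanOrderedField c ℓ₁ ℓ₂)
                {n m : ℕ} (b : Fin n → ℕ) (G : BMatching.Multigraph R n m)
                (δ : ArchimedeanOrderedField.Carrier R)
                (0≤δ : ArchimedeanOrderedField._≤_ R (ArchimedeanOrderedField.0# R) δ)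
                (θ : ArchimedeanOrderedField.Carrier R)
                (0≤θ : ArchimedeanOrderedField._≤_ R (ArchimedeanOrderedField.0# R) θ) where
  open OrderedField R
  open BMatching R
  open Multigraph
  open Execution G hiding (value)
  open Simulation R b G δ 0≤δ θ 0≤θ public
  open Placed

  Usable : Set
  Usable = ∃[ e ] 0 ℕ.< b (proj₁ (ends G e)) × 0 ℕ.< b (proj₂ (ends G e))

  -- Guarded by a usable edge. Without one every B fits, even 0, so a bound in terms of `Fits` then
  -- says that no variable was ever used.
  Fits : ℕ → Set (c ⊔ ℓ₂)
  Fits B = ∀ {es H} → Unique es → Run es H → Usable → length (ctx (live H)) ℕ.+ 10 ℕ.≤ B

  -- Comparing the peak with every fitting B avoids a maximum over the prefixes of the stream.
  Reached : List (Fin m) → Config m → Set (c ⊔ ℓ₂)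
  Reached es C = ∃[ H ] Run es H × ∃[ p ] C ≡ config p (enc (live H)) × (∀ B → Fits B → p ℕ.≤ B)

  usable : ∀ {f} → Placed f → Usable
  usable {f} p = arc f ,
    ℕ.≤-trans (ℕ.s≤s ℕ.z≤n) (≡.subst (λ v → proj₂ (src f) ℕ.< b v) (srcEndᵖ p) (srcIndexᵖ p)) ,
    ℕ.≤-trans (ℕ.s≤s ℕ.z≤n) (≡.subst (λ v → proj₂ (dst f) ℕ.< b v) (dstEndᵖ p) (dstIndexᵖ p))

  placed-live : ∀ {es H} → Run es H → All Placed (live H)
  placed-live {H = H} r = filterᵇ-All (stays (pot H)) (placed (chain r))

  -- An empty memory has width 0; in a nonempty one the first entry is a witness of `Usable`, and
  -- the guard of `Fits` is met.
  width : ∀ {es H} → Unique es → Run es H →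
          ∃[ w ] length (ctx (live H)) ℕ.≤ w × (∀ {x} → x ∈ live H → length (ctx (live H)) ℕ.+ 5 ℕ.≤ w) × (∀ B → Fits B → w ℕ.≤ B)
  width {H = H} !es r with live H | placed-live r | (λ B (fits : Fits B) → fits !es r)
  ... | []     | _     | _    = 0 , ℕ.z≤n , (λ ()) , λ _ _ → ℕ.z≤n
  ... | x ∷ xs | p ∷ _ | fits = length (ctx (x ∷ xs)) ℕ.+ 5 , ℕ.m≤m+n _ 5 , (λ _ → ℕ.≤-refl) , λ B fitsB →
          ℕ.≤-trans (ℕ.+-monoʳ-≤ (length (ctx (x ∷ xs))) (ℕ.m≤m+n 5 5)) (fits B fitsB (usable p))

  cheapest-live : ∀ H v k → cheapest (live H) v k ≡ cheapest H v k
  cheapest-live H = best-pot-cong {live H} {H} (pot-live H)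

  pot-cheapest-live : ∀ H v k → pot (live H) (cheapest (live H) v k) ≡ pot H (cheapest H v k)
  pot-cheapest-live H v k = ≡.trans (pot-live H _) (≡.cong (pot H) (cheapest-live H v k))

  newEntry-live : ∀ H e a d → newEntry (live H) e a d ≡ newEntry H e a d
  newEntry-live H e a d
    rewrite pot-cheapest-live H (proj₁ (ends G e)) a | pot-cheapest-live H (proj₂ (ends G e)) d
          | cheapest-live H (proj₁ (ends G e)) a | cheapest-live H (proj₂ (ends G e)) d = refl

  light-live : ∀ H e a d → Light (live H) e a d ≡ Light H e a d
  light-live H e a d = ≡.cong₂ (λ p q → weight G e ≤ (1# + δ) * (p + q))
    (pot-cheapest-live H (proj₁ (ends G e)) a) (pot-cheapest-live H (proj₂ (ends G e)) d)

  reached : ∀ {es H Γ w p} {ι : Memory m (edge ∷ [])} {P : Program n (edge ∷ []) Γ} {μ : Memory m Γ} → Run es H →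
            Yields ι P μ w (enc (live H)) → (∀ B → Fits B → w ℕ.≤ B) → (∀ B → Fits B → p ℕ.≤ B) →
            Reached es (exec ι P p μ)
  reached {H = H} {p = p} r y w≤ p≤ =
    let q , exec≡ , q≤ = Yields.outcome y p in
    H , r , q , exec≡ , λ B fits → ℕ.≤-trans q≤ (ℕ.⊔-lub (p≤ B fits) (w≤ B fits))

  skipped : ∀ {es H p} e → Unique es → Run es H → Run (e ∷ es) H → (∀ B → Fits B → p ℕ.≤ B) →
            Reached (e ∷ es) (exec (arrived e) halt p (enc (live H)))
  skipped e !es r r′ p≤ =
    let w , ≤w , _ , w≤ = width !es r in reached r′ (halt-yields (arrived e) ≤w) w≤ p≤

  considered : ∀ {es H p} e {a d} → Unique es → Run es H → (∀ B → Fits B → p ℕ.≤ B) →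
               b (proj₁ (ends G e)) ≡ suc a → b (proj₂ (ends G e)) ≡ suc d → Dec (Light H e a d) →
               Reached (e ∷ es) (exec (arrived e) (admit (ctx (live H)) (proj₁ (ends G e)) (proj₂ (ends G e)) (suc a) (suc d)) p (enc (live H)))
  considered {es} {H} e {a} {d} !es r p≤ eq eq′ light? = by light?
    where
    xs = live H
    w  = length (ctx xs) ℕ.+ 10
    positive : ∀ {k j} → k ≡ suc j → 0 ℕ.< k
    positive refl = ℕ.s≤s ℕ.z≤n
    fitting : ∀ B → Fits B → w ℕ.≤ B
    fitting B fits = fits !es r (e , positive eq , positive eq′)
    by : Dec (Light H e a d) → Reached (e ∷ es) (exec (arrived e) (admit (ctx xs) (proj₁ (ends G e)) (proj₂ (ends G e)) (suc a) (suc d)) _ (enc xs))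
    by (yes light) = reached (reject eq eq′ light r)
      (admit-yields e a d xs (placed-live r) ℕ.≤-refl
        (λ _ → halt-yields (arrived e) (ℕ.m≤m+n _ 10))
        (λ heavy → ⊥-elim (heavy (≡.subst (λ A → A) (≡.sym (light-live H e a d)) light))))
      fitting p≤
    by (no heavy) = reached r′
      (admit-yields e a d xs (placed-live r) ℕ.≤-refl
        (λ light → ⊥-elim (heavy (≡.subst (λ A → A) (light-live H e a d) light)))
        (λ _ → ≡.subst (λ f → Yields (arrived e) (prune (ctx (f ∷ xs))) (enc (f ∷ xs)) w (enc (live (new ∷ H))))
          (≡.sym (newEntry-live H e a d))
          (≡.subst (λ zs → Yields (arrived e) (prune (ctx (new ∷ xs))) (enc (new ∷ xs)) w (enc zs))
            (live-step (chain r′))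
            (prune-yields (arrived e) (new ∷ xs) (All.head (placed (chain r′)) ∷ placed-live r)
              (ℕ.≤-reflexive (≡.trans (≡.cong (ℕ._+ 5) (ℕ.+-comm 5 (length (ctx xs)))) (ℕ.+-assoc (length (ctx xs)) 5 5)))))))
      fitting p≤
      where
      new = newEntry H e a d
      r′  = accept eq eq′ heavy r

  admitted : ∀ {es H p} e → Unique es → Run es H → (∀ B → Fits B → p ℕ.≤ B) →
             ∀ x y → b (proj₁ (ends G e)) ≡ x → b (proj₂ (ends G e)) ≡ y →
             Reached (e ∷ es) (exec (arrived e) (admit (ctx (live H)) (proj₁ (ends G e)) (proj₂ (ends G e)) x y) p (enc (live H)))
  admitted e !es r p≤ zero    y       eq eq′ = skipped e !es r (skip (inj₁ eq) r) p≤
  admitted e !es r p≤ (suc a) zero    eq eq′ = skipped e !es r (skip (inj₂ eq′) r) p≤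
  admitted e !es r p≤ (suc a) (suc d) eq eq′ = considered e !es r p≤ eq eq′ (_ ≤? _)

  arrive-reached : ∀ {es C} e → Unique es → Reached es C → Reached (e ∷ es) (arrive program C e)
  arrive-reached e !es (H , r , p , refl , p≤) = admitted e !es r p≤ (b (proj₁ (ends G e))) (b (proj₂ (ends G e))) refl refl

  foldl-reached : ∀ ys {es C} → Unique ys → Unique es → All (λ y → All (y ≢_) es) ys → Reached es C →
                  ∃[ es′ ] Unique es′ × (∀ e → e ∈ ys ⊎ e ∈ es → e ∈ es′) × Reached es′ (foldl (arrive program) C ys)
  foldl-reached [] {es} _ !es _ C-reached = es , !es , (λ { e (inj₂ e∈) → e∈ }) , C-reached
  foldl-reached (y ∷ ys) (y∉ys ∷ !ys) !es (y∉es ∷ apart) C-reached =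
    let es′ , !es′ , seen , C′-reached = foldl-reached ys !ys (y∉es ∷ !es)
          (All.zipWith (λ { (y≢z , z∉es) → (λ z≡y → y≢z (≡.sym z≡y)) ∷ z∉es }) (y∉ys , apart))
          (arrive-reached y !es C-reached)
    in es′ , !es′ , (λ { e (inj₁ (here refl)) → seen e (inj₂ (here refl)) ; e (inj₁ (there e∈)) → seen e (inj₁ e∈) ; e (inj₂ e∈) → seen e (inj₂ (there e∈)) }) , C′-reached

  finished : Config m → Config m
  finished C = exec [] (StreamingProgram.finish program (Config.context C)) (Config.peak C) (Config.memory C)

  Finished : List (Fin m) → Config m → Set (c ⊔ ℓ₂)
  Finished es C = ∃[ H ] Run es H × ∃[ q ] C ≡ config q (enc (greedy [] (live H))) × (∀ B → Fits B → q ℕ.≤ B)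

  finish-reached : ∀ {es C} → Unique es → Reached es C → Finished es (finished C)
  finish-reached !es (H , r , p , refl , p≤) =
    let w , _ , room , w≤ = width !es r
        q , exec≡ , q≤ = Yields.outcome (finish-yields [] (live H) (placed-live r) room) p
    in H , r , q , exec≡ , λ B fits → ℕ.≤-trans q≤ (ℕ.⊔-lub (p≤ B fits) (w≤ B fits))

  run-finished : ∃[ es ] Unique es × (∀ e → e ∈ es) × Finished es (run program)
  run-finished =
    let es , !es , seen , C-reached = foldl-reached (allFin m) (allFin⁺ m) [] (All.tabulate λ _ → [])
          ([] , start , 0 , refl , λ _ _ → ℕ.z≤n)
    in es , !es , (λ e → seen e (inj₁ (∈-allFin e))) , finish-reached !es C-reached

localRatio : ∀ {c ℓ₁ ℓ₂} (R : ArchimedeanOrderedField c ℓ₁ ℓ₂) (δ θ : ArchimedeanOrderedField.Carrier R) →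
             BMatching.StreamingAlgorithm R
localRatio R δ θ n b = Programs.program R b δ θ

-- Dual and primal bounds for the output, and counting stored entries.

module Bounds {c ℓ₁ ℓ₂} (R : ArchimedeanOrderedField c ℓ₁ ℓ₂)
                {n m : ℕ} (b : Fin n → ℕ) (G : BMatching.Multigraph R n m)
                (δ : ArchimedeanOrderedField.Carrier R)
                (0≤δ : ArchimedeanOrderedField._≤_ R (ArchimedeanOrderedField.0# R) δ)
                (θ : ArchimedeanOrderedField.Carrier R)
                (0≤θ : ArchimedeanOrderedField._≤_ R (ArchimedeanOrderedField.0# R) θ) where
  open OrderedField R
  open ListSum R
  open BMatching R
  open Multigraph
  open Execution G hiding (value)
  open Streaming R b G δ 0≤δ θ 0≤θ public
  open Placed

  algorithm : StreamingAlgorithm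
  algorithm = localRatio R δ θ

  -- The witness S is the sum of the final potentials over all slots. Once both bounds pass through
  -- it, only arithmetic in δ and θ is left.
  approximation : IsBMatching b G (output algorithm b G) × ∃[ S ] 0# ≤ S ×
    (∀ N → IsBMatching b G N → totalWeight G N ≤ (1# + δ) * S) ×
    (let w = totalWeight G (output algorithm b G) in S ≤ (w + θ * S) + (w + θ * S))
  approximation =
    let es , !es , all , H , r , q , run≡ , _ = run-finished
        out≡ = ≡.trans (≡.cong (λ C → storedEdges (Config.memory C)) run≡) (storedEdges-enc (greedy [] (live H)))
        ch   = chain r
        heavier = ≤-trans (totalWeight-support (greedy-distinct (filterᵇ-distinct (stays (pot H)) (distinct !es r)) []))
                    (≤-reflexive (≈-reflexive (≡.cong (totalWeight G) (≡.sym out≡))))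
    in ≡.subst (IsBMatching b G) (≡.sym out≡) (greedy-bmatching (placed-live r)) ,
       ∑ slots (pot H) , ∑≥0 slots (pot≥0ᶜ ch) ,
       (λ N bm → dual r all N bm) ,
       ≤-trans (primal ch) (+-mono-≤ (+-monoˡ-≤ _ heavier) (+-monoˡ-≤ _ heavier))

  totalWeight≥0 : ∀ M → 0# ≤ totalWeight G M
  totalWeight≥0 M = ≤-trans (∑≥0 (allFin m) λ e → when≥0 (lookup M e) (weight≥0 G e)) (≤-reflexive (≈-sym (totalWeight≈ M)))

  bmatching-size : ∀ N → IsBMatching b G N → ∣ N ∣ ℕ.≤ Vec.sum (Vec.tabulate b)
  bmatching-size N bm = ·1-cancel-≤ _ _
    (≤-trans (≤-reflexive (≈-sym (∑-subset N 1#)))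
    (≤-trans (∑-mono (allFin m) λ e → ≤-trans
      (≤-reflexive (≈-reflexive (≡.cong (λ p → when p 1#) (≡.sym (at-end e)))))
      (∑-member (λ v → when (lookup (N ∩ incident G v) e) 1#) (λ v → when≥0 (lookup (N ∩ incident G v) e) 0≤1) (∈-allFin (proj₁ (ends G e)))))
    (≤-trans (≤-reflexive (∑-swap (allFin m) (allFin n) _))
    (≤-trans (∑-mono (allFin n) λ v → ≤-trans (≤-reflexive (∑-subset (N ∩ incident G v) 1#)) (·1-mono-≤ (bm v)))
      (≤-reflexive (∑-vec b))))))
    where
    at-end : ∀ e → lookup (N ∩ incident G (proj₁ (ends G e))) e ≡ lookup N e
    at-end e = ≡.trans (lookup-zipWith _∧_ e N (incident G (proj₁ (ends G e))))
      (≡.trans (≡.cong (lookup N e ∧_) (lookup-incident₁ e)) (∧-identityʳ (lookup N e)))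

  -- A single usable edge is a b-matching. This lets the ten additive variables be absorbed by
  -- multiples of the size of M.
  usable⇒1≤ : ∀ M → IsMaximumCardinality b G M → Usable → 1 ℕ.≤ ∣ M ∣
  usable⇒1≤ M (_ , maximum) (e , 0<bu , 0<bv) = ℕ.≤-trans (length-support {f ∷ []} ([] ∷ []))
    (maximum (support (f ∷ [])) (disjoint⇒bmatching {f ∷ []}
      (record { srcEndᵖ = refl ; dstEndᵖ = refl ; srcIndexᵖ = 0<bu ; dstIndexᵖ = 0<bv } ∷ [])
      λ s → ≤-trans (≤-reflexive (+-identityʳ (when (touches s f) 1#))) (when≤ (touches s f) 0≤1)))
    where
    f : Ent
    f = entry e (proj₁ (ends G e) , 0) (proj₂ (ends G e) , 0) 0# 0#

  length-kept : ∀ {es H} M → IsMaximumCardinality b G M → Unique es → Run es H → ∀ (K : Ent → Bool) L →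
                (∀ s → length (filterᵇ (λ f → K f ∧ touches s f) H) ℕ.≤ L) →
                length (filterᵇ K H) ℕ.≤ ∣ M ∣ ℕ.* (L ℕ.+ L)
  length-kept {H = H} M (_ , maximum) !es r K L h = ℕ.≤-trans (length-greedy K H L h)
    (ℕ.*-monoˡ-≤ (L ℕ.+ L) (ℕ.≤-trans (length-support (greedy-distinct (filterᵇ-distinct K (distinct !es r)) []))
      (maximum (support (greedy [] (filterᵇ K H))) (greedy-bmatching (filterᵇ-All K (placed (chain r)))))))

  -- For r + 1 selected entries, `geometric` is applied with x times the potential in place of x.
  -- The potential is positive, since the slot is touched, and cancels; what remains is (1 + δ)^r x
  -- ≤ (1 + δ)^L x.
  slot-count : ∀ {H} → Chain H → 0# < δ → ∀ (K : Ent → Bool) {x y} L → 0# < x → 0# ≤ y → y ≤ (1# + δ) ^ L * x →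
               ∀ s → (∀ {f} → f ∈ H → K f ≡ true → touches s f ≡ true → x * pot H s ≤ y * value s f) →
               length (filterᵇ (λ f → K f ∧ touches s f) H) ℕ.≤ suc L
  slot-count {H} ch 0<δ K {x} {y} L 0<x 0≤y y≤ s low with length (filterᵇ (λ f → K f ∧ touches s f) H) in len
  ... | zero  = ℕ.z≤n
  ... | suc r = ℕ.s≤s (^-cancel-≤ 1<1+δ r L (*-cancelʳ-≤ 0<x (≤-trans
          (*-cancelʳ-≤ (0<pot H ch len) (≤-trans (≤-reflexive (*-assoc _ _ _)) (geometric ch s K 0≤y low len))) y≤)))
    where
    1<1+δ : 1# < 1# + δ
    1<1+δ = x≤x+y 0≤δ , λ eq → proj₂ 0<δ (+-cancelʳ-≈ 1# (≈-trans (+-identityˡ 1#) (≈-trans eq (+-comm 1# δ))))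
    0<pot : ∀ H → Chain H → ∀ {r} → length (filterᵇ (λ f → K f ∧ touches s f) H) ≡ suc r → 0# < pot H s
    0<pot (f ∷ H) ch@(_ ∷ ch′) len with touches s f in t | K f
    ... | true  | _     = 0<valueᶜ ch (here refl) s t
    ... | false | true  = 0<pot H ch′ len
    ... | false | false = 0<pot H ch′ len

  memory≤ : ∀ B → Fits B → memoryUsed algorithm b G ℕ.≤ B
  memory≤ B fits =
    let _ , _ , _ , _ , _ , q , run≡ , q≤ = run-finished
    in ℕ.≤-trans (ℕ.≤-reflexive (≡.cong Config.peak run≡)) (q≤ B fits)

  memory-by-live : ∀ M L B → IsMaximumCardinality b G M →
                   (∀ {es H} → Unique es → Run es H → length (live H) ℕ.≤ L) →
                   (1 ℕ.≤ ∣ M ∣ → 5 ℕ.* L ℕ.+ 10 ℕ.≤ B) → memoryUsed algorithm b G ℕ.≤ B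
  memory-by-live M L B max live≤ B≥ = memory≤ B λ {_} {H} !es r u → ℕ.≤-trans
    (ℕ.+-monoˡ-≤ 10 (ℕ.≤-trans (ℕ.≤-reflexive (length-ctx [] (live H))) (ℕ.*-monoʳ-≤ 5 (live≤ !es r)))) (B≥ (usable⇒1≤ M max u))

  1≤maxRatio : 1# ≤ maxRatio G
  1≤maxRatio = Extrema.⊥≤max totalOrder 1# (map _ (filter _ (cartesianProduct (allFin m) (allFin m))))

  weight≤maxRatio : ∀ e f → 0# < weight G e → 0# < weight G f → weight G e ≤ maxRatio G * weight G f
  weight≤maxRatio e f 0<e 0<f = x÷y≤z⇒x≤z*y 0<f (All.lookup (Extrema.xs≤max totalOrder 1# _)
    (∈-map⁺ _ (∈-filter⁺ _ (∈-cartesianProduct⁺ (∈-allFin e) (∈-allFin f))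
      ((λ eq → proj₂ 0<e (≈-sym eq)) , (λ eq → proj₂ 0<f (≈-sym eq))))))

-- Memory bounds in terms of ε, with explicit constants.

module Parameters {c ℓ₁ ℓ₂} (R : ArchimedeanOrderedField c ℓ₁ ℓ₂) where
  open OrderedField R
  open Solver using (solve; _:+_; _:*_; _:=_; con)

  2# : Carrier
  2# = 1# + 1#

  0<p·1 : ∀ p → 0# < suc p · 1#
  0<p·1 p = <-≤-trans 0<1 (x≤x+y (0≤k·x 0≤1 p))

  ·≈* : ∀ p x → p · x ≈ p · 1# * x
  ·≈* zero    x = ≈-sym (zeroˡ x)
  ·≈* (suc p) x = ≈-trans (+-cong (≈-sym (*-identityˡ x)) (·≈* p x)) (≈-sym (distribʳ x 1# (p · 1#)))

  fraction : ∀ p x → suc p · (x ÷ (suc p · 1#)) ≈ x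
  fraction p x = ≈-trans (·≈* (suc p) _) (≈-trans (*-comm _ _) (x÷y*y≈x x (0<p·1 p)))

  0<fraction : ∀ p {x} → 0# < x → 0# < x ÷ (suc p · 1#)
  0<fraction p {x} 0<x = *-nonNegative (proj₁ 0<x) (0≤x⁻¹ (0<p·1 p)) ,
    λ eq → proj₂ 0<x (≈-trans (≈-sym (zeroˡ _)) (≈-trans (*-cong eq ≈-refl) (x÷y*y≈x x (0<p·1 p))))

  -- Turns a logarithm to base 1 + pδ into one to base 1 + δ, which is larger by a factor of at most
  -- p.
  1+p·x≤ : ∀ p {δ} k → 0# ≤ δ → (1# + p · δ) ^ k ≤ (1# + δ) ^ (p ℕ.* k)
  1+p·x≤ p {δ} k 0≤δ = ≤-trans
    (^-monoˡ-≤ k (+-nonNegative 0≤1 (0≤k·x 0≤δ p))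
      (bernoulli 0≤δ p))
    (≤-reflexive (^-assocʳ (1# + δ) p k))

  -- If pδ is at least 1/2 this is Bernoulli's inequality; otherwise (1 + pδ)^k,
  -- being at least 1/(pδ), is itself at least 2.
  2≤power : ∀ p {δ} k → 0# ≤ δ → 1# ≤ (1# + p · δ) ^ k * (p · δ) → 2# ≤ (1# + δ) ^ (p ℕ.* (2 ℕ.+ k))
  2≤power p {δ} k 0≤δ h = ≤-trans base (1+p·x≤ p (2 ℕ.+ k) 0≤δ)
    where
    x = p · δ
    0≤x : 0# ≤ x
    0≤x = 0≤k·x 0≤δ p
    1≤1+x : 1# ≤ 1# + x
    1≤1+x = x≤x+y 0≤x
    base : 2# ≤ (1# + x) ^ (2 ℕ.+ k)
    base with total 1# (x + x)
    ... | inj₁ 1≤2x = ≤-trans (+-monoʳ-≤ 1# 1≤2x)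
          (≤-trans (≤-reflexive (+-cong ≈-refl (+-cong ≈-refl (≈-sym (+-identityʳ x)))))
          (≤-trans (bernoulli 0≤x 2) (^-monoʳ-≤ 1≤1+x (ℕ.m≤m+n 2 k))))
    ... | inj₂ 2x≤1 = ≤-trans (+-mono-≤ h h)
          (≤-trans (≤-reflexive (≈-sym (distribˡ _ x x)))
          (≤-trans (*-monoʳ-≤ (0≤x^k (≤-trans 0≤1 1≤1+x) k) 2x≤1)
          (≤-trans (≤-reflexive (*-identityʳ _)) (^-monoʳ-≤ 1≤1+x (ℕ.m≤n+m k 2)))))

  module _ {n m : ℕ} (b : Fin n → ℕ) (G : BMatching.Multigraph R n m) {δ θ : Carrier} (0<δ : 0# < δ) (0≤θ : 0# ≤ θ) where
    open BMatching R
    open Bounds R b G δ (proj₁ 0<δ) θ 0≤θ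
    open Multigraph G

    length-all : ∀ (H : List Ent) → length (filterᵇ (λ _ → true) H) ≡ length H
    length-all []      = refl
    length-all (f ∷ H) = ≡.cong suc (length-all H)

    -- With W the weight ratio, a potential is at most W times the weight of any entry, and the
    -- value of an entry is at least δ/(1 + δ) of its weight. So the values in a slot spread over a
    -- factor of at most (1 + δ)W/δ.
    memory-ratio : ∀ M k → IsMaximumCardinality b G M → maxRatio ≤ (1# + 2 · δ) ^ k * (2 · δ) →
                   memoryUsed (localRatio R δ θ) b G ℕ.≤ 110 ℕ.* ((1 ℕ.⊔ k) ℕ.* ∣ M ∣)
    memory-ratio M k max W≤ = memory-by-live M _ _ max
      (λ {es} {H} !es r → ℕ.≤-trans (length-filterᵇ (stays (pot H)) H)
        (ℕ.≤-trans (ℕ.≤-reflexive (≡.sym (length-all H))) (length-kept M max !es r (λ _ → true) (suc L) λ s →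
          slot-count (chain r) 0<δ (λ _ → true) L 0<δ 0≤y y≤ s λ {f} f∈H _ t → low (chain r) f∈H s t)))
      arithmetic
      where
      β = 1# + δ
      -- In `L`, the part `a` pays for (1 + 2δ)^k, the part `d` for the factor 2 in 2δ, and the
      -- extra 1 for the factor 1 + δ lost between weights and values.
      a = 2 ℕ.* k
      d = 2 ℕ.* (2 ℕ.+ k)
      L = suc (d ℕ.+ a)
      0≤β : 0# ≤ β
      0≤β = +-nonNegative 0≤1 (proj₁ 0<δ)
      0≤W : 0# ≤ maxRatio
      0≤W = ≤-trans 0≤1 1≤maxRatio
      0≤y : 0# ≤ β * maxRatio
      0≤y = *-nonNegative 0≤β 0≤W
      W≤′ : maxRatio ≤ β ^ (d ℕ.+ a) * δ
      W≤′ = ≤-trans W≤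
        (≤-trans (*-monoˡ-≤ (0≤k·x (proj₁ 0<δ) 2) (1+p·x≤ 2 k (proj₁ 0<δ)))
        (≤-trans (≤-reflexive (solve 2 (λ x d → x :* (d :+ (d :+ con 0)) := (con 1 :+ con 1) :* (x :* d)) ≈-refl (β ^ a) δ))
        (≤-trans (*-monoˡ-≤ (*-nonNegative (0≤x^k 0≤β a) (proj₁ 0<δ)) (2≤power 2 k (proj₁ 0<δ) (≤-trans 1≤maxRatio W≤)))
          (≤-reflexive (≈-trans (≈-sym (*-assoc _ _ δ)) (*-cong (≈-sym (^-homo-* β d a)) ≈-refl))))))
      y≤ : β * maxRatio ≤ β ^ L * δ
      y≤ = ≤-trans (*-monoʳ-≤ 0≤β W≤′) (≤-reflexive (≈-sym (*-assoc _ _ δ)))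
      low : ∀ {H} → Chain H → ∀ {f} → f ∈ H → ∀ s → touches s f ≡ true → δ * pot H s ≤ β * maxRatio * value s f
      low ch {f} f∈H s t = ≤-trans
        (*-monoʳ-≤ (proj₁ 0<δ) (pot≤ ch (*-nonNegative 0≤W (proj₁ (0<weightᶜ ch f∈H)))
          (λ {f′} f′∈H → weight≤maxRatio (Entry.arc f′) (Entry.arc f) (0<weightᶜ ch f′∈H) (0<weightᶜ ch f∈H)) s))
        (≤-trans (≤-reflexive (solve 3 (λ d W w → d :* (W :* w) := W :* (d :* w)) ≈-refl δ maxRatio (weightᵉ f)))
        (≤-trans (*-monoʳ-≤ 0≤W (δ*weight≤ᶜ ch f∈H s t))
          (≤-reflexive (solve 3 (λ W b v → W :* (b :* v) := b :* W :* v) ≈-refl maxRatio β (value s f)))))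
      -- Since `suc L` is 6 + 4k, the left side is 40k∣M∣ + 60∣M∣ + 10, and 40 + 60 + 10 = 110. The
      -- maximum of 1 and k absorbs the terms without k.
      arithmetic : 1 ℕ.≤ ∣ M ∣ → 5 ℕ.* (∣ M ∣ ℕ.* (suc L ℕ.+ suc L)) ℕ.+ 10 ℕ.≤ 110 ℕ.* ((1 ℕ.⊔ k) ℕ.* ∣ M ∣)
      arithmetic 1≤M = ℕ.≤-trans (ℕ.≤-reflexive
          (N.solve 2 (λ M k → N.con 5 N.:* (M N.:* (L′ k N.:+ L′ k)) N.:+ N.con 10
            N.:= N.con 40 N.:* (k N.:* M) N.:+ (N.con 60 N.:* (N.con 1 N.:* M) N.:+ N.con 10 N.:* (N.con 1 N.:* N.con 1))) refl ∣ M ∣ k))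
        (ℕ.≤-trans (ℕ.+-mono-≤ (ℕ.*-monoʳ-≤ 40 (ℕ.*-monoˡ-≤ ∣ M ∣ (ℕ.m≤n⊔m 1 k)))
            (ℕ.+-mono-≤ (ℕ.*-monoʳ-≤ 60 (ℕ.*-monoˡ-≤ ∣ M ∣ (ℕ.m≤m⊔n 1 k))) (ℕ.*-monoʳ-≤ 10 (ℕ.*-mono-≤ (ℕ.m≤m⊔n 1 k) 1≤M))))
          (ℕ.≤-reflexive (N.solve 1 (λ x → N.con 40 N.:* x N.:+ (N.con 60 N.:* x N.:+ N.con 10 N.:* x) N.:= N.con 110 N.:* x) refl ((1 ℕ.⊔ k) ℕ.* ∣ M ∣))))
        where
        module N = +-*-Solver
        L′ : ∀ {j} → N.Polynomial j → N.Polynomial j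
        L′ k = N.con 2 N.:+ (N.con 2 N.:* (N.con 2 N.:+ k) N.:+ N.con 2 N.:* k)

    -- The value of a fresh entry is at least θ times the potentials of its slots, so no weight
    -- ratio enters. The other live entries amount to at most one for each slot.
    memory-slots : ∀ M k → IsMaximumCardinality b G M → 1# ≤ (1# + 4 · δ) ^ k * (4 · δ) → δ ≈ 4 · θ → 0# < θ →
                   memoryUsed (localRatio R δ θ) b G ℕ.≤ 345 ℕ.* (k ℕ.* ∣ M ∣ ℕ.+ Vec.sum (tabulate b))
    memory-slots M k max 1≤ δ≈ 0<θ = memory-by-live M _ _ max
      (λ {es} {H} !es r → ℕ.≤-trans (length-live (chain r))
        (ℕ.+-monoˡ-≤ Σb (length-kept M max !es r (fresh (pot H)) (suc L) λ s →
          slot-count (chain r) 0<δ (fresh (pot H)) L 0<θ 0≤1 1≤′ s λ {f} f∈H fr t → low (chain r) f∈H fr s t)))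
      arithmetic
      where
      β  = 1# + δ
      Σb = Vec.sum (tabulate b)
      -- The part `a` pays for (1 + 4δ)^k. As 4δ is 16θ and 16 is the fourth power of 2, the part
      -- `d` is taken four times.
      a  = 4 ℕ.* k
      d  = 4 ℕ.* (2 ℕ.+ k)
      L  = a ℕ.+ d ℕ.* 4
      0≤β : 0# ≤ β
      0≤β = +-nonNegative 0≤1 (proj₁ 0<δ)
      0≤4δ : 0# ≤ 4 · δ
      0≤4δ = 0≤k·x (proj₁ 0<δ) 4
      1≤′ : 1# ≤ β ^ L * θ
      1≤′ = ≤-trans 1≤
        (≤-trans (*-monoˡ-≤ 0≤4δ (1+p·x≤ 4 k (proj₁ 0<δ)))
        (≤-trans (≤-reflexive (*-cong ≈-refl (≈-trans (·≈* 4 δ) (*-cong ≈-refl δ≈))))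
        (≤-trans (≤-reflexive (solve 2 (λ x t → x :* ((con 1 :+ (con 1 :+ (con 1 :+ (con 1 :+ con 0)))) :* (t :+ (t :+ (t :+ (t :+ con 0)))))
            := (x :* ((con 1 :+ con 1) :* ((con 1 :+ con 1) :* ((con 1 :+ con 1) :* ((con 1 :+ con 1) :* con 1))))) :* t) ≈-refl (β ^ a) θ))
        (≤-trans (*-monoˡ-≤ 0≤θ (*-monoʳ-≤ (0≤x^k 0≤β a) (^-monoˡ-≤ 4 (+-nonNegative 0≤1 0≤1) (2≤power 4 k (proj₁ 0<δ) 1≤))))
          (≤-reflexive (*-cong (≈-trans (*-cong ≈-refl (^-assocʳ β d 4)) (≈-sym (^-homo-* β a (d ℕ.* 4)))) ≈-refl))))))
      low : ∀ {H} → Chain H → ∀ {f} → f ∈ H → fresh (pot H) f ≡ true → ∀ s → touches s f ≡ true → θ * pot H s ≤ 1# * value s f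
      low {H} ch {f} f∈H fr s t = ≤-trans (at (touches⁻ s f t)) (≤-reflexive (≈-sym (*-identityˡ _)))
        where
        stale = ∨-false⁻ (does (Entry.srcPot f ≤? θ * pot H (Entry.src f))) (not-injective fr)
        does-false : ∀ {x y} → does (x ≤? y) ≡ false → y ≤ x
        does-false {x} {y} h with no ¬p ← x ≤? y = ≰⇒≥ ¬p
        at : Entry.src f ≡ s ⊎ Entry.dst f ≡ s → θ * pot H s ≤ value s f
        at (inj₁ refl) = ≤-trans (does-false (proj₁ stale)) (≤-reflexive (≈-reflexive (≡.sym (value-src f))))
        at (inj₂ refl) = ≤-trans (does-false (proj₂ stale)) (≤-reflexive (≈-reflexive (≡.sym (value-dst f (src≢dstᶜ ch f∈H)))))
      -- Since `suc L` is 33 + 20k, the left side is 200k∣M∣ + 330∣M∣ + 10 + 5Σb. As k may be 0, the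
      -- terms 330∣M∣ and 10 are charged to Σb, which is at least ∣M∣; then 330 + 10 + 5 = 345.
      arithmetic : 1 ℕ.≤ ∣ M ∣ → 5 ℕ.* (∣ M ∣ ℕ.* (suc L ℕ.+ suc L) ℕ.+ Σb) ℕ.+ 10 ℕ.≤ 345 ℕ.* (k ℕ.* ∣ M ∣ ℕ.+ Σb)
      arithmetic 1≤M = ℕ.≤-trans (ℕ.≤-reflexive
          (N.solve 3 (λ M k S → N.con 5 N.:* (M N.:* (L′ k N.:+ L′ k) N.:+ S) N.:+ N.con 10
            N.:= (N.con 200 N.:* (k N.:* M) N.:+ (N.con 330 N.:* M N.:+ N.con 10 N.:* N.con 1)) N.:+ N.con 5 N.:* S) refl ∣ M ∣ k Σb))
        (ℕ.≤-trans (ℕ.+-monoˡ-≤ (5 ℕ.* Σb) (ℕ.+-mono-≤ (ℕ.*-monoˡ-≤ (k ℕ.* ∣ M ∣) (ℕ.m≤m+n 200 145))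
            (ℕ.+-mono-≤ (ℕ.*-monoʳ-≤ 330 M≤Σb) (ℕ.*-monoʳ-≤ 10 (ℕ.≤-trans 1≤M M≤Σb)))))
          (ℕ.≤-reflexive (N.solve 2 (λ x S → (N.con 345 N.:* x N.:+ (N.con 330 N.:* S N.:+ N.con 10 N.:* S)) N.:+ N.con 5 N.:* S
            N.:= N.con 345 N.:* (x N.:+ S)) refl (k ℕ.* ∣ M ∣) Σb)))
        where
        module N = +-*-Solver
        M≤Σb = bmatching-size M (proj₁ max)
        L′ : ∀ {j} → N.Polynomial j → N.Polynomial j
        L′ k = N.con 1 N.:+ (N.con 4 N.:* k N.:+ (N.con 4 N.:* (N.con 2 N.:+ k)) N.:* N.con 4)

-- The ratio 2 + ε for both choices of the parameters.

module Guarantees {c ℓ₁ ℓ₂} (R : ArchimedeanOrderedField c ℓ₁ ℓ₂) where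
  open OrderedField R
  open BMatching R
  open Parameters R
  open Solver using (solve; _:+_; _:*_; _:=_; con)

  approximates : ∀ {n m} (b : Fin n → ℕ) (G : Multigraph n m) {δ θ α} (0≤δ : 0# ≤ δ) (0≤θ : 0# ≤ θ) →
                 (∀ {S w} → 0# ≤ S → 0# ≤ w → S ≤ (w + θ * S) + (w + θ * S) → (1# + δ) * S ≤ α * w) →
                 IsApproximation b G α (output (localRatio R δ θ) b G)
  approximates b G 0≤δ 0≤θ enough =
    let bm , S , 0≤S , dual , primal = Bounds.approximation R b G _ 0≤δ _ 0≤θ
    in bm , λ N max → ≤-trans (dual N (proj₁ max)) (enough 0≤S (Bounds.totalWeight≥0 R b G _ 0≤δ _ 0≤θ (output (localRatio R _ _) b G)) primal)

  -- For θ = 0 the primal bound reads S ≤ 2w, and (1 + δ) times 2w is (2 + 2δ)w.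
  undropped : ∀ {δ ε S w} → 0# ≤ δ → 2 · δ ≈ ε → S ≤ (w + 0# * S) + (w + 0# * S) → (1# + δ) * S ≤ (1# + 1# + ε) * w
  undropped {δ} {ε} {S} {w} 0≤δ 2δ≈ε S≤ = ≤-trans (*-monoʳ-≤ (+-nonNegative 0≤1 0≤δ) S≤)
    (≤-reflexive (≈-trans
      (solve 3 (λ d s w → (con 1 :+ d) :* ((w :+ con 0 :* s) :+ (w :+ con 0 :* s))
        := (con 1 :+ con 1 :+ (d :+ (d :+ con 0))) :* w) ≈-refl δ S w)
      (*-cong (+-cong ≈-refl 2δ≈ε) ≈-refl)))

  -- Multiplied by 1 + 8θ, the primal bound gets the coefficient 2 + 16θ = 2 + ε′ at w. Collecting S
  -- on the left gives 1 + 6θ - 16θ², which is at least 1 + 4θ = 1 + δ because 16θ = ε′ is at most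
  -- 1.
  dropped : ∀ {δ θ ε ε′ S w} → 0# ≤ θ → 4 · δ ≈ ε′ → 4 · θ ≈ δ → ε′ ≤ 1# → ε′ ≤ ε → 0# ≤ S → 0# ≤ w →
            S ≤ (w + θ * S) + (w + θ * S) → (1# + δ) * S ≤ (1# + 1# + ε) * w
  dropped {δ} {θ} {ε} {ε′} {S} {w} 0≤θ 4δ≈ 4θ≈ ε′≤1 ε′≤ε 0≤S 0≤w S≤ =
    ≤-trans (*-monoˡ-≤ 0≤S (≤-reflexive (+-cong ≈-refl (≈-sym 4θ≈))))
    (≤-trans (≤-by-difference (+-mono-≤ scaled small)
      (solve 3 (λ t s w →
        (con 1 :+ 4· t) :* s :+ ((con 1 :+ (4· t :+ 4· t)) :* ((w :+ t :* s) :+ (w :+ t :* s)) :+ (con 1 :* (t :* s) :+ t :* s))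
        := (con 1 :+ con 1 :+ 4· (4· t)) :* w :+ ((con 1 :+ (4· t :+ 4· t)) :* s :+ 4· (4· t) :* (t :* s)))
        ≈-refl θ S w))
    (*-monoˡ-≤ 0≤w (+-monoʳ-≤ (1# + 1#) (≤-trans (≤-reflexive 16θ≈) ε′≤ε))))
    where
    4· : ∀ {n} → Solver.Polynomial n → Solver.Polynomial n
    4· x = x :+ (x :+ (x :+ (x :+ con 0)))
    16θ≈ : 4 · (4 · θ) ≈ ε′
    16θ≈ = ≈-trans (·-congʳ 4 4θ≈) 4δ≈
    0≤4θ : 0# ≤ 4 · θ
    0≤4θ = 0≤k·x 0≤θ 4
    scaled = *-monoʳ-≤ (+-nonNegative 0≤1 (+-nonNegative 0≤4θ 0≤4θ)) S≤
    small : 4 · (4 · θ) * (θ * S) ≤ 1# * (θ * S) + θ * S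
    small = ≤-trans (*-monoˡ-≤ (*-nonNegative 0≤θ 0≤S) (≤-trans (≤-reflexive 16θ≈) ε′≤1)) (x≤x+y (*-nonNegative 0≤θ 0≤S))

  -- Supplies the condition ε′ ≤ 1 of `dropped` by taking the minimum of ε and 1. When ε is at least
  -- 1, the condition on powers becomes 1 ≤ 2^k, true for every k.
  truncate : ∀ {ε} → 0# < ε → Σ[ ε′ ∈ Carrier ] 0# < ε′ × ε′ ≤ 1# × ε′ ≤ ε × (∀ k → 1# ÷ ε ≤ (1# + ε) ^ k → 1# ≤ (1# + ε′) ^ k * ε′)
  truncate {ε} 0<ε with total ε 1#
  ... | inj₁ ε≤1 = ε , 0<ε , ε≤1 , ≤-refl , λ k → x÷y≤z⇒x≤z*y 0<ε
  ... | inj₂ 1≤ε = 1# , 0<1 , ≤-refl , 1≤ε , λ k _ → ≤-trans (1≤x^k (x≤x+y 0≤1) k) (≤-reflexive (≈-sym (*-identityʳ _)))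

theorem1 : ∀ {c ℓ₁ ℓ₂} (R : ArchimedeanOrderedField c ℓ₁ ℓ₂) →
    let open ArchimedeanOrderedField R
        open BMatching R
    in
    (∃[ C ] ∀ ε → 0# < ε →
      Σ[ A ∈ StreamingAlgorithm ] ∀ {n m} (b : Fin n → ℕ) (G : Multigraph n m) →
        IsApproximation b G (1# + 1# + ε) (output A b G) ×
        (∀ (Mₘₐₓ : Subset m) (k : ℕ) →
          IsMaximumCardinality b G Mₘₐₓ →
          IsCeilLog (1# + ε) (Multigraph.maxRatio G ÷ ε) k →
          memoryUsed A b G ℕ.≤ C ℕ.* ((1 ℕ.⊔ k) ℕ.* ∣ Mₘₐₓ ∣)))
    ×
    (∃[ C ] ∀ ε → 0# < ε →
      Σ[ A ∈ StreamingAlgorithm ] ∀ {n m} (b : Fin n → ℕ) (G : Multigraph n m) →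
        IsApproximation b G (1# + 1# + ε) (output A b G) ×
        (∀ (Mₘₐₓ : Subset m) (k : ℕ) →
          IsMaximumCardinality b G Mₘₐₓ →
          IsCeilLog (1# + ε) (1# ÷ ε) k →
          memoryUsed A b G ℕ.≤ C ℕ.* (k ℕ.* ∣ Mₘₐₓ ∣ ℕ.+ Vec.sum (tabulate b))))
theorem1 R =
  (110 , λ ε 0<ε →
    let δ   = ε ÷ (2 · 1#)
        0<δ = 0<fraction 1 0<ε
        2δ≈ = fraction 1 ε
    in localRatio R δ 0# , λ b G →
       approximates b G (proj₁ 0<δ) ≤-refl (λ _ _ → undropped (proj₁ 0<δ) 2δ≈) ,
       λ M k max isLog → memory-ratio b G 0<δ ≤-refl M k max
         (≤-trans (x÷y≤z⇒x≤z*y 0<ε (proj₁ isLog))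
           (≤-reflexive (*-cong (^-congˡ k (+-cong ≈-refl (≈-sym 2δ≈))) (≈-sym 2δ≈))))) ,
  (345 , λ ε 0<ε →
    let ε′ , 0<ε′ , ε′≤1 , ε′≤ε , power = truncate 0<ε
        δ   = ε′ ÷ (4 · 1#)
        θ   = δ ÷ (4 · 1#)
        0<δ = 0<fraction 3 0<ε′
        0<θ = 0<fraction 3 0<δ
        4δ≈ = fraction 3 ε′
        4θ≈ = fraction 3 δ
    in localRatio R δ θ , λ b G →
       approximates b G (proj₁ 0<δ) (proj₁ 0<θ) (dropped (proj₁ 0<θ) 4δ≈ 4θ≈ ε′≤1 ε′≤ε) ,
       λ M k max isLog → memory-slots b G 0<δ (proj₁ 0<θ) M k max
         (≤-trans (power k (proj₁ isLog))
           (≤-reflexive (*-cong (^-congˡ k (+-cong ≈-refl (≈-sym 4δ≈))) (≈-sym 4δ≈))))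
         (≈-sym 4θ≈) 0<θ)
  where
  open OrderedField R
  open Parameters R
  open Guarantees R
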